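{- Let $T$ be a complete affine theory which has a first order model. Then the first order models of $T$ are exactly the extremal models of $T$, and the class of first order models of $T$ is the class of models of a complete first order theory (denoted $T_e$, the extremal theory of $T$).
   Context: Affine continuous logic: A Lipschitz language $L$ consists of constant, function and relation symbols together with a distinguished binary metric symbol $d$; each function and relation symbol carries a Lipschitz constant. An $L$-structure is a complete metric space $(M,d)$ with $d\le 1$ in which each constant symbol is an element, each $n$-ary function symbol $F$ is a $\lambda_F$-Lipschitz map $M^n\to M$ and each $n$-ary relation symbol $R$ is a $\lambda_R$-Lipschitz map $M^n\to[0,1]$ (where $M^n$ carries the metric $\sum_i d(x_i,y_i)$). Affine formulas are built from the constant $1$ and atomic formulas $R(t_1,\dots,t_n)$ ($R$ a relation symbol or $d$, $t_i$ terms) using only $r\cdot\phi$ ($r\in\mathbb R$), $\phi+\psi$, $\inf_x\phi$, $\sup_x\phi$; their values are real numbers. A condition is an expression $\phi\le\psi$; a theory is a set of closed conditions. Elementary equivalence and elementary substructure are defined with respect to the values of affine formulas. $T$ is complete if for every sentence $\phi$ there is a unique $r$ with $T\models\phi=r$. An $n$-type of $T$ is a maximal set of conditions in variables $\bar x=(x_1,\dots,x_n)$ satisfiable in a model of $T$; it is identified with the positive linear functional $\phi\mapsto p(\phi)$ (the value it forces for $\phi(\bar x)$) with $p(1)=1$. $S_n(T)$ is the set of $n$-types; it is convex and is compact in the logic topology (the coarsest topology making every $p\mapsto p(\phi)$ continuous). For a tuple $\bar a$ of $M\models T$, $tp(\bar a)$ is the type $\phi\mapsto\phi^M(\bar a)$.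 A type is extreme if it is an extreme point of $S_n(T)$. A model $M$ of $T$ is extremal if $tp(\bar a)$ is extreme for every finite tuple $\bar a$ of $M$. A first order model is an $L$-structure in which $d$ is the discrete $\{0,1\}$-valued metric and every relation symbol takes values in $\{0,1\}$; it is regarded as an ordinary first order structure (with $d$ read as equality and relations as their characteristic functions). -}

module Defs where

open import Level using (0ℓ) renaming (suc to lsuc)
open import Algebra.Bundles using (CommutativeRing)
import Algebra.Properties.Ring as RingProperties
open import Data.Empty using (⊥)
open import Data.Fin.Base using (Fin)
open import Data.Nat.Base as ℕ using (ℕ; suc)
open import Data.Product using (Σ; ∃; ∃-syntax; ∃!; _×_; _,_; proj₁; proj₂)
open import Data.Sum.Base using (_⊎_; inj₁; inj₂)
open import Data.Vec.Base using (Vec; []; _∷_; lookup)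
open import Data.Vec.Relation.Binary.Pointwise.Inductive using (Pointwise; []; _∷_)
import Data.Vec.Base as Vec
open import Function.Bundles using (_⇔_)
open import Function.Definitions using (Congruent; Injective; Surjective)
open import Function.Metric.Structures using (IsGeneralMetric)
open import Relation.Binary.Core using (Rel)
open import Relation.Binary.Structures using (IsEquivalence; IsTotalOrder)
import Relation.Binary.Construct.NonStrictToStrict as ToStrict
open import Relation.Nullary.Negation using (¬_)
open import Relation.Unary using (Pred; _∈_; _⊆_; _≐_)

-- The reals are determined up to unique isomorphism as the Dedekind
-- complete ordered field, and enter the development through that
-- characterisation.
record CompleteOrderedField : Set₁ where
  field
    commutativeRing : CommutativeRing 0ℓ 0ℓ
  open CommutativeRing commutativeRing public

  infix 4 _≤_
  field
    _≤_          : Rel Carrier 0ℓ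
    isTotalOrder : IsTotalOrder _≈_ _≤_
    +-monoˡ-≤    : ∀ {x y} z → x ≤ y → x + z ≤ y + z
    *-nonneg     : ∀ {x y} → 0# ≤ x → 0# ≤ y → 0# ≤ x * y
    0≉1          : ¬ (0# ≈ 1#)
    inverse      : ∀ x → ¬ (x ≈ 0#) → ∃[ y ] x * y ≈ 1#

  UpperBound : Pred Carrier 0ℓ → Pred Carrier 0ℓ
  UpperBound P b = ∀ {x} → P x → x ≤ b

  IsLeastUpperBound : Pred Carrier 0ℓ → Pred Carrier 0ℓ
  IsLeastUpperBound P s = UpperBound P s × (∀ {b} → UpperBound P b → s ≤ b)

  field
    complete : (P : Pred Carrier 0ℓ) → ∃ P → ∃ (UpperBound P) →
               ∃ (IsLeastUpperBound P)

  open IsTotalOrder isTotalOrder public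
    using (total; antisym; isPartialOrder)
    renaming (refl to ≤-refl; trans to ≤-trans; reflexive to ≤-reflexive)
  open ToStrict _≈_ _≤_ public using (_<_)
  open RingProperties ring public
    using (-‿involutive; -‿distribˡ-*; -‿distribʳ-*; -0#≈0#)

  ≤-resp : ∀ {x x′ y y′} → x ≈ x′ → y ≈ y′ → x ≤ y → x′ ≤ y′
  ≤-resp p q x≤y = ≤-trans (≤-reflexive (sym p)) (≤-trans x≤y (≤-reflexive q))

  +-mono-≤ : ∀ {x y u v} → x ≤ y → u ≤ v → x + u ≤ y + v
  +-mono-≤ {x} {y} {u} {v} p q =
    ≤-trans (+-monoˡ-≤ u p) (≤-resp (+-comm u y) (+-comm v y) (+-monoˡ-≤ y q))

  x≤y⇒0≤y-x : ∀ {x y} → x ≤ y → 0# ≤ y - x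
  x≤y⇒0≤y-x {x} p = ≤-resp (-‿inverseʳ x) refl (+-monoˡ-≤ (- x) p)

  y-x+x≈y : ∀ x y → (y - x) + x ≈ y
  y-x+x≈y x y = trans (+-assoc y (- x) x)
                  (trans (+-congˡ (-‿inverseˡ x)) (+-identityʳ y))

  0≤y-x⇒x≤y : ∀ {x y} → 0# ≤ y - x → x ≤ y
  0≤y-x⇒x≤y {x} {y} p = ≤-resp (+-identityˡ x) (y-x+x≈y x y) (+-monoˡ-≤ x p)

  neg-antitone : ∀ {x y} → x ≤ y → - y ≤ - x
  neg-antitone {x} {y} p = 0≤y-x⇒x≤y
    (≤-resp refl
      (trans (+-comm y (- x)) (+-congˡ (sym (-‿involutive y))))
      (x≤y⇒0≤y-x p))

  *-monoˡ-≤ : ∀ {r x y} → 0# ≤ r → x ≤ y → r * x ≤ r * y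
  *-monoˡ-≤ {r} {x} {y} 0≤r p = 0≤y-x⇒x≤y
    (≤-resp refl
      (trans (distribˡ r y (- x)) (+-congˡ (sym (-‿distribʳ-* r x))))
      (*-nonneg 0≤r (x≤y⇒0≤y-x p)))

  *-antitoneˡ-≤ : ∀ {r x y} → r ≤ 0# → x ≤ y → r * y ≤ r * x
  *-antitoneˡ-≤ {r} {x} {y} r≤0 p =
    ≤-resp (back y) (back x)
      (neg-antitone (*-monoˡ-≤ (≤-resp -0#≈0# refl (neg-antitone r≤0)) p))
    where
    back : ∀ z → - (- r * z) ≈ r * z
    back z = trans (-‿cong (sym (-‿distribˡ-* r z))) (-‿involutive (r * z))

  BoundedAbove : {A : Set} → (A → Carrier) → Set
  BoundedAbove f = ∃[ u ] ∀ a → f a ≤ u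

  BoundedBelow : {A : Set} → (A → Carrier) → Set
  BoundedBelow f = ∃[ l ] ∀ a → l ≤ f a

  private
    supremum : {A : Set} (f : A → Carrier) → A → BoundedAbove f →
               ∃ (IsLeastUpperBound λ y → ∃[ a ] y ≈ f a)
    supremum f a (u , f≤u) = complete _ (f a , a , refl)
      (u , λ (b , y≈fb) → ≤-trans (≤-reflexive y≈fb) (f≤u b))

  -- The element of A witnesses that the range of f is inhabited.
  ⨆ : {A : Set} (f : A → Carrier) → A → BoundedAbove f → Carrier
  ⨆ f a b = proj₁ (supremum f a b)

  ⨆-upper : {A : Set} (f : A → Carrier) (a : A) (b : BoundedAbove f) →
            ∀ x → f x ≤ ⨆ f a b
  ⨆-upper f a b x = proj₁ (proj₂ (supremum f a b)) (x , refl)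

  ⨆-least : {A : Set} (f : A → Carrier) (a : A) (b : BoundedAbove f) →
            ∀ {u} → (∀ x → f x ≤ u) → ⨆ f a b ≤ u
  ⨆-least f a b f≤u = proj₂ (proj₂ (supremum f a b))
    λ (x , y≈fx) → ≤-trans (≤-reflexive y≈fx) (f≤u x)

  neg-bounded : {A : Set} {f : A → Carrier} →
                BoundedBelow f → BoundedAbove (λ a → - f a)
  neg-bounded (l , l≤f) = - l , λ a → neg-antitone (l≤f a)

  ⨅ : {A : Set} (f : A → Carrier) → A → BoundedBelow f → Carrier
  ⨅ f a b = - ⨆ (λ x → - f x) a (neg-bounded b)

  ⨅-lower : {A : Set} (f : A → Carrier) (a : A) (b : BoundedBelow f) →
            ∀ x → ⨅ f a b ≤ f x
  ⨅-lower f a b x = ≤-resp refl (-‿involutive (f x))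
    (neg-antitone (⨆-upper (λ x → - f x) a (neg-bounded b) x))

  ⨅-greatest : {A : Set} (f : A → Carrier) (a : A) (b : BoundedBelow f) →
               ∀ {l} → (∀ x → l ≤ f x) → l ≤ ⨅ f a b
  ⨅-greatest f a b {l} l≤f = ≤-resp (-‿involutive l) refl
    (neg-antitone (⨆-least (λ x → - f x) a (neg-bounded b)
                           (λ x → neg-antitone (l≤f x))))

module _ (R : CompleteOrderedField) where
  open CompleteOrderedField R

  -- As usual without quotients, the underlying set carries an equality
  -- _≈ₘ_; isMetric makes it coincide with being at distance 0.
  record CompleteMetricSpace : Set₁ where
    infix 4 _≈ₘ_
    field
      M        : Set
      _≈ₘ_     : Rel M 0ℓ
      point    : M
      d        : M → M → Carrier
      isMetric : IsGeneralMetric _≈ₘ_ _≈_ _≤_ 0# _+_ d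
      d≤1      : ∀ x y → d x y ≤ 1#

    Cauchy : (ℕ → M) → Set
    Cauchy s = ∀ {ε} → 0# < ε →
      ∃[ N ] ∀ i j → N ℕ.≤ i → N ℕ.≤ j → d (s i) (s j) ≤ ε

    ConvergesTo : (ℕ → M) → M → Set
    ConvergesTo s x = ∀ {ε} → 0# < ε → ∃[ N ] ∀ i → N ℕ.≤ i → d (s i) x ≤ ε

    field
      cauchy-complete : ∀ s → Cauchy s → ∃ (ConvergesTo s)

    -- the metric Σᵢ d(xᵢ, yᵢ) on Mⁿ
    dⁿ : ∀ {n} → Vec M n → Vec M n → Carrier
    dⁿ []       []       = 0#
    dⁿ (x ∷ xs) (y ∷ ys) = d x y + dⁿ xs ys

    module Metric = IsGeneralMetric isMetric

record Language (R : CompleteOrderedField) : Set₁ where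
  open CompleteOrderedField R
  field
    Const Fun Rel′ : Set
    arityᶠ : Fun → ℕ
    arityʳ : Rel′ → ℕ
    lipᶠ   : Fun → Carrier
    lipʳ   : Rel′ → Carrier
    lipᶠ≥0 : ∀ F → 0# ≤ lipᶠ F
    lipʳ≥0 : ∀ P → 0# ≤ lipʳ P

module _ {R : CompleteOrderedField} (L : Language R) where
  open Language L

  data Term (n : ℕ) : Set where
    var : Fin n → Term n
    con : Const → Term n
    fun : (F : Fun) → Vec (Term n) (arityᶠ F) → Term n

module _ {R : CompleteOrderedField} (L : Language R) where
  open CompleteOrderedField R
  open Language L

  record Structure : Set₁ where
    field
      space : CompleteMetricSpace R
    open CompleteMetricSpace space public
    field
      ⟦_⟧ᶜ  : Const → M
      ⟦_⟧ᶠ  : (F : Fun) → Vec M (arityᶠ F) → M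
      ⟦_⟧ʳ  : (P : Rel′) → Vec M (arityʳ P) → Carrier
      lipschitzᶠ : ∀ F xs ys →
        d (⟦ F ⟧ᶠ xs) (⟦ F ⟧ᶠ ys) ≤ lipᶠ F * dⁿ xs ys
      -- One-sided, but imposed on (xs , ys) and on (ys , xs).
      lipschitzʳ : ∀ P xs ys →
        ⟦ P ⟧ʳ xs - ⟦ P ⟧ʳ ys ≤ lipʳ P * dⁿ xs ys
      0≤rel : ∀ P xs → 0# ≤ ⟦ P ⟧ʳ xs
      rel≤1 : ∀ P xs → ⟦ P ⟧ʳ xs ≤ 1#

    ⟦_⟧ₜ  : ∀ {n} → Term L n → Vec M n → M
    ⟦_⟧ₜₛ : ∀ {n k} → Vec (Term L n) k → Vec M n → Vec M k
    ⟦ var i ⟧ₜ    ρ = lookup ρ i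
    ⟦ con c ⟧ₜ    ρ = ⟦ c ⟧ᶜ
    ⟦ fun F ts ⟧ₜ ρ = ⟦ F ⟧ᶠ (⟦ ts ⟧ₜₛ ρ)
    ⟦ [] ⟧ₜₛ      ρ = []
    ⟦ t ∷ ts ⟧ₜₛ  ρ = ⟦ t ⟧ₜ ρ ∷ ⟦ ts ⟧ₜₛ ρ

  record IsFirstOrder (𝓜 : Structure) : Set where
    open Structure 𝓜
    field
      d-discrete : ∀ x y → (d x y ≈ 0#) ⊎ (d x y ≈ 1#)
      rel-binary : ∀ P xs → (⟦ P ⟧ʳ xs ≈ 0#) ⊎ (⟦ P ⟧ʳ xs ≈ 1#)

  infix  4 _≼_
  infixl 6 _⊕_
  infixr 7 _·_

  -- Formulas with free variables among x₀,…,xₙ₋₁ (de Bruijn indices).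
  data Formula (n : ℕ) : Set where
    𝟙    : Formula n
    rel  : (P : Rel′) → Vec (Term L n) (arityʳ P) → Formula n
    dist : Term L n → Term L n → Formula n
    _·_  : Carrier → Formula n → Formula n
    _⊕_  : Formula n → Formula n → Formula n
    inf  : Formula (suc n) → Formula n
    sup  : Formula (suc n) → Formula n

  data Condition (n : ℕ) : Set where
    _≼_ : Formula n → Formula n → Condition n

  Sentence : Set
  Sentence = Formula 0

  Theory : Set₁
  Theory = Pred (Condition 0) 0ℓ

module _ {R : CompleteOrderedField} {L : Language R} where
  open CompleteOrderedField R
  open Language L

  module Semantics (𝓜 : Structure L) where
    open Structure 𝓜

    -- Values are defined together with bounds for them, as ⨅ and ⨆ exist
    -- only for bounded families.
    ⟦_⟧   : ∀ {n} → Formula L n → Vec M n → Carrier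
    lower : ∀ {n} (φ : Formula L n) → BoundedBelow ⟦ φ ⟧
    upper : ∀ {n} (φ : Formula L n) → BoundedAbove ⟦ φ ⟧

    lower∷ : ∀ {n} (φ : Formula L (suc n)) ρ → BoundedBelow λ m → ⟦ φ ⟧ (m ∷ ρ)
    lower∷ φ ρ = proj₁ (lower φ) , λ m → proj₂ (lower φ) (m ∷ ρ)

    upper∷ : ∀ {n} (φ : Formula L (suc n)) ρ → BoundedAbove λ m → ⟦ φ ⟧ (m ∷ ρ)
    upper∷ φ ρ = proj₁ (upper φ) , λ m → proj₂ (upper φ) (m ∷ ρ)

    ⟦ 𝟙 ⟧        ρ = 1#
    ⟦ rel P ts ⟧ ρ = ⟦ P ⟧ʳ (⟦ ts ⟧ₜₛ ρ)
    ⟦ dist s t ⟧ ρ = d (⟦ s ⟧ₜ ρ) (⟦ t ⟧ₜ ρ)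
    ⟦ r · φ ⟧    ρ = r * ⟦ φ ⟧ ρ
    ⟦ φ ⊕ ψ ⟧    ρ = ⟦ φ ⟧ ρ + ⟦ ψ ⟧ ρ
    ⟦ inf φ ⟧    ρ = ⨅ (λ m → ⟦ φ ⟧ (m ∷ ρ)) point (lower∷ φ ρ)
    ⟦ sup φ ⟧    ρ = ⨆ (λ m → ⟦ φ ⟧ (m ∷ ρ)) point (upper∷ φ ρ)

    lower 𝟙          = 1# , λ _ → ≤-refl
    lower (rel P ts) = 0# , λ _ → 0≤rel P _
    lower (dist s t) = 0# , λ _ → Metric.nonNegative
    lower (r · φ) with total 0# r
    ... | inj₁ 0≤r = r * proj₁ (lower φ) , λ ρ → *-monoˡ-≤ 0≤r (proj₂ (lower φ) ρ)
    ... | inj₂ r≤0 = r * proj₁ (upper φ) , λ ρ → *-antitoneˡ-≤ r≤0 (proj₂ (upper φ) ρ)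
    lower (φ ⊕ ψ) = proj₁ (lower φ) + proj₁ (lower ψ) ,
      λ ρ → +-mono-≤ (proj₂ (lower φ) ρ) (proj₂ (lower ψ) ρ)
    lower (inf φ) = proj₁ (lower φ) , λ ρ →
      ⨅-greatest _ point (lower∷ φ ρ) λ m → proj₂ (lower φ) (m ∷ ρ)
    lower (sup φ) = proj₁ (lower φ) , λ ρ →
      ≤-trans (proj₂ (lower φ) (point ∷ ρ)) (⨆-upper _ point (upper∷ φ ρ) point)

    upper 𝟙          = 1# , λ _ → ≤-refl
    upper (rel P ts) = 1# , λ _ → rel≤1 P _
    upper (dist s t) = 1# , λ _ → d≤1 _ _
    upper (r · φ) with total 0# r
    ... | inj₁ 0≤r = r * proj₁ (upper φ) , λ ρ → *-monoˡ-≤ 0≤r (proj₂ (upper φ) ρ)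
    ... | inj₂ r≤0 = r * proj₁ (lower φ) , λ ρ → *-antitoneˡ-≤ r≤0 (proj₂ (lower φ) ρ)
    upper (φ ⊕ ψ) = proj₁ (upper φ) + proj₁ (upper ψ) ,
      λ ρ → +-mono-≤ (proj₂ (upper φ) ρ) (proj₂ (upper ψ) ρ)
    upper (inf φ) = proj₁ (upper φ) , λ ρ →
      ≤-trans (⨅-lower _ point (lower∷ φ ρ) point) (proj₂ (upper φ) (point ∷ ρ))
    upper (sup φ) = proj₁ (upper φ) , λ ρ →
      ⨆-least _ point (upper∷ φ ρ) λ m → proj₂ (upper φ) (m ∷ ρ)

  infix 4 _,_⊨ᶜ_ _⊨_ _⊨_==_

  _,_⊨ᶜ_ : ∀ {n} (𝓜 : Structure L) → Vec (Structure.M 𝓜) n → Condition L n → Set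
  𝓜 , ρ ⊨ᶜ (φ ≼ ψ) = ⟦ φ ⟧ ρ ≤ ⟦ ψ ⟧ ρ
    where open Semantics 𝓜

  _⊨_ : Structure L → Theory L → Set
  𝓜 ⊨ T = ∀ {c} → c ∈ T → 𝓜 , [] ⊨ᶜ c

  _⊨_==_ : Theory L → Sentence L → Carrier → Set₁
  T ⊨ φ == r = ∀ 𝓜 → 𝓜 ⊨ T → Semantics.⟦_⟧ 𝓜 φ [] ≈ r

  Complete : Theory L → Set₁
  Complete T = ∀ φ → ∃! _≈_ λ r → T ⊨ φ == r

  SatisfiableIn : Theory L → ∀ {n} → Pred (Condition L n) 0ℓ → Set₁
  SatisfiableIn T {n} Γ = Σ (Structure L) λ 𝓜 → (𝓜 ⊨ T) ×
    Σ (Vec (Structure.M 𝓜) n) λ ρ → ∀ {c} → c ∈ Γ → 𝓜 , ρ ⊨ᶜ c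

  record Type (T : Theory L) (n : ℕ) : Set₁ where
    field
      conditions  : Pred (Condition L n) 0ℓ
      satisfiable : SatisfiableIn T conditions
      maximal     : ∀ {Γ} → SatisfiableIn T Γ → conditions ⊆ Γ → Γ ⊆ conditions

  open Type public

  infix 4 _≈ᵗ_ _⟨_⟩==_

  _≈ᵗ_ : ∀ {T n} → Type T n → Type T n → Set
  p ≈ᵗ q = conditions p ≐ conditions q

  -- p ⟨ φ ⟩== r : the type p, viewed as a linear functional, takes the
  -- value r at φ, i.e. the condition φ = r belongs to p.
  _⟨_⟩==_ : ∀ {T n} → Type T n → Formula L n → Carrier → Set
  p ⟨ φ ⟩== r = conditions p (φ ≼ r · 𝟙) × conditions p (r · 𝟙 ≼ φ)

  IsConvexCombination : ∀ {T n} → Carrier → (p q s : Type T n) → Set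
  IsConvexCombination t p q s = ∀ φ {a b} → q ⟨ φ ⟩== a → s ⟨ φ ⟩== b →
    p ⟨ φ ⟩== (t * a + (1# - t) * b)

  Extreme : ∀ {T n} → Type T n → Set₁
  Extreme {T} {n} p = ∀ (q s : Type T n) t → 0# < t → t < 1# →
    IsConvexCombination t p q s → (q ≈ᵗ p) × (s ≈ᵗ p)

  tp : ∀ {T n} (𝓜 : Structure L) → 𝓜 ⊨ T → Vec (Structure.M 𝓜) n → Type T n
  tp 𝓜 𝓜⊨T ρ .conditions c = 𝓜 , ρ ⊨ᶜ c
  tp 𝓜 𝓜⊨T ρ .satisfiable  = 𝓜 , 𝓜⊨T , ρ , λ c → c
  tp 𝓜 𝓜⊨T ρ .maximal {Γ} (𝓝 , _ , σ , 𝓝⊨Γ) tp⊆Γ {φ ≼ ψ} φ≼ψ∈Γ =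
    ≤-resp (same φ) (same ψ) (𝓝⊨Γ φ≼ψ∈Γ)
    where
    module 𝓜 = Semantics 𝓜
    module 𝓝 = Semantics 𝓝
    same : ∀ χ → 𝓝.⟦ χ ⟧ σ ≈ 𝓜.⟦ χ ⟧ ρ
    same χ = antisym
      (≤-resp refl (*-identityʳ r)
        (𝓝⊨Γ {χ ≼ r · 𝟙} (tp⊆Γ {χ ≼ r · 𝟙} (≤-reflexive (sym (*-identityʳ r))))))
      (≤-resp (*-identityʳ r) refl
        (𝓝⊨Γ {r · 𝟙 ≼ χ} (tp⊆Γ {r · 𝟙 ≼ χ} (≤-reflexive (*-identityʳ r)))))
      where r = 𝓜.⟦ χ ⟧ ρ

  Extremal : (T : Theory L) (𝓜 : Structure L) → 𝓜 ⊨ T → Set₁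
  Extremal T 𝓜 𝓜⊨T = ∀ {n} (ρ : Vec (Structure.M 𝓜) n) → Extreme {T} (tp 𝓜 𝓜⊨T ρ)

module _ {R : CompleteOrderedField} (L : Language R) where
  open Language L

  infixr 5 _⇒′_
  infixr 6 _∨′_
  infixr 7 _∧′_
  infix  8 _≐′_

  data FOFormula (n : ℕ) : Set where
    _≐′_           : Term L n → Term L n → FOFormula n
    rel            : (P : Rel′) → Vec (Term L n) (arityʳ P) → FOFormula n
    ⊥′             : FOFormula n
    _∧′_ _∨′_ _⇒′_ : FOFormula n → FOFormula n → FOFormula n
    ∀′ ∃′          : FOFormula (suc n) → FOFormula n

  FOSentence : Set
  FOSentence = FOFormula 0

  FOTheory : Set₁
  FOTheory = Pred FOSentence 0ℓ

  -- Equality symbols are interpreted by the equality of the setoid.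
  record FOStructure : Set₁ where
    infix 4 _≈ₐ_
    field
      A             : Set
      _≈ₐ_          : Rel A 0ℓ
      isEquivalence : IsEquivalence _≈ₐ_
      point         : A
      constᴬ        : Const → A
      funᴬ          : (F : Fun) → Vec A (arityᶠ F) → A
      relᴬ          : (P : Rel′) → Pred (Vec A (arityʳ P)) 0ℓ
      fun-cong      : ∀ F {xs ys} → Pointwise _≈ₐ_ xs ys → funᴬ F xs ≈ₐ funᴬ F ys
      rel-resp      : ∀ P {xs ys} → Pointwise _≈ₐ_ xs ys → relᴬ P xs → relᴬ P ys

    ⟦_⟧ₜ  : ∀ {n} → Term L n → Vec A n → A
    ⟦_⟧ₜₛ : ∀ {n k} → Vec (Term L n) k → Vec A n → Vec A k
    ⟦ var i ⟧ₜ    ρ = lookup ρ i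
    ⟦ con c ⟧ₜ    ρ = constᴬ c
    ⟦ fun F ts ⟧ₜ ρ = funᴬ F (⟦ ts ⟧ₜₛ ρ)
    ⟦ [] ⟧ₜₛ      ρ = []
    ⟦ t ∷ ts ⟧ₜₛ  ρ = ⟦ t ⟧ₜ ρ ∷ ⟦ ts ⟧ₜₛ ρ

    Sat : ∀ {n} → FOFormula n → Vec A n → Set
    Sat (s ≐′ t)   ρ = ⟦ s ⟧ₜ ρ ≈ₐ ⟦ t ⟧ₜ ρ
    Sat (rel P ts) ρ = relᴬ P (⟦ ts ⟧ₜₛ ρ)
    Sat ⊥′         ρ = ⊥
    Sat (φ ∧′ ψ)   ρ = Sat φ ρ × Sat ψ ρ
    Sat (φ ∨′ ψ)   ρ = Sat φ ρ ⊎ Sat ψ ρ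
    Sat (φ ⇒′ ψ)   ρ = Sat φ ρ → Sat ψ ρ
    Sat (∀′ φ)     ρ = ∀ a → Sat φ (a ∷ ρ)
    Sat (∃′ φ)     ρ = ∃[ a ] Sat φ (a ∷ ρ)

module _ {R : CompleteOrderedField} {L : Language R} where
  open CompleteOrderedField R
  open Language L

  infix 4 _⊨ᶠᵒ_ _⊩ᶠᵒ_ _≅_

  _⊨ᶠᵒ_ : FOStructure L → FOTheory L → Set
  𝓐 ⊨ᶠᵒ Γ = ∀ {σ} → σ ∈ Γ → FOStructure.Sat 𝓐 σ []

  _⊩ᶠᵒ_ : FOTheory L → FOSentence L → Set₁
  Γ ⊩ᶠᵒ σ = ∀ 𝓐 → 𝓐 ⊨ᶠᵒ Γ → FOStructure.Sat 𝓐 σ []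

  FOComplete : FOTheory L → Set₁
  FOComplete Γ = (∃[ 𝓐 ] 𝓐 ⊨ᶠᵒ Γ) ×
                 (∀ σ → (Γ ⊩ᶠᵒ σ) ⊎ (Γ ⊩ᶠᵒ (σ ⇒′ ⊥′)))

  record _≅_ (𝓐 𝓑 : FOStructure L) : Set where
    private
      module A = FOStructure 𝓐
      module B = FOStructure 𝓑
    field
      to         : A.A → B.A
      congruent  : Congruent A._≈ₐ_ B._≈ₐ_ to
      injective  : Injective A._≈ₐ_ B._≈ₐ_ to
      surjective : Surjective A._≈ₐ_ B._≈ₐ_ to
      const-homo : ∀ c → to (A.constᴬ c) B.≈ₐ B.constᴬ c
      fun-homo   : ∀ F xs → to (A.funᴬ F xs) B.≈ₐ B.funᴬ F (Vec.map to xs)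
      rel-homo   : ∀ P xs → A.relᴬ P xs ⇔ B.relᴬ P (Vec.map to xs)

  -- A first order L-structure regarded as an ordinary one: d(x,y) = 0 is
  -- equality, and P holds of a tuple when its value there is 1.
  asFO : (𝓜 : Structure L) → IsFirstOrder L 𝓜 → FOStructure L
  asFO 𝓜 _ = record
    { A             = M
    ; _≈ₐ_          = _≈ₘ_
    ; isEquivalence = Metric.≈-isEquivalence
    ; point         = point
    ; constᴬ        = ⟦_⟧ᶜ
    ; funᴬ          = ⟦_⟧ᶠ
    ; relᴬ          = λ P xs → ⟦ P ⟧ʳ xs ≈ 1#
    ; fun-cong      = λ F p → Metric.0⇒≈ (antisym
        (≤-resp refl (lip-0 (lipᶠ F) p) (lipschitzᶠ F _ _)) Metric.nonNegative)
    ; rel-resp      = λ P p xs∈P → antisym (rel≤1 P _)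
        (≤-resp xs∈P refl (below P p))
    }
    where
    open Structure 𝓜

    dⁿ-0 : ∀ {n} {xs ys : Vec M n} → Pointwise _≈ₘ_ xs ys → dⁿ xs ys ≈ 0#
    dⁿ-0 []       = refl
    dⁿ-0 (p ∷ ps) = trans (+-cong (Metric.≈⇒0 p) (dⁿ-0 ps)) (+-identityˡ 0#)

    lip-0 : ∀ l {n} {xs ys : Vec M n} → Pointwise _≈ₘ_ xs ys → l * dⁿ xs ys ≈ 0#
    lip-0 l p = trans (*-congˡ (dⁿ-0 p)) (zeroʳ l)

    below : ∀ P {xs ys} → Pointwise _≈ₘ_ xs ys → ⟦ P ⟧ʳ xs ≤ ⟦ P ⟧ʳ ys
    below P {xs} {ys} p = ≤-resp (y-x+x≈y _ _) (+-identityˡ _)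
      (+-monoˡ-≤ (⟦ P ⟧ʳ ys) (≤-resp refl (lip-0 (lipʳ P) p) (lipschitzʳ P xs ys)))

{-# OPTIONS --safe #-}

-- First order structures realise only extreme types, because quantified affine
-- formulas are controlled at each of their tuples: there is an affine χ which
-- vanishes at a and satisfies |φ - φ(a)| ≤ χ in all structures. For {0,1}-valued
-- atomic φ take φ or 1 - φ, and for inf φ combine inf χ with the difference of
-- inf φ from its value. If the type of a is a convex combination, then χ, being
-- nonnegative, vanishes on both parts, which therefore give φ the value φ(a).
--
-- Conversely, evaluation at a type of T extends to a mean on bounded functions on
-- the tuples of the given first order model 𝓜₀ (Hahn-Banach). A formula with
-- values 0 and 1 in 𝓜₀ which takes an intermediate value at the type splits this
-- mean in two, and the ultrameans of 𝓜₀ along the two pieces realise types of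
-- which the given one is a proper convex combination.
--
-- The extremal theory is the first order theory of 𝓜₀. Its models are discrete
-- structures with the same values of affine sentences as 𝓜₀, since affine formulas
-- have finitely many values in first order structures, uniformly, and each value is
-- first order definable. First order models of T satisfy it by a back and forth
-- argument: controls have only finitely many shapes for each formula, so agreement
-- of tuples on finitely many affine formulas can be tested by infima of controls.
module Submission where

open import Defs
open import Level using (0ℓ)
import Algebra.Properties.Ring as RingProperties
import Algebra.Properties.Semiring.Mult.TCOptimised as Mult
import Algebra.Solver.Ring as RingSolver
open import Algebra.Solver.Ring.AlmostCommutativeRing using (fromCommutativeRing; _-Raw-AlmostCommutative⟶_)
open import Axiom.ExcludedMiddle using (ExcludedMiddle)
open import Axiom.Extensionality.Propositional using (Extensionality)
open import Data.Bool.Base using (Bool; true)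
open import Data.Empty using (⊥-elim)
open import Data.Fin.Base using (Fin; zero; suc; _↑ˡ_; _↑ʳ_)
open import Data.Integer.Base as ℤ using (ℤ; +_; -[1+_])
import Data.Integer.Properties as ℤ
open import Data.List.Base as List using (List; []; _∷_; _++_; cartesianProductWith)
open import Data.List.Relation.Unary.All as All using (All; []; _∷_)
import Data.List.Relation.Unary.All.Properties as All
open import Data.List.Relation.Unary.Any as Any using (Any; here; there)
import Data.List.Relation.Unary.Any.Properties as Any
open import Data.Maybe.Base using (Maybe; just; nothing)
open import Data.Nat.Base as ℕ using (ℕ; zero; suc)
import Data.Nat.Properties as ℕ
open import Data.Product using (Σ; ∃; ∃-syntax; _×_; _,_; proj₁; proj₂)
open import Data.Sum.Base as Sum using (_⊎_; inj₁; inj₂)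
open import Data.Vec.Base as Vec using (Vec; []; _∷_; lookup)
import Data.Vec.Properties as Vec
open import Data.Vec.Relation.Binary.Pointwise.Inductive as Pointwise using (Pointwise; []; _∷_)
open import Function.Base using (_∘_; id)
open import Function.Bundles using (_⇔_; mk⇔; Equivalence)
open import Relation.Binary.Core using (Rel)
open import Relation.Binary.Definitions using (Reflexive; Transitive)
open import Relation.Binary.PropositionalEquality as ≡ using (_≡_)
open import Relation.Binary.Structures using (IsEquivalence)
open import Relation.Nullary using (¬_; Dec; yes; no; contradiction; does)
open import Relation.Nullary.Decidable using (True; toWitness; fromWitness)
open import Relation.Unary using (Pred)

-- Hahn-Banach rests on a Bourbaki-Witt fixed point: excluded middle returns witnesses and so acts
-- as a choice operator, which yields a step that lowers every sublinear functional that is not odd.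
-- The fixed point theorem requires this step to agree on functionals with equal values, but
-- equality of reals is only a relation; this is why canonical representatives of reals appear.
-- Ultrameans take over the role of compactness. A mean is only finitely additive and no
-- measurability is asked of families, so near-witnesses of an infimum, chosen index by index, are
-- again elements; this is the heart of the step for `inf` in Łoś's theorem. All limits run at one
-- geometric rate, so that error constants are computed and never chosen. Turning a model of the
-- extremal theory into an L-structure meets an obstacle: Lipschitz constants are not first order
-- data. With discrete metrics, a constant of at least 1 imposes nothing, while a smaller one forces
-- the symbol to be constant, and constancy is a first order sentence.

-- Arithmetic of a complete ordered field

module IntegerSolver (R : CompleteOrderedField) where
  open CompleteOrderedField R
  open Mult semiring using (×1-homo-*; ×-homo-+; 1+×) renaming (_×_ to _∙_)
  open RingProperties ring using (-‿+-comm)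

  private
    ⟪_⟫ : ℤ → Carrier
    ⟪ + n ⟫      = n ∙ 1#
    ⟪ -[1+ n ] ⟫ = - (suc n ∙ 1#)

    open import Relation.Binary.Reasoning.Setoid setoid

    ⊖-homo : ∀ m n → ⟪ m ℤ.⊖ n ⟫ ≈ m ∙ 1# - n ∙ 1#
    ⊖-homo m       zero    = sym (trans (+-congˡ -0#≈0#) (+-identityʳ _))
    ⊖-homo zero    (suc n) = sym (+-identityˡ _)
    ⊖-homo (suc m) (suc n) = begin
      ⟪ suc m ℤ.⊖ suc n ⟫                    ≡⟨ ≡.cong ⟪_⟫ (ℤ.[1+m]⊖[1+n]≡m⊖n m n) ⟩
      ⟪ m ℤ.⊖ n ⟫                            ≈⟨ ⊖-homo m n ⟩
      m ∙ 1# - n ∙ 1#                        ≈⟨ +-congʳ (+-identityʳ _) ⟨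
      m ∙ 1# + 0# - n ∙ 1#                   ≈⟨ +-congʳ (+-congˡ (-‿inverseʳ 1#)) ⟨
      m ∙ 1# + (1# - 1#) - n ∙ 1#            ≈⟨ +-congʳ (+-assoc _ _ _) ⟨
      m ∙ 1# + 1# - 1# - n ∙ 1#              ≈⟨ +-assoc _ _ _ ⟩
      m ∙ 1# + 1# + (- 1# - n ∙ 1#)          ≈⟨ +-cong (+-comm _ _) (-‿+-comm _ _) ⟩
      1# + m ∙ 1# - (1# + n ∙ 1#)            ≈⟨ +-cong (1+× m 1#) (-‿cong (1+× n 1#)) ⟨
      suc m ∙ 1# - suc n ∙ 1#                ∎

    neg-homo : ∀ m → ⟪ ℤ.- m ⟫ ≈ - ⟪ m ⟫
    neg-homo (+ zero)  = sym -0#≈0#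
    neg-homo (+ suc n) = refl
    neg-homo -[1+ n ]  = sym (-‿involutive _)

    +-homo : ∀ m n → ⟪ m ℤ.+ n ⟫ ≈ ⟪ m ⟫ + ⟪ n ⟫
    +-homo (+ m)    (+ n)    = ×-homo-+ 1# m n
    +-homo (+ m)    -[1+ n ] = ⊖-homo m (suc n)
    +-homo -[1+ m ] (+ n)    = trans (⊖-homo n (suc m)) (+-comm _ _)
    +-homo -[1+ m ] -[1+ n ] = begin
      - (suc (suc (m ℕ.+ n)) ∙ 1#)      ≡⟨ ≡.cong (λ k → - (suc k ∙ 1#)) (ℕ.+-suc m n) ⟨
      - ((suc m ℕ.+ suc n) ∙ 1#)        ≈⟨ -‿cong (×-homo-+ 1# (suc m) (suc n)) ⟩
      - (suc m ∙ 1# + suc n ∙ 1#)       ≈⟨ -‿+-comm _ _ ⟨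
      - (suc m ∙ 1#) - (suc n ∙ 1#)     ∎

    +*-homo : ∀ m n → ⟪ + m ℤ.* n ⟫ ≈ m ∙ 1# * ⟪ n ⟫
    +*-homo m (+ n)    = begin
      ⟪ + m ℤ.* + n ⟫     ≡⟨ ≡.cong ⟪_⟫ (≡.sym (ℤ.pos-* m n)) ⟩
      (m ℕ.* n) ∙ 1#      ≈⟨ ×1-homo-* m n ⟩
      m ∙ 1# * n ∙ 1#     ∎
    +*-homo m -[1+ n ] = begin
      ⟪ + m ℤ.* (ℤ.- (+ suc n)) ⟫   ≡⟨ ≡.cong ⟪_⟫ (≡.sym (ℤ.neg-distribʳ-* (+ m) (+ suc n))) ⟩
      ⟪ ℤ.- (+ m ℤ.* + suc n) ⟫     ≈⟨ neg-homo (+ m ℤ.* + suc n) ⟩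
      - ⟪ + m ℤ.* + suc n ⟫         ≈⟨ -‿cong (+*-homo m (+ suc n)) ⟩
      - (m ∙ 1# * suc n ∙ 1#)       ≈⟨ -‿distribʳ-* _ _ ⟩
      m ∙ 1# * - (suc n ∙ 1#)       ∎

    *-homo : ∀ m n → ⟪ m ℤ.* n ⟫ ≈ ⟪ m ⟫ * ⟪ n ⟫
    *-homo (+ m)    n = +*-homo m n
    *-homo -[1+ m ] n = begin
      ⟪ ℤ.- (+ suc m) ℤ.* n ⟫   ≡⟨ ≡.cong ⟪_⟫ (≡.sym (ℤ.neg-distribˡ-* (+ suc m) n)) ⟩
      ⟪ ℤ.- (+ suc m ℤ.* n) ⟫   ≈⟨ neg-homo (+ suc m ℤ.* n) ⟩
      - ⟪ + suc m ℤ.* n ⟫       ≈⟨ -‿cong (+*-homo (suc m) n) ⟩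
      - (suc m ∙ 1# * ⟪ n ⟫)    ≈⟨ -‿distribˡ-* _ _ ⟩
      - (suc m ∙ 1#) * ⟪ n ⟫    ∎

    -- Integers serve as coefficients because normalising polynomials needs an equality test that
    -- computes, and the equality of the field does not.
    morphism : ℤ.+-*-rawRing -Raw-AlmostCommutative⟶ fromCommutativeRing commutativeRing
    morphism = record
      { ⟦_⟧ = ⟪_⟫ ; +-homo = +-homo ; *-homo = *-homo ; -‿homo = neg-homo
      ; 0-homo = refl ; 1-homo = refl }

    _coeff≟_ : ∀ m n → Maybe (⟪ m ⟫ ≈ ⟪ n ⟫)
    m coeff≟ n with m ℤ.≟ n
    ... | yes ≡.refl = just refl
    ... | no _       = nothing

  open RingSolver ℤ.+-*-rawRing (fromCommutativeRing commutativeRing) morphism _coeff≟_ public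
    using (solve; con; _:=_; _:+_; _:*_; :-_; _:-_; Polynomial)

  0ₚ 1ₚ : ∀ {n} → Polynomial n
  0ₚ = con (+ 0)
  1ₚ = con (+ 1)

module OrderedField (em : ∀ {ℓ} → ExcludedMiddle ℓ) (R : CompleteOrderedField) where
  open CompleteOrderedField R public hiding (zero)
  open IntegerSolver R public

  ≰⇒≥ : ∀ {x y} → ¬ (x ≤ y) → y ≤ x
  ≰⇒≥ {x} {y} x≰y with total x y
  ... | inj₁ x≤y = contradiction x≤y x≰y
  ... | inj₂ y≤x = y≤x

  -- The workhorse for inequalities: a known inequality is moved to the goal by a ring identity
  -- between the two differences, and the solver proves the identity.
  ≤-by-difference : ∀ {a b x y} → a ≤ b → y - x ≈ b - a → x ≤ y
  ≤-by-difference a≤b e = 0≤y-x⇒x≤y (≤-resp refl (sym e) (x≤y⇒0≤y-x a≤b))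

  0≤1 : 0# ≤ 1#
  0≤1 with total 0# 1#
  ... | inj₁ 0≤1 = 0≤1
  ... | inj₂ 1≤0 = ≤-by-difference (*-nonneg 0≤-1 0≤-1)
      (solve 0 (1ₚ :- 0ₚ := (0ₚ :- 1ₚ) :* (0ₚ :- 1ₚ) :- 0ₚ) refl)
    where
    0≤-1 : 0# ≤ 0# - 1#
    0≤-1 = x≤y⇒0≤y-x 1≤0

  -1≤0 : - 1# ≤ 0#
  -1≤0 = ≤-by-difference 0≤1 (solve 0 (0ₚ :- (:- 1ₚ) := 1ₚ :- 0ₚ) refl)

  +-nonneg : ∀ {x y} → 0# ≤ x → 0# ≤ y → 0# ≤ x + y
  +-nonneg p q = ≤-resp (+-identityʳ 0#) refl (+-mono-≤ p q)

  neg-nonneg : ∀ {x} → x ≤ 0# → 0# ≤ - x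
  neg-nonneg p = ≤-resp -0#≈0# refl (neg-antitone p)

  *-monoʳ-≤ : ∀ {r x y} → 0# ≤ r → x ≤ y → x * r ≤ y * r
  *-monoʳ-≤ 0≤r p = ≤-resp (*-comm _ _) (*-comm _ _) (*-monoˡ-≤ 0≤r p)

  ≤-sub : ∀ {x a b} → x ≤ a + b → x - b ≤ a
  ≤-sub {x} {a} {b} p = ≤-by-difference p
    (solve 3 (λ x a b → a :- (x :- b) := (a :+ b) :- x) refl x a b)

  ≤-unsub : ∀ {x a b} → x - b ≤ a → x ≤ a + b
  ≤-unsub {x} {a} {b} p = ≤-by-difference p
    (solve 3 (λ x a b → (a :+ b) :- x := a :- (x :- b)) refl x a b)

  0≤⇒≤+ : ∀ {x y} → 0# ≤ y → x ≤ x + y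
  0≤⇒≤+ p = ≤-resp (+-identityʳ _) refl (+-mono-≤ ≤-refl p)

  +-cancel-nonneg : ∀ {x y} → 0# ≤ x → 0# ≤ y → x + y ≤ 0# → (x ≈ 0#) × (y ≈ 0#)
  +-cancel-nonneg 0≤x 0≤y p =
    antisym (≤-trans (0≤⇒≤+ 0≤y) p) 0≤x ,
    antisym (≤-trans (0≤⇒≤+ 0≤x) (≤-resp (+-comm _ _) refl p)) 0≤y

  positive⇒≉0 : ∀ {x} → 0# < x → ¬ (x ≈ 0#)
  positive⇒≉0 (_ , 0≉x) x≈0 = 0≉x (sym x≈0)

  positive-inverse : ∀ {x} → 0# < x → ∃[ y ] (x * y ≈ 1#) × (0# ≤ y)
  positive-inverse {x} 0<x with inverse x (positive⇒≉0 0<x)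
  ... | y , xy≈1 with total 0# y
  ... | inj₁ 0≤y = y , xy≈1 , 0≤y
  ... | inj₂ y≤0 = contradiction (antisym 0≤1 1≤0) 0≉1
    where
    1≤0 : 1# ≤ 0#
    1≤0 = ≤-resp xy≈1 (zeroʳ x) (*-monoˡ-≤ (proj₁ 0<x) y≤0)

  *-zero-cancel : ∀ {t x} → 0# < t → t * x ≈ 0# → x ≈ 0#
  *-zero-cancel {t} {x} 0<t p with inverse t (positive⇒≉0 0<t)
  ... | y , ty≈1 = trans (sym (*-identityˡ x)) (trans (*-congʳ (sym ty≈1))
        (trans (solve 3 (λ t y x → (t :* y) :* x := y :* (t :* x)) refl t y x)
          (trans (*-congˡ p) (zeroʳ y))))

  -- The two infima are reached one at a time, each with the other summand moved across. This is how
  -- subadditivity passes to infima of functionals.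
  ⨅-+ : ∀ {A B : Set} {f : A → Carrier} {g : B → Carrier} {a b} {p : BoundedBelow f} {q : BoundedBelow g} →
        ∀ {x} → (∀ c d → x ≤ f c + g d) → x ≤ ⨅ f a p + ⨅ g b q
  ⨅-+ {f = f} {g} {a} {b} {p} {q} {x} h =
    ≤-unsub (⨅-greatest f a p λ c →
      ≤-sub (≤-resp refl (+-comm _ _) (≤-unsub (⨅-greatest g b q λ d →
        ≤-sub (≤-resp refl (+-comm _ _) (h c d))))))

  ⨅-scale : ∀ {A : Set} {f : A → Carrier} {a} {p : BoundedBelow f} {r x} →
            0# ≤ r → (∀ c → x ≤ r * f c) → x ≤ r * ⨅ f a p
  ⨅-scale {f = f} {a} {p} {r} {x} 0≤r h with em {P = r ≈ 0#}
  -- Division by `r` fails here, but both sides no longer depend on the index, so the instance at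
  -- `a` is enough.
  ... | yes r≈0 = ≤-resp refl (trans (*-congʳ r≈0) (trans (zeroˡ _) (sym (trans (*-congʳ r≈0) (zeroˡ _))))) (h a)
  ... | no r≉0 with positive-inverse (0≤r , λ 0≈r → r≉0 (sym 0≈r))
  ... | y , ry≈1 , 0≤y = ≤-resp (cancel x) refl
        (*-monoˡ-≤ 0≤r (⨅-greatest f a p λ c → ≤-resp refl
          (trans (solve 3 (λ y r z → y :* (r :* z) := (r :* y) :* z) refl y r (f c))
            (trans (*-congʳ ry≈1) (*-identityˡ _)))
          (*-monoˡ-≤ 0≤y (h c))))
    where
    cancel : ∀ z → r * (y * z) ≈ z
    cancel z = trans (sym (*-assoc r y z)) (trans (*-congʳ ry≈1) (*-identityˡ z))

  2#≉0 : ¬ (1# + 1# ≈ 0#)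
  2#≉0 p = 0≉1 (sym (proj₁ (+-cancel-nonneg 0≤1 0≤1 (≤-reflexive p))))

  ½ : Carrier
  ½ = proj₁ (inverse (1# + 1#) 2#≉0)

  ½+½≈1 : ½ + ½ ≈ 1#
  ½+½≈1 = trans (solve 1 (λ h → h :+ h := (1ₚ :+ 1ₚ) :* h) refl ½) (proj₂ (inverse (1# + 1#) 2#≉0))

  0≤½ : 0# ≤ ½
  0≤½ with total 0# ½
  ... | inj₁ p = p
  ... | inj₂ p = contradiction (antisym 0≤1 (≤-resp ½+½≈1 (+-identityʳ 0#) (+-mono-≤ p p))) 0≉1

  -- The sequence of powers of one half, the common unit in which all later errors are measured.
  δ : ℕ → Carrier
  δ zero    = 1#
  δ (suc n) = ½ * δ n

  δ-halves : ∀ n → δ (suc n) + δ (suc n) ≈ δ n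
  δ-halves n = trans (sym (distribʳ (δ n) ½ ½)) (trans (*-congʳ ½+½≈1) (*-identityˡ _))

  0≤δ : ∀ n → 0# ≤ δ n
  0≤δ zero    = 0≤1
  0≤δ (suc n) = *-nonneg 0≤½ (0≤δ n)

  δ-suc : ∀ n → δ (suc n) ≤ δ n
  δ-suc n = ≤-resp refl (δ-halves n) (0≤⇒≤+ (0≤δ (suc n)))

  δ-antitone : ∀ {m n} → m ℕ.≤ n → δ n ≤ δ m
  δ-antitone {m} m≤n with ℕ.m≤n⇒∃[o]m+o≡n m≤n
  ... | o , ≡.refl = go m o
    where
    go : ∀ m o → δ (m ℕ.+ o) ≤ δ m
    go m zero    = ≤-reflexive (reflexive (≡.cong δ (ℕ.+-identityʳ m)))
    go m (suc o) = ≤-trans (≤-reflexive (reflexive (≡.cong δ (ℕ.+-suc m o))))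
                     (≤-trans (δ-suc (m ℕ.+ o)) (go m o))

  -- The Archimedean property, from the completeness of R: the infimum g of
  -- the sequence C δ n satisfies 2g ≤ g.
  ≤-upto-δ : ∀ C {x y} → (∀ n → x ≤ y + C * δ n) → x ≤ y
  ≤-upto-δ C {x} {y} h with total C 0#
  ... | inj₁ C≤0 = ≤-trans (h 0) (≤-resp refl (+-identityʳ y)
        (+-mono-≤ ≤-refl (≤-resp refl (zeroˡ _) (*-monoʳ-≤ 0≤1 C≤0))))
  ... | inj₂ 0≤C = ≤-by-difference {a = x - y} {b = 0#} (≤-trans x-y≤g g≤0)
        (solve 2 (λ x y → y :- x := 0ₚ :- (x :- y)) refl x y)
    where
    e : ℕ → Carrier
    e n = C * δ n
    bounded : BoundedBelow e
    bounded = 0# , λ n → *-nonneg 0≤C (0≤δ n)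
    g : Carrier
    g = ⨅ e 0 bounded
    x-y≤g : x - y ≤ g
    x-y≤g = ⨅-greatest e 0 bounded λ n → ≤-sub (≤-resp refl (+-comm _ _) (h n))
    2g≤g : g + g ≤ g
    2g≤g = ⨅-greatest e 0 bounded λ n → ≤-resp refl
      (trans (sym (distribˡ C _ _)) (*-congˡ (δ-halves n)))
      (+-mono-≤ (⨅-lower e 0 bounded (suc n)) (⨅-lower e 0 bounded (suc n)))
    g≤0 : g ≤ 0#
    g≤0 = ≤-by-difference 2g≤g (solve 1 (λ g → 0ₚ :- g := g :- (g :+ g)) refl g)

  δ-small : ∀ C {ε} → 0# < ε → ∃[ n ] C * δ n ≤ ε
  δ-small C {ε} 0<ε with em {P = ∃[ n ] C * δ n ≤ ε}
  ... | yes p = p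
  ... | no ¬p = contradiction (antisym ε≤0 (proj₁ 0<ε)) (positive⇒≉0 0<ε)
    where
    ε≤0 : ε ≤ 0#
    ε≤0 = ≤-upto-δ C λ n → ≤-resp refl (sym (+-identityˡ _)) (≰⇒≥ λ p → ¬p (n , p))

-- The Bourbaki-Witt fixed point theorem, in descending form

module BourbakiWitt (em : ∀ {ℓ} → ExcludedMiddle ℓ)
  {X : Set} (_≤_ : Rel X 0ℓ) (≤-refl : Reflexive _≤_) (≤-trans : Transitive _≤_)
  (step : X → X) (step-≤ : ∀ x → step x ≤ x)
  (step-cong : ∀ {x y} → x ≤ y → y ≤ x → step x ≤ step y)
  (⋀ : {A : Set} (c : A → X) → A → (∀ a b → (c a ≤ c b) ⊎ (c b ≤ c a)) → X)
  (⋀-lower : ∀ {A : Set} (c : A → X) a ch b → ⋀ c a ch ≤ c b)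
  (⋀-greatest : ∀ {A : Set} (c : A → X) a ch {x} → (∀ b → x ≤ c b) → x ≤ ⋀ c a ch)
  (start : X)
  where

  private
    data Tower : X → Set₁ where
      base  : Tower start
      next  : ∀ {x} → Tower x → Tower (step x)
      limit : ∀ {A : Set} (c : A → X) a ch → (∀ b → Tower (c b)) → Tower (⋀ c a ch)

    ≤-start : ∀ {x} → Tower x → x ≤ start
    ≤-start base             = ≤-refl
    ≤-start (next p)         = ≤-trans (step-≤ _) (≤-start p)
    ≤-start (limit c a ch p) = ≤-trans (⋀-lower c a ch a) (≤-start (p a))

    -- The extreme elements of the classical proof, unrelated to extreme types: no step that starts
    -- strictly above `x` jumps past `x`. As `_≤_` is only a preorder, strictness is the failure of
    -- the reverse inequality.
    Extreme′ : X → Set₁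
    Extreme′ x = ∀ {y} → Tower y → x ≤ y → ¬ (y ≤ x) → x ≤ step y

    -- Induction on the tower: the elements above `x` or below `step x` contain `start` and are
    -- closed under `step`, by extremeness, and under infima of chains.
    extreme⇒comparable : ∀ {x y} → Tower x → Extreme′ x → Tower y → (x ≤ y) ⊎ (y ≤ step x)
    extreme⇒comparable p ext base = inj₁ (≤-start p)
    extreme⇒comparable {x} p ext (next {z} q) with extreme⇒comparable p ext q
    ... | inj₂ z≤sx = inj₂ (≤-trans (step-≤ _) z≤sx)
    ... | inj₁ x≤z with em {P = z ≤ x}
    ...   | yes z≤x = inj₂ (step-cong z≤x x≤z)
    ...   | no  z≰x = inj₁ (ext q x≤z z≰x)
    extreme⇒comparable {x} p ext (limit c a ch q) with em {P = ∃[ b ] c b ≤ step x}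
    ... | yes (b , cb≤sx) = inj₂ (≤-trans (⋀-lower c a ch b) cb≤sx)
    ... | no  ∄b = inj₁ (⋀-greatest c a ch above)
      where
      above : ∀ b → x ≤ c b
      above b with extreme⇒comparable p ext (q b)
      ... | inj₁ x≤cb  = x≤cb
      ... | inj₂ cb≤sx = contradiction (b , cb≤sx) ∄b

    -- At an infimum, `y` fails to lie below some member `c b`. Comparability puts that member below
    -- `y`, and its own extremeness already keeps `step y` above it.
    extreme : ∀ {x} → Tower x → Extreme′ x
    extreme base q s≤y y≰s = contradiction (≤-start q) y≰s
    extreme (next {w} p) {y} q sw≤y y≰sw with extreme⇒comparable p (extreme p) q
    ... | inj₂ y≤sw = contradiction y≤sw y≰sw
    ... | inj₁ w≤y with em {P = y ≤ w}
    ...   | yes y≤w = step-cong w≤y y≤w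
    ...   | no  y≰w = ≤-trans (step-≤ w) (extreme p q w≤y y≰w)
    extreme (limit c a ch p) {y} q ⋀≤y y≰⋀ with em {P = ∃[ b ] ¬ (y ≤ c b)}
    ... | no ∄b = contradiction (⋀-greatest c a ch below) y≰⋀
      where
      below : ∀ b → y ≤ c b
      below b with em {P = y ≤ c b}
      ... | yes y≤cb = y≤cb
      ... | no  y≰cb = contradiction (b , y≰cb) ∄b
    ... | yes (b , y≰cb) with extreme⇒comparable (p b) (extreme (p b)) q
    ...   | inj₁ cb≤y = ≤-trans (⋀-lower c a ch b) (extreme (p b) q cb≤y y≰cb)
    ...   | inj₂ y≤sc = contradiction (≤-trans y≤sc (step-≤ _)) y≰cb

    tower-chain : ∀ {x y} → Tower x → Tower y → (x ≤ y) ⊎ (y ≤ x)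
    tower-chain p q with extreme⇒comparable p (extreme p) q
    ... | inj₁ x≤y  = inj₁ x≤y
    ... | inj₂ y≤sx = inj₂ (≤-trans y≤sx (step-≤ _))

    -- em brings membership in the tower down to the lowest universe.
    InTower : X → Set
    InTower x = True (em {P = Tower x})

  -- The tower is a chain, so it has an infimum, which again belongs to the tower. So does the step
  -- of this infimum, which therefore cannot be lower.
  fixpoint : ∃[ x ] (x ≤ step x) × (x ≤ start)
  fixpoint = bottom , ⋀-lower c a ch (step bottom , fromWitness (next bottom∈T)) ,
             ≤-start bottom∈T
    where
    c : Σ X InTower → X
    c = proj₁
    a : Σ X InTower
    a = start , fromWitness base
    ch : ∀ a b → (c a ≤ c b) ⊎ (c b ≤ c a)
    ch (_ , p) (_ , q) = tower-chain (toWitness p) (toWitness q)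
    bottom : X
    bottom = ⋀ c a ch
    bottom∈T : Tower bottom
    bottom∈T = limit c a ch λ b → toWitness (proj₂ b)

-- The Hahn-Banach theorem for bounded functions

module HahnBanach (em : ∀ {ℓ} → ExcludedMiddle ℓ) (ext : ∀ {a b} → Extensionality a b)
                  (R : CompleteOrderedField) where
  open OrderedField em R

  private
    pick : (Carrier → Bool) → Carrier
    pick b with em {P = ∃[ y ] b y ≡ true}
    ... | yes (y , _) = y
    ... | no _        = 0#

    -- Boolean-valued because extensionality identifies Boolean functions that agree pointwise,
    -- whereas equivalent predicates need not be identical. Equal reals thus have the very same
    -- class, and `pick` returns the same element for both.
    class : Carrier → Carrier → Bool
    class x y = does (em {P = x ≈ y})

  canonical : Carrier → Carrier
  canonical x = pick (class x)

  canonical-≈ : ∀ x → canonical x ≈ x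
  canonical-≈ x with em {P = ∃[ y ] class x y ≡ true}
  ... | no ∄y = contradiction (x , self) ∄y
    where
    self : class x x ≡ true
    self with em {P = x ≈ x}
    ... | yes _ = ≡.refl
    ... | no ¬p = contradiction refl ¬p
  ... | yes (y , p) with em {P = x ≈ y} | p
  ...   | yes x≈y | _  = sym x≈y
  ...   | no _    | ()

  canonical-cong : ∀ {x y} → x ≈ y → canonical x ≡ canonical y
  canonical-cong {x} {y} x≈y = ≡.cong pick (ext same)
    where
    same : ∀ z → class x z ≡ class y z
    same z with em {P = x ≈ z} | em {P = y ≈ z}
    ... | yes _ | yes _ = ≡.refl
    ... | no _  | no _  = ≡.refl
    ... | yes p | no q  = contradiction (trans (sym x≈y) p) q
    ... | no p  | yes q = contradiction (trans x≈y q) p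

  record BoundedFunction (I : Set) : Set where
    constructor bounded
    field
      at    : I → Carrier
      below : BoundedBelow at
      above : BoundedAbove at
  open BoundedFunction public

  module _ {I : Set} where

    infix  4 _≤ᵇ_
    infixl 6 _⊞_
    infixr 7 _⊡_

    _≤ᵇ_ : Rel (BoundedFunction I) 0ℓ
    f ≤ᵇ g = ∀ i → at f i ≤ at g i

    const : Carrier → BoundedFunction I
    const r = bounded (λ _ → r) (r , λ _ → ≤-refl) (r , λ _ → ≤-refl)

    _⊞_ : BoundedFunction I → BoundedFunction I → BoundedFunction I
    bounded f (l , l≤f) (u , f≤u) ⊞ bounded g (l′ , l′≤g) (u′ , g≤u′) =
      bounded (λ i → f i + g i) (l + l′ , λ i → +-mono-≤ (l≤f i) (l′≤g i))
                                (u + u′ , λ i → +-mono-≤ (f≤u i) (g≤u′ i))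

    _⊡_ : Carrier → BoundedFunction I → BoundedFunction I
    at    (r ⊡ f) i = r * at f i
    below (r ⊡ f) with total 0# r
    ... | inj₁ 0≤r = r * proj₁ (below f) , λ i → *-monoˡ-≤ 0≤r (proj₂ (below f) i)
    ... | inj₂ r≤0 = r * proj₁ (above f) , λ i → *-antitoneˡ-≤ r≤0 (proj₂ (above f) i)
    above (r ⊡ f) with total 0# r
    ... | inj₁ 0≤r = r * proj₁ (above f) , λ i → *-monoˡ-≤ 0≤r (proj₂ (above f) i)
    ... | inj₂ r≤0 = r * proj₁ (below f) , λ i → *-antitoneˡ-≤ r≤0 (proj₂ (below f) i)

    neg : BoundedFunction I → BoundedFunction I
    neg f = (- 1#) ⊡ f

  record Sublinear (I : Set) : Set where
    field
      ⟨_⟩    : BoundedFunction I → Carrier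
      mono   : ∀ {f g} → f ≤ᵇ g → ⟨ f ⟩ ≤ ⟨ g ⟩
      subadd : ∀ f g → ⟨ f ⊞ g ⟩ ≤ ⟨ f ⟩ + ⟨ g ⟩
      subhom : ∀ {r} f → 0# ≤ r → ⟨ r ⊡ f ⟩ ≤ r * ⟨ f ⟩

    respects : ∀ {f g} → (∀ i → at f i ≈ at g i) → ⟨ f ⟩ ≈ ⟨ g ⟩
    respects e = antisym (mono λ i → ≤-reflexive (e i)) (mono λ i → ≤-reflexive (sym (e i)))

    ⟨0⟩≥0 : 0# ≤ ⟨ const 0# ⟩
    ⟨0⟩≥0 = ≤-by-difference (≤-trans (mono {g = const 0# ⊞ const 0#} λ _ → ≤-reflexive (sym (+-identityˡ 0#)))
                                (subadd (const 0#) (const 0#)))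
      (solve 1 (λ z → z :- 0ₚ := (z :+ z) :- z) refl ⟨ const 0# ⟩)

    ⟨0⟩≤0 : ⟨ const 0# ⟩ ≤ 0#
    ⟨0⟩≤0 = ≤-trans (mono {g = 0# ⊡ const 0#} λ _ → ≤-reflexive (sym (zeroˡ 0#)))
              (≤-trans (subhom (const 0#) ≤-refl) (≤-reflexive (zeroˡ _)))

    -- Subhomogeneity for the inverse of `r`, applied to `r ⊡ f`; for `r` zero only the sign of the
    -- value at the zero function is left.
    superhom : ∀ {r} f → 0# ≤ r → r * ⟨ f ⟩ ≤ ⟨ r ⊡ f ⟩
    superhom {r} f 0≤r with em {P = 0# ≈ r}
    ... | yes 0≈r = ≤-resp (trans (sym (zeroˡ _)) (*-congʳ 0≈r))
          (respects λ i → trans (sym (zeroˡ (at f i))) (*-congʳ 0≈r)) ⟨0⟩≥0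
    ... | no 0≉r with positive-inverse (0≤r , 0≉r)
    ...   | y , ry≈1 , 0≤y = ≤-resp refl (cancel _)
              (*-monoˡ-≤ 0≤r (≤-resp (respects λ i → uncancel (at f i)) refl (subhom (r ⊡ f) 0≤y)))
      where
      cancel : ∀ z → r * (y * z) ≈ z
      cancel z = trans (sym (*-assoc r y z)) (trans (*-congʳ ry≈1) (*-identityˡ z))
      uncancel : ∀ z → y * (r * z) ≈ z
      uncancel z = trans (solve 3 (λ y r z → y :* (r :* z) := r :* (y :* z)) refl y r z) (cancel z)

    -- The zero function has nonnegative value and is the sum of `f` and `neg f`. Oddness is the
    -- reverse inequality, so it is all that separates sublinear from linear.
    -⟨neg⟩≤ : ∀ f → - ⟨ neg f ⟩ ≤ ⟨ f ⟩
    -⟨neg⟩≤ f = ≤-by-difference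
      (≤-trans ⟨0⟩≥0 (≤-trans (mono {g = f ⊞ neg f} λ i → ≤-reflexive
        (solve 1 (λ z → 0ₚ := z :+ (:- 1ₚ) :* z) refl (at f i))) (subadd f (neg f))))
      (solve 2 (λ a b → a :- (:- b) := (a :+ b) :- 0ₚ) refl ⟨ f ⟩ ⟨ neg f ⟩)

  open Sublinear using (⟨_⟩; mono; subadd; subhom)

  infix 4 _≤ˢ_
  _≤ˢ_ : ∀ {I} → Rel (Sublinear I) 0ℓ
  s ≤ˢ s′ = ∀ f → ⟨ s ⟩ f ≤ ⟨ s′ ⟩ f

  record PositiveLinear (I : Set) : Set where
    field
      ∫       : BoundedFunction I → Carrier
      ∫-mono  : ∀ {f g} → f ≤ᵇ g → ∫ f ≤ ∫ g
      ∫-⊞     : ∀ f g → ∫ (f ⊞ g) ≈ ∫ f + ∫ g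
      ∫-⊡     : ∀ r f → ∫ (r ⊡ f) ≈ r * ∫ f

    ∫-cong : ∀ {f g} → (∀ i → at f i ≈ at g i) → ∫ f ≈ ∫ g
    ∫-cong e = antisym (∫-mono λ i → ≤-reflexive (e i)) (∫-mono λ i → ≤-reflexive (sym (e i)))

    ∫-+ : ∀ {h} f g → (∀ i → at h i ≈ at f i + at g i) → ∫ h ≈ ∫ f + ∫ g
    ∫-+ f g e = trans (∫-cong e) (∫-⊞ f g)

    ∫-* : ∀ {h} r f → (∀ i → at h i ≈ r * at f i) → ∫ h ≈ r * ∫ f
    ∫-* r f e = trans (∫-cong e) (∫-⊡ r f)

  module _ {I : Set} where

    private
      Nonneg : Set
      Nonneg = Σ Carrier (0# ≤_)

    -- Shifting along f lowers the value at neg f to at most - s f, so that a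
    -- minimal sublinear functional is odd, and hence linear.
    module Minorant (s : Sublinear I) (f : BoundedFunction I) where
      open Sublinear s renaming (⟨_⟩ to ⟪_⟫; mono to s-mono; subadd to s-subadd; subhom to s-subhom)

      shifted : BoundedFunction I → Nonneg → Carrier
      shifted g (t , _) = ⟪ g ⊞ t ⊡ f ⟫ - t * ⟪ f ⟫

      shifted-below : ∀ g → BoundedBelow (shifted g)
      shifted-below g = - ⟪ neg g ⟫ , λ (t , 0≤t) → ≤-by-difference
        (≤-trans (superhom f 0≤t) (≤-trans
          (s-mono {g = (g ⊞ t ⊡ f) ⊞ neg g} λ i → ≤-reflexive
            (solve 3 (λ t f g → t :* f := (g :+ t :* f) :+ (:- 1ₚ) :* g) refl t (at f i) (at g i)))
          (s-subadd (g ⊞ t ⊡ f) (neg g))))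
        (solve 3 (λ a b c → (a :- b) :- (:- c) := (a :+ c) :- b) refl
          ⟪ g ⊞ t ⊡ f ⟫ (t * ⟪ f ⟫) ⟪ neg g ⟫)

      value : BoundedFunction I → Carrier
      value g = ⨅ (shifted g) (0# , ≤-refl) (shifted-below g)

      value-≤ : ∀ g t → value g ≤ shifted g t
      value-≤ g = ⨅-lower (shifted g) (0# , ≤-refl) (shifted-below g)

      ≤-value : ∀ g {x} → (∀ t → x ≤ shifted g t) → x ≤ value g
      ≤-value g = ⨅-greatest (shifted g) (0# , ≤-refl) (shifted-below g)

      minorant : Sublinear I
      minorant .⟨_⟩ = value
      minorant .mono {g} {h} g≤h = ≤-value h λ t → ≤-trans (value-≤ g t)
        (+-mono-≤ (s-mono λ i → +-mono-≤ (g≤h i) ≤-refl) ≤-refl)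
      minorant .subadd g h = ⨅-+ λ (t , 0≤t) (u , 0≤u) →
        ≤-trans (value-≤ (g ⊞ h) (t + u , +-nonneg 0≤t 0≤u))
        (≤-by-difference
          (≤-trans (s-mono {g = (g ⊞ t ⊡ f) ⊞ (h ⊞ u ⊡ f)} λ i → ≤-reflexive
              (solve 5 (λ g h t u f → (g :+ h) :+ (t :+ u) :* f := (g :+ t :* f) :+ (h :+ u :* f))
                 refl (at g i) (at h i) t u (at f i)))
            (s-subadd (g ⊞ t ⊡ f) (h ⊞ u ⊡ f)))
          (solve 6 (λ a b c t u f → ((a :- t :* f) :+ (b :- u :* f)) :- (c :- (t :+ u) :* f)
                                    := (a :+ b) :- c) refl
             ⟪ g ⊞ t ⊡ f ⟫ ⟪ h ⊞ u ⊡ f ⟫ ⟪ (g ⊞ h) ⊞ (t + u) ⊡ f ⟫ t u ⟪ f ⟫))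
      minorant .subhom {r} g 0≤r = ⨅-scale 0≤r λ (t , 0≤t) →
        ≤-trans (value-≤ (r ⊡ g) (r * t , *-nonneg 0≤r 0≤t))
        (≤-by-difference
          (≤-trans (s-mono {g = r ⊡ (g ⊞ t ⊡ f)} λ i → ≤-reflexive
              (solve 4 (λ r g t f → r :* g :+ (r :* t) :* f := r :* (g :+ t :* f))
                 refl r (at g i) t (at f i)))
            (s-subhom (g ⊞ t ⊡ f) 0≤r))
          (solve 5 (λ a b r t f → r :* (a :- t :* f) :- (b :- (r :* t) :* f) := r :* a :- b) refl
             ⟪ g ⊞ t ⊡ f ⟫ ⟪ (r ⊡ g) ⊞ (r * t) ⊡ f ⟫ r t ⟪ f ⟫))

      minorant-≤ : minorant ≤ˢ s
      minorant-≤ g = ≤-trans (value-≤ g (0# , ≤-refl)) (≤-reflexive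
        (trans (+-cong (respects λ i → solve 2 (λ g f → g :+ 0ₚ :* f := g) refl (at g i) (at f i)) refl)
               (solve 2 (λ a b → a :- 0ₚ :* b := a) refl ⟪ g ⟫ ⟪ f ⟫)))

      minorant-neg : value (neg f) ≤ - ⟪ f ⟫
      -- The shift by `t = 1` suffices, because `neg f` plus `f` vanishes.
      minorant-neg = ≤-trans (value-≤ (neg f) (1# , 0≤1)) (≤-by-difference
        (≤-trans (s-mono {g = const 0#} λ i → ≤-reflexive
            (solve 1 (λ f → (:- 1ₚ) :* f :+ 1ₚ :* f := 0ₚ) refl (at f i))) ⟨0⟩≤0)
        (solve 2 (λ a f → (:- f) :- (a :- 1ₚ :* f) := 0ₚ :- a) refl ⟪ neg f ⊞ 1# ⊡ f ⟫ ⟪ f ⟫))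

    minorant-cong : ∀ {s s′ : Sublinear I} f → s ≤ˢ s′ → s′ ≤ˢ s →
                    Minorant.minorant s f ≤ˢ Minorant.minorant s′ f
    minorant-cong {s} {s′} f s≤s′ s′≤s g = Minorant.≤-value s′ f g λ t →
      ≤-trans (Minorant.value-≤ s f g t)
        (+-mono-≤ (s≤s′ _) (neg-antitone (*-monoˡ-≤ (proj₂ t) (s′≤s f))))

    module ChainInfimum {A : Set} (c : A → Sublinear I) (a : A)
                        (chain : ∀ a b → (c a ≤ˢ c b) ⊎ (c b ≤ˢ c a)) where

      private
        val : BoundedFunction I → A → Carrier
        val f b = ⟨ c b ⟩ f

        -- The bound taken from the one member `c a` serves all of them: a member above it is larger
        -- at `f`, and a member below it is smaller at `neg f`.
        val-below : ∀ f → BoundedBelow (val f)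
        val-below f = - ⟨ c a ⟩ (neg f) , λ b → bound b (chain a b)
          where
          bound : ∀ b → (c a ≤ˢ c b) ⊎ (c b ≤ˢ c a) → - ⟨ c a ⟩ (neg f) ≤ val f b
          bound b (inj₁ ca≤cb) = ≤-trans (Sublinear.-⟨neg⟩≤ (c a) f) (ca≤cb f)
          bound b (inj₂ cb≤ca) = ≤-trans (neg-antitone (cb≤ca (neg f))) (Sublinear.-⟨neg⟩≤ (c b) f)

      infimum : Sublinear I
      infimum .⟨_⟩ f = ⨅ (val f) a (val-below f)
      infimum .mono {f} {g} f≤g = ⨅-greatest (val g) a (val-below g) λ b →
        ≤-trans (⨅-lower (val f) a (val-below f) b) (mono (c b) f≤g)
      -- The two summands may come from different members of the chain; the smaller of the two
      -- members serves for both.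
      infimum .subadd f g = ⨅-+ λ b b′ → both b b′ (chain b b′)
        where
        at-one : ∀ b → ⨅ (val (f ⊞ g)) a (val-below (f ⊞ g)) ≤ val f b + val g b
        at-one b = ≤-trans (⨅-lower _ a (val-below (f ⊞ g)) b) (subadd (c b) f g)
        both : ∀ b b′ → (c b ≤ˢ c b′) ⊎ (c b′ ≤ˢ c b) →
               ⨅ (val (f ⊞ g)) a (val-below (f ⊞ g)) ≤ val f b + val g b′
        both b b′ (inj₁ p) = ≤-trans (at-one b) (+-mono-≤ ≤-refl (p g))
        both b b′ (inj₂ p) = ≤-trans (at-one b′) (+-mono-≤ (p f) ≤-refl)
      infimum .subhom {r} f 0≤r = ⨅-scale 0≤r λ b →
        ≤-trans (⨅-lower (val (r ⊡ f)) a (val-below (r ⊡ f)) b) (subhom (c b) f 0≤r)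

      infimum-lower : ∀ b → infimum ≤ˢ c b
      infimum-lower b f = ⨅-lower (val f) a (val-below f) b

      infimum-greatest : ∀ {s} → (∀ b → s ≤ˢ c b) → s ≤ˢ infimum
      infimum-greatest h f = ⨅-greatest (val f) a (val-below f) λ b → h b f

    private
      NotOddAt : (BoundedFunction I → Carrier) → BoundedFunction I → Set
      NotOddAt v f = ¬ (v (neg f) ≤ - v f)

      stepAt : ∀ {v} → Dec (∃ (NotOddAt v)) → Sublinear I → Sublinear I
      stepAt (yes (f , _)) s = Minorant.minorant s f
      stepAt (no _)        s = s

      -- Canonical representatives make the choice of f depend on the values
      -- of s only up to ≈.
      step : Sublinear I → Sublinear I
      step s = stepAt (em {P = ∃ (NotOddAt (canonical ∘ ⟨ s ⟩))}) s

      step-≤ : ∀ s → step s ≤ˢ s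
      step-≤ s with em {P = ∃ (NotOddAt (canonical ∘ ⟨ s ⟩))}
      ... | yes (f , _) = Minorant.minorant-≤ s f
      ... | no _        = λ _ → ≤-refl

      step-cong : ∀ {s s′} → s ≤ˢ s′ → s′ ≤ˢ s → step s ≤ˢ step s′
      step-cong {s} {s′} p q = ≡.subst
        (λ v → stepAt (em {P = ∃ (NotOddAt v)}) s ≤ˢ step s′)
        (≡.sym (ext λ f → canonical-cong (antisym (p f) (q f))))
        same
        where
        same : stepAt (em {P = ∃ (NotOddAt (canonical ∘ ⟨ s′ ⟩))}) s ≤ˢ step s′
        same with em {P = ∃ (NotOddAt (canonical ∘ ⟨ s′ ⟩))}
        ... | yes (f , _) = minorant-cong {s} {s′} f p q
        ... | no _        = p

      -- If oddness failed, the step would be the minorant along the chosen `g`. Its value at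
      -- `neg g` is at most the negated value of `s` at `g`, and fixedness would pass this bound to
      -- `s`, against the choice of `g`.
      fixed⇒odd : ∀ {s} → s ≤ˢ step s → ∀ f → ⟨ s ⟩ (neg f) ≤ - ⟨ s ⟩ f
      fixed⇒odd {s} fixed f with em {P = ∃ (NotOddAt (canonical ∘ ⟨ s ⟩))}
      ... | yes (g , even) = contradiction
            (≤-resp (sym (canonical-≈ _)) (-‿cong (sym (canonical-≈ _)))
              (≤-trans (fixed (neg g)) (Minorant.minorant-neg s g))) even
      ... | no odd with em {P = ⟨ s ⟩ (neg f) ≤ - ⟨ s ⟩ f}
      ...   | yes p = p
      ...   | no ¬p = contradiction (f , λ p → ¬p
                (≤-resp (canonical-≈ _) (-‿cong (canonical-≈ _)) p)) odd

    odd⇒linear : (s : Sublinear I) → (∀ f → ⟨ s ⟩ (neg f) ≤ - ⟨ s ⟩ f) → PositiveLinear I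
    odd⇒linear s odd = record { ∫ = ⟨ s ⟩ ; ∫-mono = mono s ; ∫-⊞ = additive ; ∫-⊡ = homogeneous }
      where
      open Sublinear s using (respects; superhom)
      s-neg : ∀ f → ⟨ s ⟩ (neg f) ≈ - ⟨ s ⟩ f
      s-neg f = antisym (odd f) (≤-by-difference (Sublinear.-⟨neg⟩≤ s f)
        (solve 2 (λ a b → a :- (:- b) := b :- (:- a)) refl (⟨ s ⟩ (neg f)) (⟨ s ⟩ f)))
      additive : ∀ f g → ⟨ s ⟩ (f ⊞ g) ≈ ⟨ s ⟩ f + ⟨ s ⟩ g
      additive f g = antisym (subadd s f g) (≤-by-difference
        (≤-trans (mono s {g = (f ⊞ g) ⊞ neg g} λ i → ≤-reflexive
            (solve 2 (λ f g → f := (f :+ g) :+ (:- 1ₚ) :* g) refl (at f i) (at g i)))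
          (≤-trans (subadd s (f ⊞ g) (neg g)) (+-mono-≤ ≤-refl (odd g))))
        (solve 3 (λ a b c → c :- (a :+ b) := (c :- b) :- a) refl (⟨ s ⟩ f) (⟨ s ⟩ g) (⟨ s ⟩ (f ⊞ g))))
      homogeneous : ∀ r f → ⟨ s ⟩ (r ⊡ f) ≈ r * ⟨ s ⟩ f
      homogeneous r f with total 0# r
      ... | inj₁ 0≤r = antisym (subhom s f 0≤r) (superhom f 0≤r)
      ... | inj₂ r≤0 = trans
        (respects λ i → solve 2 (λ r f → r :* f := (:- r) :* ((:- 1ₚ) :* f)) refl r (at f i))
        (trans (antisym (subhom s (neg f) (neg-nonneg r≤0)) (superhom (neg f) (neg-nonneg r≤0)))
          (trans (*-congˡ (s-neg f)) (solve 2 (λ r a → (:- r) :* (:- a) := r :* a) refl r (⟨ s ⟩ f))))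

    abstract
      hahn-banach : (s : Sublinear I) → Σ (PositiveLinear I) λ μ → ∀ f → PositiveLinear.∫ μ f ≤ ⟨ s ⟩ f
      hahn-banach s = from-fixpoint fixpoint
        where
        open BourbakiWitt em (_≤ˢ_ {I}) (λ _ → ≤-refl) (λ p q f → ≤-trans (p f) (q f))
          step step-≤ (λ {s} {s′} → step-cong {s} {s′})
          (λ c a ch → ChainInfimum.infimum c a ch)
          (λ c a ch → ChainInfimum.infimum-lower c a ch)
          (λ c a ch {s} → ChainInfimum.infimum-greatest c a ch {s}) s
        from-fixpoint : (∃[ m ] (m ≤ˢ step m) × (m ≤ˢ s)) →
                        Σ (PositiveLinear I) λ μ → ∀ f → PositiveLinear.∫ μ f ≤ ⟨ s ⟩ f
        from-fixpoint (m , m-fixed , m≤s) = odd⇒linear m (fixed⇒odd {m} m-fixed) , m≤s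

-- Lipschitz continuity of affine formulas

inf* : {R : CompleteOrderedField} {L : Language R} → ∀ n → Formula L n → Sentence L
inf* zero    φ = φ
inf* (suc n) φ = inf* n (inf φ)

module StructureProperties (em : ∀ {ℓ} → ExcludedMiddle ℓ) {R : CompleteOrderedField} {L : Language R}
                           (𝓜 : Structure L) where
  open OrderedField em R
  open Language L
  open Structure 𝓜
  open Semantics 𝓜

  d-sym : ∀ x y → d x y ≈ d y x
  d-sym = Metric.sym

  d-refl : ∀ x → d x x ≈ 0#
  d-refl x = Metric.≈⇒0 Metric.EqC.refl

  dⁿ-nonneg : ∀ {n} (xs ys : Vec M n) → 0# ≤ dⁿ xs ys
  dⁿ-nonneg []       []       = ≤-refl
  dⁿ-nonneg (x ∷ xs) (y ∷ ys) = +-nonneg Metric.nonNegative (dⁿ-nonneg xs ys)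

  dⁿ-sym : ∀ {n} (xs ys : Vec M n) → dⁿ xs ys ≈ dⁿ ys xs
  dⁿ-sym []       []       = refl
  dⁿ-sym (x ∷ xs) (y ∷ ys) = +-cong (d-sym x y) (dⁿ-sym xs ys)

  dⁿ-bounded : ∀ n → ∃[ u ] ∀ (xs ys : Vec M n) → dⁿ xs ys ≤ u
  dⁿ-bounded zero    = 0# , λ { [] [] → ≤-refl }
  dⁿ-bounded (suc n) with dⁿ-bounded n
  ... | u , h = 1# + u , λ { (x ∷ xs) (y ∷ ys) → +-mono-≤ (d≤1 x y) (h xs ys) }

  -- Lets the later inductions on formulas obtain the case of `sup` from those of `inf` and of
  -- multiplication by a scalar.
  ⟦sup⟧≈ : ∀ {n} (φ : Formula L (suc n)) ρ → ⟦ sup φ ⟧ ρ ≈ ⟦ (- 1#) · inf ((- 1#) · φ) ⟧ ρ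
  ⟦sup⟧≈ φ ρ = antisym
    (⨆-least _ point (upper∷ φ ρ) λ m → ≤-resp (-1*-1* _) refl
      (*-antitoneˡ-≤ -1≤0 (⨅-lower _ point (lower∷ ((- 1#) · φ) ρ) m)))
    (≤-resp refl (-1*-1* _) (*-antitoneˡ-≤ -1≤0
      (⨅-greatest _ point (lower∷ ((- 1#) · φ) ρ) λ m →
        *-antitoneˡ-≤ -1≤0 (⨆-upper _ point (upper∷ φ ρ) m))))
    where
    -1*-1* : ∀ x → - 1# * (- 1# * x) ≈ x
    -1*-1* = solve 1 (λ x → (:- 1ₚ) :* ((:- 1ₚ) :* x) := x) refl

  inf≤ : ∀ {n} (φ : Formula L (suc n)) ρ m → ⟦ inf φ ⟧ ρ ≤ ⟦ φ ⟧ (m ∷ ρ)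
  inf≤ φ ρ = ⨅-lower _ point (lower∷ φ ρ)

  ≤inf : ∀ {n} (φ : Formula L (suc n)) ρ {x} → (∀ m → x ≤ ⟦ φ ⟧ (m ∷ ρ)) → x ≤ ⟦ inf φ ⟧ ρ
  ≤inf φ ρ = ⨅-greatest _ point (lower∷ φ ρ)

  near-inf : ∀ {n} (φ : Formula L (suc n)) ρ {ε} → 0# < ε → ∃[ m ] ⟦ φ ⟧ (m ∷ ρ) ≤ ⟦ inf φ ⟧ ρ + ε
  near-inf φ ρ {ε} 0<ε with em {P = ∃[ m ] ⟦ φ ⟧ (m ∷ ρ) ≤ ⟦ inf φ ⟧ ρ + ε}
  ... | yes p = p
  ... | no ∄m = contradiction (antisym ε≤0 (proj₁ 0<ε)) (positive⇒≉0 0<ε)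
    where
    ε≤0 : ε ≤ 0#
    ε≤0 = ≤-by-difference (≤inf φ ρ λ m → ≰⇒≥ λ p → ∄m (m , p))
      (solve 2 (λ a ε → 0ₚ :- ε := a :- (a :+ ε)) refl (⟦ inf φ ⟧ ρ) ε)

  lookup-lipschitz : ∀ {n} i (ρ ρ′ : Vec M n) → d (lookup ρ i) (lookup ρ′ i) ≤ dⁿ ρ ρ′
  lookup-lipschitz zero    (x ∷ ρ) (y ∷ ρ′) = 0≤⇒≤+ (dⁿ-nonneg ρ ρ′)
  lookup-lipschitz (suc i) (x ∷ ρ) (y ∷ ρ′) = ≤-trans (lookup-lipschitz i ρ ρ′)
    (≤-resp refl (+-comm _ _) (0≤⇒≤+ Metric.nonNegative))

  term-lipschitz : ∀ {n} (t : Term L n) →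
    ∃[ K ] (0# ≤ K) × (∀ ρ ρ′ → d (⟦ t ⟧ₜ ρ) (⟦ t ⟧ₜ ρ′) ≤ K * dⁿ ρ ρ′)
  terms-lipschitz : ∀ {n k} (ts : Vec (Term L n) k) →
    ∃[ K ] (0# ≤ K) × (∀ ρ ρ′ → dⁿ (⟦ ts ⟧ₜₛ ρ) (⟦ ts ⟧ₜₛ ρ′) ≤ K * dⁿ ρ ρ′)
  term-lipschitz (var i)    = 1# , 0≤1 , λ ρ ρ′ → ≤-resp refl (sym (*-identityˡ _)) (lookup-lipschitz i ρ ρ′)
  term-lipschitz (con c)    = 0# , ≤-refl , λ ρ ρ′ → ≤-reflexive (trans (d-refl _) (sym (zeroˡ _)))
  term-lipschitz (fun F ts) with terms-lipschitz ts
  ... | K , 0≤K , h = lipᶠ F * K , *-nonneg (lipᶠ≥0 F) 0≤K , λ ρ ρ′ →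
        ≤-trans (lipschitzᶠ F _ _) (≤-resp refl (sym (*-assoc _ _ _)) (*-monoˡ-≤ (lipᶠ≥0 F) (h ρ ρ′)))
  terms-lipschitz []       = 0# , ≤-refl , λ ρ ρ′ → ≤-reflexive (sym (zeroˡ _))
  terms-lipschitz (t ∷ ts) with term-lipschitz t | terms-lipschitz ts
  ... | K , 0≤K , h | K′ , 0≤K′ , h′ = K + K′ , +-nonneg 0≤K 0≤K′ , λ ρ ρ′ →
        ≤-resp refl (sym (distribʳ _ _ _)) (+-mono-≤ (h ρ ρ′) (h′ ρ ρ′))

  Lipschitz : ∀ {n} → Carrier → (Vec M n → Carrier) → Set
  Lipschitz K f = ∀ ρ ρ′ → f ρ ≤ f ρ′ + K * dⁿ ρ ρ′

  d-difference : ∀ x y x′ y′ → d x y ≤ d x′ y′ + (d x x′ + d y y′)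
  d-difference x y x′ y′ = ≤-trans (Metric.triangle x x′ y)
    (≤-trans (+-mono-≤ ≤-refl (Metric.triangle x′ y′ y))
      (≤-reflexive (trans (solve 3 (λ a b c → a :+ (b :+ c) := b :+ (a :+ c)) refl _ _ _)
        (+-congˡ (+-congˡ (d-sym y′ y))))))

  -- Needed for the values of a formula along Cauchy sequences to converge in mean. A negative
  -- factor exchanges the two tuples, which costs nothing since the condition is imposed on all
  -- pairs.
  formula-lipschitz : ∀ {n} (φ : Formula L n) → ∃[ K ] (0# ≤ K) × Lipschitz K ⟦ φ ⟧
  formula-lipschitz 𝟙 = 0# , ≤-refl , λ ρ ρ′ →
    ≤-reflexive (sym (trans (+-congˡ (zeroˡ _)) (+-identityʳ _)))
  formula-lipschitz (rel P ts) with terms-lipschitz ts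
  ... | K , 0≤K , h = lipʳ P * K , *-nonneg (lipʳ≥0 P) 0≤K , λ ρ ρ′ →
        ≤-resp refl (+-comm _ _) (≤-unsub (≤-trans (lipschitzʳ P _ _)
          (≤-resp refl (sym (*-assoc _ _ _)) (*-monoˡ-≤ (lipʳ≥0 P) (h ρ ρ′)))))
  formula-lipschitz (dist s t) with term-lipschitz s | term-lipschitz t
  ... | K , 0≤K , h | K′ , 0≤K′ , h′ = K + K′ , +-nonneg 0≤K 0≤K′ , λ ρ ρ′ →
        ≤-trans (d-difference _ _ _ _)
          (+-mono-≤ ≤-refl (≤-resp refl (sym (distribʳ _ _ _)) (+-mono-≤ (h ρ ρ′) (h′ ρ ρ′))))
  formula-lipschitz (r · φ) with formula-lipschitz φ | total 0# r
  ... | K , 0≤K , h | inj₁ 0≤r = r * K , *-nonneg 0≤r 0≤K , λ ρ ρ′ →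
        ≤-resp refl (trans (distribˡ _ _ _) (+-congˡ (sym (*-assoc _ _ _)))) (*-monoˡ-≤ 0≤r (h ρ ρ′))
  ... | K , 0≤K , h | inj₂ r≤0 = (- r) * K , *-nonneg (neg-nonneg r≤0) 0≤K , λ ρ ρ′ →
        ≤-by-difference (*-antitoneˡ-≤ r≤0 (h ρ′ ρ))
          (trans (+-congʳ (+-congˡ (*-congˡ (dⁿ-sym ρ ρ′))))
            (solve 5 (λ r K a b D → (r :* a :+ (:- r) :* K :* D) :- r :* b := r :* a :- r :* (b :+ K :* D))
              refl r K (⟦ φ ⟧ ρ′) (⟦ φ ⟧ ρ) (dⁿ ρ′ ρ)))
  formula-lipschitz (φ ⊕ ψ) with formula-lipschitz φ | formula-lipschitz ψ
  ... | K , 0≤K , h | K′ , 0≤K′ , h′ = K + K′ , +-nonneg 0≤K 0≤K′ , λ ρ ρ′ →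
        ≤-resp refl (solve 5 (λ a b K K′ D → (a :+ K :* D) :+ (b :+ K′ :* D) := (a :+ b) :+ (K :+ K′) :* D)
                       refl _ _ _ _ _)
          (+-mono-≤ (h ρ ρ′) (h′ ρ ρ′))
  formula-lipschitz (inf φ) with formula-lipschitz φ
  ... | K , 0≤K , h = K , 0≤K , λ ρ ρ′ → ≤-unsub (≤inf φ ρ′ λ m → ≤-sub
        (≤-trans (inf≤ φ ρ m) (≤-resp refl
          (+-congˡ (*-congˡ (trans (+-congʳ (d-refl m)) (+-identityˡ _)))) (h (m ∷ ρ) (m ∷ ρ′)))))
  formula-lipschitz (sup φ) with formula-lipschitz φ
  ... | K , 0≤K , h = K , 0≤K , λ ρ ρ′ → ⨆-least _ point (upper∷ φ ρ) λ m →
        ≤-trans (h (m ∷ ρ) (m ∷ ρ′)) (+-mono-≤ (⨆-upper _ point (upper∷ φ ρ′) m)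
          (≤-reflexive (*-congˡ (trans (+-congʳ (d-refl m)) (+-identityˡ _)))))

  inf*≤ : ∀ {n} (φ : Formula L n) ρ → ⟦ inf* n φ ⟧ [] ≤ ⟦ φ ⟧ ρ
  inf*≤ φ []      = ≤-refl
  inf*≤ φ (m ∷ ρ) = ≤-trans (inf*≤ (inf φ) ρ) (inf≤ φ ρ m)

  ≤inf* : ∀ n (φ : Formula L n) {x} → (∀ ρ → x ≤ ⟦ φ ⟧ ρ) → x ≤ ⟦ inf* n φ ⟧ []
  ≤inf* zero    φ h = h []
  ≤inf* (suc n) φ h = ≤inf* n (inf φ) λ ρ → ≤inf φ ρ λ m → h (m ∷ ρ)

-- Limits at a geometric rate

module RapidLimits (em : ∀ {ℓ} → ExcludedMiddle ℓ) (R : CompleteOrderedField) where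
  open OrderedField em R

  -- The error is a stored constant times `δ n`. Sums, multiples and comparisons of limits then need
  -- only arithmetic on the constants.
  record _⟶_ (u : ℕ → Carrier) (l : Carrier) : Set where
    constructor rapidly
    field
      const-rate : Carrier
      rate≥0     : 0# ≤ const-rate
      limit≤     : ∀ n → l ≤ u n + const-rate * δ n
      ≤limit     : ∀ n → u n ≤ l + const-rate * δ n

  infix 4 _⟶_

  -- The limit is the supremum of the numbers `u n - C * δ n`, for which every `u n + C * δ n` is an
  -- upper bound.
  rapid-limit : ∀ u C → (∀ {m n} → m ℕ.≤ n → (u m ≤ u n + C * δ m) × (u n ≤ u m + C * δ m)) →
                ∃[ l ] u ⟶ l
  rapid-limit u C h = l , rapidly C 0≤C (λ n → ⨆-least f 0 f-above λ m → f≤ n m)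
                              (λ n → ≤-unsub (⨆-upper f 0 f-above n))
    where
    0≤C : 0# ≤ C
    0≤C = ≤-by-difference (proj₁ (h {0} {0} ℕ.≤-refl))
      (solve 2 (λ u C → C :- 0ₚ := (u :+ C :* 1ₚ) :- u) refl (u 0) C)
    f : ℕ → Carrier
    f n = u n - C * δ n
    f≤ : ∀ n m → f m ≤ u n + C * δ n
    f≤ n m with ℕ.≤-total m n
    ... | inj₁ m≤n = ≤-trans (≤-sub (proj₁ (h m≤n))) (0≤⇒≤+ (*-nonneg 0≤C (0≤δ n)))
    ... | inj₂ n≤m = ≤-sub (≤-trans (proj₂ (h n≤m)) (0≤⇒≤+ (*-nonneg 0≤C (0≤δ m))))
    f-above : BoundedAbove f
    f-above = u 0 + C * δ 0 , f≤ 0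
    l : Carrier
    l = ⨆ f 0 f-above

  ⟶-mono-upto : ∀ {u v l l′} C → (∀ n → u n ≤ v n + C * δ n) → u ⟶ l → v ⟶ l′ → l ≤ l′
  ⟶-mono-upto {u} {v} {l} {l′} C h (rapidly A _ l≤ _) (rapidly B _ _ ≤l′) =
    ≤-upto-δ (B + C + A) λ n → ≤-trans (l≤ n) (≤-trans (+-mono-≤ (≤-trans (h n) (+-mono-≤ (≤l′ n) ≤-refl)) ≤-refl)
      (≤-reflexive (solve 5 (λ l A B C e → l :+ B :* e :+ C :* e :+ A :* e := l :+ (B :+ C :+ A) :* e)
        refl l′ A B C (δ n))))

  ⟶-mono : ∀ {u v l l′} → (∀ n → u n ≤ v n) → u ⟶ l → v ⟶ l′ → l ≤ l′
  ⟶-mono h = ⟶-mono-upto 0# λ n →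
    ≤-resp refl (sym (trans (+-congˡ (zeroˡ _)) (+-identityʳ _))) (h n)

  ⟶-unique : ∀ {u v l l′} → (∀ n → u n ≈ v n) → u ⟶ l → v ⟶ l′ → l ≈ l′
  ⟶-unique h p q = antisym (⟶-mono (λ n → ≤-reflexive (h n)) p q)
                           (⟶-mono (λ n → ≤-reflexive (sym (h n))) q p)

  ⟶-cong : ∀ {u v l l′} → (∀ n → u n ≈ v n) → l ≈ l′ → u ⟶ l → v ⟶ l′
  ⟶-cong h e (rapidly A 0≤A l≤ ≤l) = rapidly A 0≤A
    (λ n → ≤-resp e (+-congʳ (h n)) (l≤ n)) (λ n → ≤-resp (h n) (+-congʳ e) (≤l n))

  ⟶-const : ∀ x → (λ _ → x) ⟶ x
  ⟶-const x = rapidly 0# ≤-refl (λ n → 0≤⇒≤+ (≤-reflexive (sym (zeroˡ _))))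
                                (λ n → 0≤⇒≤+ (≤-reflexive (sym (zeroˡ _))))

  ⟶-+ : ∀ {u v l l′} → u ⟶ l → v ⟶ l′ → (λ n → u n + v n) ⟶ (l + l′)
  ⟶-+ (rapidly A 0≤A l≤ ≤l) (rapidly B 0≤B l′≤ ≤l′) = rapidly (A + B) (+-nonneg 0≤A 0≤B)
    (λ n → ≤-resp refl (regroup _ _ _) (+-mono-≤ (l≤ n) (l′≤ n)))
    (λ n → ≤-resp refl (regroup _ _ _) (+-mono-≤ (≤l n) (≤l′ n)))
    where
    regroup : ∀ x y e → (x + A * e) + (y + B * e) ≈ (x + y) + (A + B) * e
    regroup x y e = solve 5 (λ x y A B e → (x :+ A :* e) :+ (y :+ B :* e) := (x :+ y) :+ (A :+ B) :* e)
      refl x y A B e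

  ⟶-* : ∀ {u l} r → u ⟶ l → (λ n → r * u n) ⟶ (r * l)
  ⟶-* {u} {l} r (rapidly A 0≤A l≤ ≤l) with total 0# r
  ... | inj₁ 0≤r = rapidly (r * A) (*-nonneg 0≤r 0≤A) (λ n → scaled (l≤ n)) (λ n → scaled (≤l n))
    where
    scaled : ∀ {x y e} → x ≤ y + A * e → r * x ≤ r * y + r * A * e
    scaled p = ≤-resp refl (trans (distribˡ _ _ _) (+-congˡ (sym (*-assoc _ _ _)))) (*-monoˡ-≤ 0≤r p)
  ... | inj₂ r≤0 = rapidly ((- r) * A) (*-nonneg (neg-nonneg r≤0) 0≤A) (λ n → scaled (≤l n)) (λ n → scaled (l≤ n))
    where
    scaled : ∀ {x y e} → x ≤ y + A * e → r * y ≤ r * x + (- r) * A * e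
    scaled {x} {y} {e} p = ≤-by-difference (*-antitoneˡ-≤ r≤0 p)
      (solve 5 (λ x y r A e → (r :* x :+ (:- r) :* A :* e) :- r :* y := r :* x :- r :* (y :+ A :* e))
        refl x y r A e)

  ⟶-eventually-≤ : ∀ {u l b} m → (∀ n → m ℕ.≤ n → u n ≤ b) → u ⟶ l → l ≤ b
  ⟶-eventually-≤ m h (rapidly A 0≤A l≤ _) = ≤-upto-δ A λ n → ≤-trans (l≤ (m ℕ.+ n))
    (+-mono-≤ (h _ (ℕ.m≤m+n m n)) (*-monoˡ-≤ 0≤A (δ-antitone (ℕ.m≤n+m n m))))

  ⟶-eventually-≥ : ∀ {u l b} m → (∀ n → m ℕ.≤ n → b ≤ u n) → u ⟶ l → b ≤ l
  ⟶-eventually-≥ m h (rapidly A 0≤A _ ≤l) = ≤-upto-δ A λ n → ≤-trans (h _ (ℕ.m≤m+n m n))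
    (≤-trans (≤l (m ℕ.+ n)) (+-mono-≤ ≤-refl (*-monoˡ-≤ 0≤A (δ-antitone (ℕ.m≤n+m n m)))))

  0<δ : ∀ n → 0# < δ n
  0<δ zero    = 0≤1 , 0≉1
  0<δ (suc n) = 0≤δ (suc n) , λ 0≈ → proj₂ (0<δ n)
    (trans (sym (+-identityˡ 0#)) (trans (+-cong 0≈ 0≈) (δ-halves n)))

-- Ultrameans and Łoś's theorem

-- The mean of an I-indexed family of copies of 𝓜 with respect to ∫: the
-- distances and relations are integrated, and the resulting pseudometric
-- space is completed by rapidly converging sequences.
module UltraMean (em : ∀ {ℓ} → ExcludedMiddle ℓ) (ext : ∀ {a b} → Extensionality a b)
  {R : CompleteOrderedField} {L : Language R} (𝓜 : Structure L) (I : Set)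
  (μ : HahnBanach.PositiveLinear em ext R I)
  (normalised : CompleteOrderedField._≈_ R
     (HahnBanach.PositiveLinear.∫ μ (HahnBanach.const em ext R (CompleteOrderedField.1# R)))
     (CompleteOrderedField.1# R))
  where

  open OrderedField em R
  open HahnBanach em ext R
  open RapidLimits em R
  open Language L
  open Structure 𝓜
  open Semantics 𝓜
  open StructureProperties em 𝓜
  open PositiveLinear μ

  ∫-const : ∀ r → ∫ (const r) ≈ r
  ∫-const r = trans (∫-cong {g = r ⊡ const 1#} λ _ → sym (*-identityʳ r))
    (trans (∫-⊡ r (const 1#)) (trans (*-congˡ normalised) (*-identityʳ r)))

  distance : (x y : I → M) → BoundedFunction I
  distance x y = bounded (λ i → d (x i) (y i)) (0# , λ _ → Metric.nonNegative) (1# , λ _ → d≤1 _ _)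

  distanceⁿ : ∀ {k} (x y : I → Vec M k) → BoundedFunction I
  distanceⁿ {k} x y = bounded (λ i → dⁿ (x i) (y i)) (0# , λ i → dⁿ-nonneg (x i) (y i))
    (proj₁ (dⁿ-bounded k) , λ i → proj₂ (dⁿ-bounded k) (x i) (y i))

  -- The points of the completion are sequences of arbitrary families, Cauchy in mean distance. The
  -- stored `rate` lets function symbols act on such sequences with a computed rate for the result.
  record Seq : Set where
    field
      seq    : ℕ → I → M
      rate   : Carrier
      cauchy : ∀ {m n} → m ℕ.≤ n → ∫ (distance (seq m) (seq n)) ≤ rate * δ m
  open Seq

  snapshot : ∀ {k} → Vec Seq k → ℕ → I → Vec M k
  snapshot ρ n i = Vec.map (λ s → seq s n i) ρ

  rateⁿ : ∀ {k} → Vec Seq k → Carrier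
  rateⁿ []      = 0#
  rateⁿ (s ∷ ρ) = rate s + rateⁿ ρ

  cauchyⁿ : ∀ {k} (ρ : Vec Seq k) {m n} → m ℕ.≤ n →
            ∫ (distanceⁿ (snapshot ρ m) (snapshot ρ n)) ≤ rateⁿ ρ * δ m
  cauchyⁿ []      m≤n = ≤-reflexive (trans (∫-cong {g = const 0#} λ _ → refl)
                          (trans (∫-const 0#) (sym (zeroˡ _))))
  cauchyⁿ (s ∷ ρ) {m} {n} m≤n = ≤-resp (sym (∫-+ (distance (seq s m) (seq s n)) (distanceⁿ (snapshot ρ m) (snapshot ρ n)) λ _ → refl))
    (sym (distribʳ _ _ _)) (+-mono-≤ (cauchy s m≤n) (cauchyⁿ ρ m≤n))

  -- What relation symbols and formulas have in common, and enough for means along a tuple of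
  -- sequences to converge. It serves both to define the ultramean and to evaluate formulas in it.
  record LipschitzFunction (k : ℕ) : Set where
    field
      fn        : Vec M k → Carrier
      fn-below  : BoundedBelow fn
      fn-above  : BoundedAbove fn
      modulus   : Carrier
      modulus≥0 : 0# ≤ modulus
      lipschitz : Lipschitz modulus fn

    along : (I → Vec M k) → BoundedFunction I
    along x = bounded (λ i → fn (x i)) (proj₁ fn-below , λ i → proj₂ fn-below (x i))
                                       (proj₁ fn-above , λ i → proj₂ fn-above (x i))

    mean : Vec Seq k → ℕ → Carrier
    mean ρ n = ∫ (along (snapshot ρ n))

    along-difference : ∀ x y → ∫ (along x) ≤ ∫ (along y) + modulus * ∫ (distanceⁿ x y)
    along-difference x y = ≤-resp refl (trans (∫-⊞ _ _) (+-congˡ (∫-⊡ modulus (distanceⁿ x y))))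
      (∫-mono {along x} {along y ⊞ modulus ⊡ distanceⁿ x y} λ i → lipschitz (x i) (y i))

    mean-step : ∀ ρ {m n} → m ℕ.≤ n → (mean ρ m ≤ mean ρ n + modulus * rateⁿ ρ * δ m)
                                    × (mean ρ n ≤ mean ρ m + modulus * rateⁿ ρ * δ m)
    mean-step ρ {m} {n} m≤n =
      ≤-trans (along-difference (snapshot ρ m) (snapshot ρ n)) (+-mono-≤ ≤-refl rate≤) ,
      ≤-trans (along-difference (snapshot ρ n) (snapshot ρ m)) (+-mono-≤ ≤-refl (≤-trans
        (≤-reflexive (*-congˡ (∫-cong {distanceⁿ (snapshot ρ n) (snapshot ρ m)}
          {distanceⁿ (snapshot ρ m) (snapshot ρ n)} λ i → dⁿ-sym (snapshot ρ n i) (snapshot ρ m i)))) rate≤))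
      where
      rate≤ = ≤-resp refl (sym (*-assoc _ _ _)) (*-monoˡ-≤ modulus≥0 (cauchyⁿ ρ m≤n))

    private
      converges : ∀ ρ → ∃[ l ] mean ρ ⟶ l
      converges ρ = rapid-limit (mean ρ) (modulus * rateⁿ ρ) (mean-step ρ)

    limit : Vec Seq k → Carrier
    limit ρ = proj₁ (converges ρ)

    ⟶limit : ∀ ρ → mean ρ ⟶ limit ρ
    ⟶limit ρ = proj₂ (converges ρ)

  open LipschitzFunction using (along; mean; limit; ⟶limit)

  relation : (P : Rel′) → LipschitzFunction (arityʳ P)
  relation P = record
    { fn = ⟦ P ⟧ʳ ; fn-below = 0# , 0≤rel P ; fn-above = 1# , rel≤1 P
    ; modulus = lipʳ P ; modulus≥0 = lipʳ≥0 P
    ; lipschitz = λ ρ ρ′ → ≤-resp refl (+-comm _ _) (≤-unsub (lipschitzʳ P ρ ρ′)) }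

  formula : ∀ {k} → Formula L k → LipschitzFunction k
  formula φ = record
    { fn = ⟦ φ ⟧ ; fn-below = lower φ ; fn-above = upper φ
    ; modulus = proj₁ (formula-lipschitz φ) ; modulus≥0 = proj₁ (proj₂ (formula-lipschitz φ))
    ; lipschitz = proj₂ (proj₂ (formula-lipschitz φ)) }

  d̂-function : LipschitzFunction 2
  d̂-function = formula (dist (var zero) (var (suc zero)))

  abstract
    d̂ : Seq → Seq → Carrier
    d̂ s t = limit d̂-function (s ∷ t ∷ [])

    ⟶d̂ : ∀ s t → (λ n → ∫ (distance (seq s n) (seq t n))) ⟶ d̂ s t
    ⟶d̂ s t = ⟶-cong (λ n → ∫-cong λ _ → refl) refl (⟶limit d̂-function (s ∷ t ∷ []))

  d̂-nonneg : ∀ {s t} → 0# ≤ d̂ s t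
  d̂-nonneg {s} {t} = ⟶-mono (λ n → ≤-resp (∫-const 0#) refl (∫-mono λ i → Metric.nonNegative))
    (⟶-const 0#) (⟶d̂ s t)

  d̂≤1 : ∀ s t → d̂ s t ≤ 1#
  d̂≤1 s t = ⟶-mono (λ n → ≤-resp refl (∫-const 1#) (∫-mono λ i → d≤1 _ _)) (⟶d̂ s t) (⟶-const 1#)

  d̂-sym : ∀ s t → d̂ s t ≈ d̂ t s
  d̂-sym s t = ⟶-unique (λ n → ∫-cong λ i → d-sym _ _) (⟶d̂ s t) (⟶d̂ t s)

  d̂-refl : ∀ s → d̂ s s ≈ 0#
  d̂-refl s = ⟶-unique (λ n → trans (∫-cong λ i → d-refl _) (∫-const 0#)) (⟶d̂ s s) (⟶-const 0#)

  d̂-triangle : ∀ s t u → d̂ s u ≤ d̂ s t + d̂ t u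
  d̂-triangle s t u = ⟶-mono
    (λ n → ≤-resp refl (∫-⊞ (distance (seq s n) (seq t n)) (distance (seq t n) (seq u n)))
      (∫-mono λ i → Metric.triangle _ _ _))
    (⟶d̂ s u) (⟶-+ (⟶d̂ s t) (⟶d̂ t u))

  constant : (I → M) → Seq
  constant x = record
    { seq = λ _ → x ; rate = 0#
    ; cauchy = λ _ → ≤-reflexive (trans (∫-cong λ i → d-refl _) (trans (∫-const 0#) (sym (zeroˡ _)))) }

  d̂-constant : ∀ s m → d̂ s (constant (seq s m)) ≤ rate s * δ m
  d̂-constant s m = ⟶-eventually-≤ m
    (λ n m≤n → ≤-trans (≤-reflexive (∫-cong λ i → d-sym _ _)) (cauchy s m≤n))
    (⟶d̂ s (constant (seq s m)))

  d̂-constants : ∀ x y → ∫ (distance x y) ≈ d̂ (constant x) (constant y)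
  d̂-constants x y = ⟶-unique (λ _ → refl) (⟶-const _) (⟶d̂ (constant x) (constant y))

  module Completeness (S : ℕ → Seq)
    (S-cauchy : ∀ {ε} → 0# < ε → ∃[ N ] ∀ i j → N ℕ.≤ i → N ℕ.≤ j → d̂ (S i) (S j) ≤ ε) where

    threshold : ℕ → ℕ
    threshold zero    = proj₁ (S-cauchy (0<δ 0))
    -- Adding the previous threshold makes the sequence of thresholds monotone.
    threshold (suc n) = threshold n ℕ.+ proj₁ (S-cauchy (0<δ (suc n)))

    threshold-mono : ∀ {m n} → m ℕ.≤ n → threshold m ℕ.≤ threshold n
    threshold-mono m≤n = go (ℕ.≤⇒≤′ m≤n)
      where
      go : ∀ {m n} → m ℕ.≤′ n → threshold m ℕ.≤ threshold n
      go ℕ.≤′-refl       = ℕ.≤-refl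
      go (ℕ.≤′-step m≤n) = ℕ.≤-trans (go m≤n) (ℕ.m≤m+n _ _)

    beyond : ∀ n {i j} → threshold n ℕ.≤ i → threshold n ℕ.≤ j → d̂ (S i) (S j) ≤ δ n
    beyond zero    p q = proj₂ (S-cauchy (0<δ 0)) _ _ p q
    beyond (suc n) p q = proj₂ (S-cauchy (0<δ (suc n))) _ _
      (ℕ.≤-trans (ℕ.m≤n+m _ (threshold n)) p) (ℕ.≤-trans (ℕ.m≤n+m _ (threshold n)) q)

    T : ℕ → Seq
    T n = S (threshold n)

    -- Far enough along `T n` that freezing the sequence there moves it by at most `δ n`.
    index : ℕ → ℕ
    index n = proj₁ (δ-small (rate (T n)) (0<δ n))

    diagonal : ℕ → I → M
    diagonal n = seq (T n) (index n)

    T-diagonal : ∀ n → d̂ (T n) (constant (diagonal n)) ≤ δ n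
    T-diagonal n = ≤-trans (d̂-constant (T n) (index n)) (proj₂ (δ-small (rate (T n)) (0<δ n)))

    -- One `δ m` for each leg of the path from `diagonal m` through `T m` and `T n` to `diagonal n`.
    3# : Carrier
    3# = 1# + 1# + 1#

    diagonal-cauchy : ∀ {m n} → m ℕ.≤ n → ∫ (distance (diagonal m) (diagonal n)) ≤ 3# * δ m
    diagonal-cauchy {m} {n} m≤n = ≤-trans (≤-reflexive (d̂-constants _ _))
      (≤-trans (d̂-triangle _ (T m) _) (≤-trans (+-mono-≤
        (≤-trans (≤-reflexive (d̂-sym _ _)) (T-diagonal m))
        (≤-trans (d̂-triangle _ (T n) _) (+-mono-≤
          (beyond m ℕ.≤-refl (threshold-mono m≤n))
          (≤-trans (T-diagonal n) (δ-antitone m≤n)))))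
        (≤-reflexive (solve 1 (λ e → e :+ (e :+ e) := (1ₚ :+ 1ₚ :+ 1ₚ) :* e) refl (δ m)))))

    limit-point : Seq
    limit-point = record { seq = diagonal ; rate = 3# ; cauchy = diagonal-cauchy }

    5# : Carrier
    5# = 1# + 1# + 3#

    near-limit : ∀ n i → threshold n ℕ.≤ i → d̂ (S i) limit-point ≤ 5# * δ n
    near-limit n i p = ≤-trans (d̂-triangle _ (T n) _) (≤-trans (+-mono-≤
        (beyond n p ℕ.≤-refl)
        (≤-trans (d̂-triangle _ (constant (diagonal n)) _) (+-mono-≤ (T-diagonal n)
          (≤-trans (≤-reflexive (d̂-sym _ _)) (d̂-constant limit-point n)))))
      (≤-reflexive (solve 2 (λ e k → e :+ (e :+ k :* e) := (1ₚ :+ 1ₚ :+ k) :* e) refl (δ n) 3#)))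

    converges : ∀ {ε} → 0# < ε → ∃[ N ] ∀ i → N ℕ.≤ i → d̂ (S i) limit-point ≤ ε
    converges 0<ε with δ-small 5# 0<ε
    ... | n , small = threshold n , λ i p → ≤-trans (near-limit n i p) small

  completion : CompleteMetricSpace R
  completion = record
    { M        = Seq
    ; _≈ₘ_     = λ s t → d̂ s t ≈ 0#
    ; point    = constant λ _ → point
    ; d        = d̂
    ; isMetric = record
      { isSemiMetric = record
        { isQuasiSemiMetric = record
          { isPreMetric = record
            { isProtoMetric = record
              { isPartialOrder  = isPartialOrder
              ; ≈-isEquivalence = record
                { refl  = λ {s} → d̂-refl s
                ; sym   = λ {s} {t} e → trans (d̂-sym t s) e
                ; trans = λ {s} {t} {u} e e′ → antisym
                    (≤-trans (d̂-triangle s t u) (≤-reflexive (trans (+-cong e e′) (+-identityˡ 0#))))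
                    d̂-nonneg
                }
              ; cong        = λ {s} {s′} {t} {t′} e e′ → antisym (move e e′)
                  (move (trans (d̂-sym s′ s) e) (trans (d̂-sym t′ t) e′))
              ; nonNegative = d̂-nonneg
              }
            ; ≈⇒0 = λ e → e
            }
          ; 0⇒≈ = λ e → e
          }
        ; sym = d̂-sym
        }
      ; triangle = d̂-triangle
      }
    ; d≤1      = d̂≤1
    ; cauchy-complete = λ S c → Completeness.limit-point S c , Completeness.converges S c
    }
    where
    move : ∀ {s s′ t t′} → d̂ s s′ ≈ 0# → d̂ t t′ ≈ 0# → d̂ s t ≤ d̂ s′ t′
    move {s} {s′} {t} {t′} e e′ = ≤-trans (d̂-triangle s s′ t) (≤-trans
      (+-mono-≤ (≤-reflexive e) (≤-trans (d̂-triangle s′ t′ t)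
        (+-mono-≤ ≤-refl (≤-reflexive (trans (d̂-sym t′ t) e′)))))
      (≤-reflexive (trans (+-identityˡ _) (+-identityʳ _))))

  open CompleteMetricSpace completion using () renaming (dⁿ to d̂ⁿ)

  ⟶d̂ⁿ : ∀ {k} (ρ σ : Vec Seq k) →
        (λ n → ∫ (distanceⁿ (snapshot ρ n) (snapshot σ n))) ⟶ d̂ⁿ ρ σ
  ⟶d̂ⁿ []      []      = ⟶-cong (λ n → sym (trans (∫-cong {g = const 0#} λ _ → refl) (∫-const 0#))) refl (⟶-const 0#)
  ⟶d̂ⁿ (s ∷ ρ) (t ∷ σ) = ⟶-cong
    (λ n → sym (∫-+ (distance (seq s n) (seq t n)) (distanceⁿ (snapshot ρ n) (snapshot σ n)) λ _ → refl)) refl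
    (⟶-+ (⟶d̂ s t) (⟶d̂ⁿ ρ σ))

  apply-modulus : ∀ F (x y : I → Vec M (arityᶠ F)) →
    ∫ (distance (λ i → ⟦ F ⟧ᶠ (x i)) (λ i → ⟦ F ⟧ᶠ (y i))) ≤ lipᶠ F * ∫ (distanceⁿ x y)
  apply-modulus F x y = ≤-resp refl (∫-⊡ _ (distanceⁿ x y)) (∫-mono λ i → lipschitzᶠ F (x i) (y i))

  apply : (F : Fun) → Vec Seq (arityᶠ F) → Seq
  apply F ρ = record
    { seq    = λ n i → ⟦ F ⟧ᶠ (snapshot ρ n i)
    ; rate   = lipᶠ F * rateⁿ ρ
    ; cauchy = λ {m} {n} m≤n → ≤-trans (apply-modulus F (snapshot ρ m) (snapshot ρ n))
        (≤-resp refl (sym (*-assoc _ _ _)) (*-monoˡ-≤ (lipᶠ≥0 F) (cauchyⁿ ρ m≤n))) }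

  apply-lipschitz : ∀ F ρ σ → d̂ (apply F ρ) (apply F σ) ≤ lipᶠ F * d̂ⁿ ρ σ
  apply-lipschitz F ρ σ = ⟶-mono (λ n → apply-modulus F (snapshot ρ n) (snapshot σ n))
    (⟶d̂ (apply F ρ) (apply F σ)) (⟶-* (lipᶠ F) (⟶d̂ⁿ ρ σ))

  abstract
    relation̂ : (P : Rel′) → Vec Seq (arityʳ P) → Carrier
    relation̂ P = limit (relation P)

    ⟶relation̂ : ∀ P ρ → mean (relation P) ρ ⟶ relation̂ P ρ
    ⟶relation̂ P = ⟶limit (relation P)

  relation̂-lipschitz : ∀ P ρ σ → relation̂ P ρ - relation̂ P σ ≤ lipʳ P * d̂ⁿ ρ σ
  relation̂-lipschitz P ρ σ = ≤-sub (≤-resp refl (+-comm _ _) (⟶-mono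
    (λ n → LipschitzFunction.along-difference (relation P) (snapshot ρ n) (snapshot σ n))
    (⟶relation̂ P ρ) (⟶-+ (⟶relation̂ P σ) (⟶-* (lipʳ P) (⟶d̂ⁿ ρ σ)))))

  relation̂-nonneg : ∀ P ρ → 0# ≤ relation̂ P ρ
  relation̂-nonneg P ρ = ⟶-mono
    (λ n → ≤-resp (∫-const 0#) refl (∫-mono {const 0#} {along (relation P) (snapshot ρ n)} λ i → 0≤rel P _))
    (⟶-const 0#) (⟶relation̂ P ρ)

  relation̂≤1 : ∀ P ρ → relation̂ P ρ ≤ 1#
  relation̂≤1 P ρ = ⟶-mono
    (λ n → ≤-resp refl (∫-const 1#) (∫-mono {along (relation P) (snapshot ρ n)} {const 1#} λ i → rel≤1 P _))
    (⟶relation̂ P ρ) (⟶-const 1#)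

  ultraMean : Structure L
  ultraMean = record
    { space      = completion
    ; ⟦_⟧ᶜ       = λ c → constant λ _ → ⟦ c ⟧ᶜ
    ; ⟦_⟧ᶠ       = apply
    ; ⟦_⟧ʳ       = relation̂
    ; lipschitzᶠ = apply-lipschitz
    ; lipschitzʳ = relation̂-lipschitz
    ; 0≤rel      = relation̂-nonneg
    ; rel≤1      = relation̂≤1
    }

  private
    module N  = Structure ultraMean
    module ⟪N⟫ = Semantics ultraMean
    module PN = StructureProperties em ultraMean

  snapshot-term : ∀ {k} (t : Term L k) ρ n i → seq (N.⟦ t ⟧ₜ ρ) n i ≡ ⟦ t ⟧ₜ (snapshot ρ n i)
  snapshot-terms : ∀ {k j} (ts : Vec (Term L k) j) ρ n i →
                   snapshot (N.⟦ ts ⟧ₜₛ ρ) n i ≡ ⟦ ts ⟧ₜₛ (snapshot ρ n i)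
  snapshot-term (var j)    ρ n i = ≡.sym (Vec.lookup-map j (λ s → seq s n i) ρ)
  snapshot-term (con c)    ρ n i = ≡.refl
  snapshot-term (fun F ts) ρ n i = ≡.cong ⟦ F ⟧ᶠ (snapshot-terms ts ρ n i)
  snapshot-terms []       ρ n i = ≡.refl
  snapshot-terms (t ∷ ts) ρ n i = ≡.cong₂ _∷_ (snapshot-term t ρ n i) (snapshot-terms ts ρ n i)

  -- From above, near-optimal witnesses at snapshot `n`, chosen separately at each index, form a
  -- constant sequence and hence a point of the ultramean. From below, the infimum is pointwise at
  -- most the value at any `s`, and the mean is monotone.
  ⟶inf : ∀ {k} (φ : Formula L (suc k)) → (∀ ρ → mean (formula φ) ρ ⟶ ⟪N⟫.⟦ φ ⟧ ρ) →
         ∀ ρ → mean (formula (inf φ)) ρ ⟶ ⟪N⟫.⟦ inf φ ⟧ ρ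
  ⟶inf φ ih ρ = rapidly C 0≤C inf≤mean mean≤inf
    where
    module Φ = LipschitzFunction (formula φ)
    module Ι = LipschitzFunction (formula (inf φ))
    D : Carrier
    D = rateⁿ ρ
    0≤D : 0# ≤ D
    0≤D = ≤-resp refl (*-identityʳ D) (≤-trans
      (≤-resp (∫-const 0#) refl (∫-mono {const 0#} {distanceⁿ (snapshot ρ 0) (snapshot ρ 0)} λ i →
        dⁿ-nonneg (snapshot ρ 0 i) (snapshot ρ 0 i))) (cauchyⁿ ρ {0} {0} ℕ.≤-refl))
    C : Carrier
    -- The 1 pays for the near-optimal witnesses, the two products for the drift of `φ` and of
    -- `inf φ` between snapshots.
    C = 1# + Φ.modulus * D + Ι.modulus * D
    0≤ΦD = *-nonneg Φ.modulus≥0 0≤D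
    0≤ΙD = *-nonneg Ι.modulus≥0 0≤D
    0≤C : 0# ≤ C
    0≤C = +-nonneg (+-nonneg 0≤1 0≤ΦD) 0≤ΙD

    inf≤mean : ∀ n → ⟪N⟫.⟦ inf φ ⟧ ρ ≤ mean (formula (inf φ)) ρ n + C * δ n
    inf≤mean n = ≤-trans (PN.inf≤ φ ρ (constant y))
      (⟶-eventually-≤ n bound (ih (constant y ∷ ρ)))
      where
      y : I → M
      y i = proj₁ (near-inf φ (snapshot ρ n i) (0<δ n))
      bound : ∀ m → n ℕ.≤ m → mean (formula φ) (constant y ∷ ρ) m ≤ mean (formula (inf φ)) ρ n + C * δ n
      bound m n≤m = ≤-trans (proj₂ (Φ.mean-step (constant y ∷ ρ) n≤m)) (≤-trans
        (+-mono-≤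
          (≤-resp refl (trans (∫-⊞ (Ι.along (snapshot ρ n)) (const (δ n))) (+-congˡ (∫-const (δ n))))
            (∫-mono {Φ.along (snapshot (constant y ∷ ρ) n)} λ i → proj₂ (near-inf φ (snapshot ρ n i) (0<δ n))))
          ≤-refl)
        (≤-trans (≤-reflexive (solve 4 (λ a e k D → (a :+ e) :+ k :* (0ₚ :+ D) :* e := a :+ (1ₚ :+ k :* D) :* e)
            refl (mean (formula (inf φ)) ρ n) (δ n) Φ.modulus D))
          (+-mono-≤ ≤-refl (*-monoʳ-≤ (0≤δ n) (0≤⇒≤+ 0≤ΙD)))))

    mean≤inf : ∀ n → mean (formula (inf φ)) ρ n ≤ ⟪N⟫.⟦ inf φ ⟧ ρ + C * δ n
    mean≤inf n = ≤-unsub (PN.≤inf φ ρ λ s → ≤-sub (bound s))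
      where
      bound : ∀ s → mean (formula (inf φ)) ρ n ≤ ⟪N⟫.⟦ φ ⟧ (s ∷ ρ) + C * δ n
      bound s = ≤-trans (≤-unsub (⟶-eventually-≥ {mean (formula φ) (s ∷ ρ)} n
          (λ m n≤m → ≤-sub (≤-trans (proj₁ (Ι.mean-step ρ n≤m)) (+-mono-≤ (inf-mean≤ m) ≤-refl)))
          (ih (s ∷ ρ))))
        (+-mono-≤ ≤-refl (*-monoʳ-≤ (0≤δ n) (≤-resp refl (+-comm _ _) (0≤⇒≤+ (+-nonneg 0≤1 0≤ΦD)))))
        where
        inf-mean≤ : ∀ m → mean (formula (inf φ)) ρ m ≤ mean (formula φ) (s ∷ ρ) m
        inf-mean≤ m = ∫-mono {Ι.along (snapshot ρ m)} {Φ.along (snapshot (s ∷ ρ) m)}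
          λ i → inf≤ φ (snapshot ρ m i) (seq s m i)

  ⟶· : ∀ {k} r (φ : Formula L k) → (∀ ρ → mean (formula φ) ρ ⟶ ⟪N⟫.⟦ φ ⟧ ρ) →
       ∀ ρ → mean (formula (r · φ)) ρ ⟶ ⟪N⟫.⟦ r · φ ⟧ ρ
  ⟶· r φ ih ρ = ⟶-cong
    (λ n → sym (∫-* r (along (formula φ) (snapshot ρ n)) λ _ → refl)) refl (⟶-* r (ih ρ))

  -- Łoś's theorem for affine formulas
  mean⟶ : ∀ {k} (φ : Formula L k) ρ → mean (formula φ) ρ ⟶ ⟪N⟫.⟦ φ ⟧ ρ
  mean⟶ 𝟙          ρ = ⟶-cong (λ n → sym (trans (∫-cong λ _ → refl) normalised)) refl (⟶-const 1#)
  mean⟶ (rel P ts) ρ = ⟶-cong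
    (λ n → ∫-cong λ i → reflexive (≡.cong ⟦ P ⟧ʳ (snapshot-terms ts ρ n i))) refl
    (⟶relation̂ P (N.⟦ ts ⟧ₜₛ ρ))
  mean⟶ (dist s t) ρ = ⟶-cong
    (λ n → ∫-cong λ i → reflexive (≡.cong₂ d (snapshot-term s ρ n i) (snapshot-term t ρ n i))) refl
    (⟶d̂ (N.⟦ s ⟧ₜ ρ) (N.⟦ t ⟧ₜ ρ))
  mean⟶ (r · φ)    ρ = ⟶· r φ (mean⟶ φ) ρ
  mean⟶ (φ ⊕ ψ)    ρ = ⟶-cong
    (λ n → sym (∫-+ (along (formula φ) (snapshot ρ n)) (along (formula ψ) (snapshot ρ n)) λ _ → refl)) refl
    (⟶-+ (mean⟶ φ ρ) (mean⟶ ψ ρ))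
  mean⟶ (inf φ)    ρ = ⟶inf φ (mean⟶ φ) ρ
  mean⟶ (sup φ)    ρ = ⟶-cong
    (λ n → ∫-cong λ i → sym (⟦sup⟧≈ φ (snapshot ρ n i))) (sym (PN.⟦sup⟧≈ φ ρ))
    (⟶· (- 1#) (inf ((- 1#) · φ)) (⟶inf ((- 1#) · φ) (⟶· (- 1#) φ (mean⟶ φ))) ρ)

  sentence-preserved : ∀ (φ : Sentence L) → ⟪N⟫.⟦ φ ⟧ [] ≈ ⟦ φ ⟧ []
  sentence-preserved φ = ⟶-unique (λ n → trans (∫-cong λ _ → refl) (∫-const _)) (mean⟶ φ []) (⟶-const _)

  diagonals : ∀ {k} → (I → Vec M k) → Vec Seq k
  diagonals x = Vec.tabulate λ j → constant λ i → lookup (x i) j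

  value-at-diagonals : ∀ {k} (φ : Formula L k) (x : I → Vec M k) →
                       ⟪N⟫.⟦ φ ⟧ (diagonals x) ≈ ∫ (along (formula φ) x)
  value-at-diagonals φ x = ⟶-unique
    (λ n → ∫-cong λ i → reflexive (≡.cong ⟦ φ ⟧ (snapshot-diagonals n i))) (mean⟶ φ (diagonals x)) (⟶-const _)
    where
    snapshot-diagonals : ∀ n i → snapshot (diagonals x) n i ≡ x i
    snapshot-diagonals n i = ≡.trans (≡.sym (Vec.tabulate-∘ (λ s → seq s n i) (λ j → constant λ i → lookup (x i) j)))
                                     (Vec.tabulate∘lookup (x i))

-- Restricting a mean by a weight

module Reweighting (em : ∀ {ℓ} → ExcludedMiddle ℓ) (ext : ∀ {a b} → Extensionality a b)
                   (R : CompleteOrderedField) {I : Set} (μ : HahnBanach.PositiveLinear em ext R I) where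
  open OrderedField em R
  open HahnBanach em ext R
  open PositiveLinear μ

  private
    -- A weight between 0 and 1 preserves an upper bound only if the bound is nonnegative, and a
    -- lower bound only if it is nonpositive; hence the caps.
    upper-cap : ∀ u → ∃[ w ] (u ≤ w) × (0# ≤ w)
    upper-cap u with total 0# u
    ... | inj₁ 0≤u = u , ≤-refl , 0≤u
    ... | inj₂ u≤0 = 0# , u≤0 , ≤-refl

    lower-cap : ∀ l → ∃[ w ] (w ≤ l) × (w ≤ 0#)
    lower-cap l with total 0# l
    ... | inj₁ 0≤l = 0# , 0≤l , ≤-refl
    ... | inj₂ l≤0 = l , ≤-refl , l≤0

  module Weighted (w : I → Carrier) (0≤w : ∀ i → 0# ≤ w i) (w≤1 : ∀ i → w i ≤ 1#) where

    weigh : BoundedFunction I → BoundedFunction I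
    weigh (bounded f (l , l≤f) (u , f≤u)) = bounded (λ i → w i * f i)
      (l′ , λ i → ≤-trans (≤-resp (*-identityʳ l′) (*-comm _ _) (*-antitoneˡ-≤ l′≤0 (w≤1 i)))
                          (*-monoˡ-≤ (0≤w i) (≤-trans l′≤l (l≤f i))))
      (u′ , λ i → ≤-trans (*-monoˡ-≤ (0≤w i) (≤-trans (f≤u i) u≤u′))
                          (≤-resp refl (*-identityˡ u′) (*-monoʳ-≤ 0≤u′ (w≤1 i))))
      where
      l′   = proj₁ (lower-cap l)
      l′≤l = proj₁ (proj₂ (lower-cap l))
      l′≤0 = proj₂ (proj₂ (lower-cap l))
      u′   = proj₁ (upper-cap u)
      u≤u′ = proj₁ (proj₂ (upper-cap u))
      0≤u′ = proj₂ (proj₂ (upper-cap u))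

    module _ {c : Carrier} (0<c : 0# < c) where

      private
        c⁻¹   = proj₁ (positive-inverse 0<c)
        cc⁻¹≈1 = proj₁ (proj₂ (positive-inverse 0<c))
        0≤c⁻¹ = proj₂ (proj₂ (positive-inverse 0<c))

      reweighted : PositiveLinear I
      reweighted = record
        { ∫      = λ f → c⁻¹ * ∫ (weigh f)
        ; ∫-mono = λ {f} {g} f≤g → *-monoˡ-≤ 0≤c⁻¹ (∫-mono {weigh f} {weigh g} λ i → *-monoˡ-≤ (0≤w i) (f≤g i))
        ; ∫-⊞    = λ f g → trans
            (*-congˡ (∫-+ {weigh (f ⊞ g)} (weigh f) (weigh g) λ i → distribˡ (w i) (at f i) (at g i)))
            (distribˡ _ _ _)
        ; ∫-⊡    = λ r f → trans
            (*-congˡ (∫-* {weigh (r ⊡ f)} r (weigh f) λ i →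
              solve 3 (λ w r f → w :* (r :* f) := r :* (w :* f)) refl (w i) r (at f i)))
            (solve 3 (λ k r x → k :* (r :* x) := r :* (k :* x)) refl c⁻¹ r (∫ (weigh f)))
        }

      reweighted-scaled : ∀ f → c * PositiveLinear.∫ reweighted f ≈ ∫ (weigh f)
      reweighted-scaled f = trans (sym (*-assoc _ _ _)) (trans (*-congʳ cc⁻¹≈1) (*-identityˡ _))

      reweighted-≈1 : ∀ f → ∫ (weigh f) ≈ c → PositiveLinear.∫ reweighted f ≈ 1#
      reweighted-≈1 f e = trans (*-congˡ e) (trans (*-comm _ _) cc⁻¹≈1)

-- Extreme types of a complete theory

module CompleteTheory (em : ∀ {ℓ} → ExcludedMiddle ℓ) {R : CompleteOrderedField} {L : Language R}
                      {T : Theory L} (complete : Complete T) where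
  open OrderedField em R using (_≈_; _≤_; trans; sym; ≤-trans; ≤-reflexive)
  open Semantics

  sentences-agree : ∀ {𝓜 𝓝} → 𝓜 ⊨ T → 𝓝 ⊨ T → ∀ φ → ⟦_⟧ 𝓜 φ [] ≈ ⟦_⟧ 𝓝 φ []
  sentences-agree {𝓜} {𝓝} 𝓜⊨T 𝓝⊨T φ with complete φ
  ... | _ , h , _ = trans (h 𝓜 𝓜⊨T) (sym (h 𝓝 𝓝⊨T))

  -- A lower bound over all tuples is a lower bound of the single sentence `inf* n φ`, whose value
  -- the theory fixes.
  transfer-≤ : ∀ {𝓜 𝓝} → 𝓜 ⊨ T → 𝓝 ⊨ T → ∀ {n} (φ : Formula L n) {x} →
               (∀ ρ → x ≤ ⟦_⟧ 𝓜 φ ρ) → ∀ ρ → x ≤ ⟦_⟧ 𝓝 φ ρ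
  transfer-≤ {𝓜} {𝓝} 𝓜⊨T 𝓝⊨T {n} φ h ρ = ≤-trans (StructureProperties.≤inf* em 𝓜 n φ h)
    (≤-trans (≤-reflexive (sentences-agree 𝓜⊨T 𝓝⊨T (inf* n φ))) (StructureProperties.inf*≤ em 𝓝 φ ρ))

-- By Hahn-Banach a type of T is represented by a mean on the tuples of 𝓜₀. If φ
-- is {0,1}-valued in 𝓜₀ but has a value v strictly in between at the type, then
-- restricting the mean to φ = 1 and to φ = 0 exhibits the type as a proper convex
-- combination with weights v and 1 - v.
module ExtremeTypes (em : ∀ {ℓ} → ExcludedMiddle ℓ) (ext : ∀ {a b} → Extensionality a b)
  {R : CompleteOrderedField} {L : Language R} {T : Theory L} (T-complete : Complete T)
  {𝓜₀ : Structure L} (𝓜₀⊨T : 𝓜₀ ⊨ T) {𝓜 : Structure L} (𝓜⊨T : 𝓜 ⊨ T) where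

  open OrderedField em R
  open HahnBanach em ext R
  open CompleteTheory em T-complete
  private
    module M₀ where
      open Structure 𝓜₀ public
      open Semantics 𝓜₀ public
    module M where
      open Structure 𝓜 public
      open Semantics 𝓜 public

  evaluation : ∀ {n} → Formula L n → BoundedFunction (Vec M₀.M n)
  evaluation φ = bounded M₀.⟦ φ ⟧ (M₀.lower φ) (M₀.upper φ)

  record Realisation {n} (ν : PositiveLinear (Vec M₀.M n)) : Set₁ where
    field
      model       : Structure L
      model⊨T     : model ⊨ T
      tuple       : Vec (Structure.M model) n
      tuple-value : ∀ φ → Semantics.⟦_⟧ model φ tuple ≈ PositiveLinear.∫ ν (evaluation φ)

    type : Type T n
    type = tp {T = T} model (λ {c} → model⊨T {c}) tuple

  abstract
    -- The index set is the set of tuples itself and the realising tuple is the identity family, so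
    -- that a formula has as value there its mean over all tuples.
    realise : ∀ {n} (ν : PositiveLinear (Vec M₀.M n)) → PositiveLinear.∫ ν (const 1#) ≈ 1# → Realisation ν
    realise ν normalised = record
      { model       = ultraMean
      ; model⊨T     = λ { {φ ≼ ψ} φ≼ψ∈T → ≤-resp (sym (sentence-preserved φ)) (sym (sentence-preserved ψ))
                                            (𝓜₀⊨T {φ ≼ ψ} φ≼ψ∈T) }
      ; tuple       = diagonals id
      ; tuple-value = λ φ → trans (value-at-diagonals φ id)
          (PositiveLinear.∫-cong ν {LipschitzFunction.along (formula φ) id} {evaluation φ} λ _ → refl)
      }
      where open UltraMean em ext 𝓜₀ _ ν normalised

  module Representation {n} (a : Vec M.M n) where

    I : Set
    I = Vec M₀.M n

    Majorant : BoundedFunction I → Set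
    Majorant f = Σ (Formula L n) λ φ → f ≤ᵇ evaluation φ

    value : ∀ f → Majorant f → Carrier
    value f (φ , _) = M.⟦ φ ⟧ a

    -- Here completeness enters: a formula that dominates `f` on `𝓜₀` has a lower bound there, and
    -- the same bound holds at `a`. Without it the infimum over majorants need not exist.
    value-below : ∀ f → BoundedBelow (value f)
    value-below f = proj₁ (below f) , λ (φ , f≤φ) →
      transfer-≤ {𝓜₀} {𝓜} 𝓜₀⊨T 𝓜⊨T φ (λ ρ → ≤-trans (proj₂ (below f) ρ) (f≤φ ρ)) a

    trivial-majorant : ∀ f → Majorant f
    trivial-majorant f = proj₁ (above f) · 𝟙 , λ ρ →
      ≤-trans (proj₂ (above f) ρ) (≤-reflexive (sym (*-identityʳ _)))

    upper-value : BoundedFunction I → Carrier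
    upper-value f = ⨅ (value f) (trivial-majorant f) (value-below f)

    upper-value-≤ : ∀ f m → upper-value f ≤ value f m
    upper-value-≤ f = ⨅-lower (value f) (trivial-majorant f) (value-below f)

    upper-functional : Sublinear I
    upper-functional = record
      { ⟨_⟩    = upper-value
      ; mono   = λ {f} {g} f≤g → ⨅-greatest (value g) (trivial-majorant g) (value-below g)
          λ (φ , g≤φ) → upper-value-≤ f (φ , λ ρ → ≤-trans (f≤g ρ) (g≤φ ρ))
      ; subadd = λ f g → ⨅-+ λ (φ , f≤φ) (ψ , g≤ψ) →
          upper-value-≤ (f ⊞ g) (φ ⊕ ψ , λ ρ → +-mono-≤ (f≤φ ρ) (g≤ψ ρ))
      ; subhom = λ {r} f 0≤r → ⨅-scale 0≤r λ (φ , f≤φ) →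
          upper-value-≤ (r ⊡ f) (r · φ , λ ρ → *-monoˡ-≤ 0≤r (f≤φ ρ))
      }

    μ : PositiveLinear I
    μ = proj₁ (hahn-banach upper-functional)

    open PositiveLinear μ

    -- Every formula is its own majorant, so the mean is at most the value at `a`. The same for the
    -- negated formula gives equality by linearity.
    ∫-evaluation : ∀ φ → ∫ (evaluation φ) ≈ M.⟦ φ ⟧ a
    ∫-evaluation φ = antisym (dominated φ) (≤-by-difference
      (≤-trans (≤-reflexive (sym (∫-* {evaluation ((- 1#) · φ)} (- 1#) (evaluation φ) λ _ → refl)))
        (dominated ((- 1#) · φ)))
      (solve 2 (λ x y → x :- y := (:- 1ₚ) :* y :- (:- 1ₚ) :* x) refl (∫ (evaluation φ)) (M.⟦ φ ⟧ a)))
      where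
      dominated : ∀ φ → ∫ (evaluation φ) ≤ M.⟦ φ ⟧ a
      dominated φ = ≤-trans (proj₂ (hahn-banach upper-functional) (evaluation φ))
        (upper-value-≤ (evaluation φ) (φ , λ _ → ≤-refl))

  IsBinary : ∀ {n} → Formula L n → Set
  IsBinary φ = ∀ ρ → (M₀.⟦ φ ⟧ ρ ≈ 0#) ⊎ (M₀.⟦ φ ⟧ ρ ≈ 1#)

  module Splitting {n} (φ : Formula L n) (binary : IsBinary φ) (a : Vec M.M n)
    (v≉0 : ¬ (M.⟦ φ ⟧ a ≈ 0#)) (v≉1 : ¬ (M.⟦ φ ⟧ a ≈ 1#)) where
    open Representation a
    open PositiveLinear μ
    v : Carrier
    v = M.⟦ φ ⟧ a

    P Q : I → Carrier
    P = M₀.⟦ φ ⟧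
    Q i = 1# - P i

    0≤P : ∀ i → 0# ≤ P i
    0≤P i with binary i
    ... | inj₁ e = ≤-reflexive (sym e)
    ... | inj₂ e = ≤-trans 0≤1 (≤-reflexive (sym e))
    P≤1 : ∀ i → P i ≤ 1#
    P≤1 i with binary i
    ... | inj₁ e = ≤-trans (≤-reflexive e) 0≤1
    ... | inj₂ e = ≤-reflexive e
    PP≈P : ∀ i → P i * P i ≈ P i
    PP≈P i with binary i
    ... | inj₁ e = trans (*-cong e e) (trans (zeroˡ 0#) (sym e))
    ... | inj₂ e = trans (*-cong e refl) (*-identityˡ _)
    0≤Q : ∀ i → 0# ≤ Q i
    0≤Q i = x≤y⇒0≤y-x (P≤1 i)
    Q≤1 : ∀ i → Q i ≤ 1#
    Q≤1 i = ≤-by-difference (0≤P i) (solve 1 (λ p → 1ₚ :- (1ₚ :- p) := p :- 0ₚ) refl (P i))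

    0≤v : 0# ≤ v
    0≤v = transfer-≤ {𝓜₀} {𝓜} 𝓜₀⊨T 𝓜⊨T φ 0≤P a
    v≤1 : v ≤ 1#
    -- Only lower bounds transfer, so the upper bound of `φ` is carried over as a lower bound of its
    -- negative.
    v≤1 = ≤-by-difference
      (transfer-≤ {𝓜₀} {𝓜} 𝓜₀⊨T 𝓜⊨T ((- 1#) · φ) {(- 1#)}
        (λ ρ → ≤-resp (*-identityʳ _) refl (*-antitoneˡ-≤ -1≤0 (P≤1 ρ))) a)
      (solve 1 (λ v → 1ₚ :- v := (:- 1ₚ) :* v :- (:- 1ₚ)) refl v)
    0<v : 0# < v
    0<v = 0≤v , λ e → v≉0 (sym e)
    v<1 : v < 1#
    v<1 = v≤1 , v≉1
    0<1-v : 0# < 1# - v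
    0<1-v = x≤y⇒0≤y-x v≤1 , λ e → v≉1 (trans
      (solve 1 (λ v → v := 1ₚ :- (1ₚ :- v)) refl v)
      (trans (+-congˡ (-‿cong (sym e))) (solve 0 (1ₚ :- 0ₚ := 1ₚ) refl)))

    open Reweighting em ext R μ
    module WP = Weighted P 0≤P P≤1
    module WQ = Weighted Q 0≤Q Q≤1

    ∫P : ∫ (WP.weigh (const 1#)) ≈ v
    ∫P = trans (∫-cong {WP.weigh (const 1#)} {evaluation φ} λ i → *-identityʳ (P i)) (∫-evaluation φ)

    ∫Q : ∫ (WQ.weigh (const 1#)) ≈ 1# - v
    ∫Q = trans (∫-cong {WQ.weigh (const 1#)} {evaluation (𝟙 ⊕ (- 1#) · φ)}
                 λ i → solve 1 (λ p → (1ₚ :- p) :* 1ₚ := 1ₚ :+ (:- 1ₚ) :* p) refl (P i))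
           (trans (∫-evaluation (𝟙 ⊕ (- 1#) · φ))
             (solve 1 (λ v → 1ₚ :+ (:- 1ₚ) :* v := 1ₚ :- v) refl v))

    module Yes = Realisation (realise (WP.reweighted 0<v) (WP.reweighted-≈1 0<v (const 1#) ∫P))
    module No  = Realisation (realise (WQ.reweighted 0<1-v) (WQ.reweighted-≈1 0<1-v (const 1#) ∫Q))
    module NY = Semantics Yes.model
    module NN = Semantics No.model

    scaled-Yes : ∀ ψ → v * NY.⟦ ψ ⟧ Yes.tuple ≈ ∫ (WP.weigh (evaluation ψ))
    scaled-Yes ψ = trans (*-congˡ (Yes.tuple-value ψ)) (WP.reweighted-scaled 0<v (evaluation ψ))

    scaled-No : ∀ ψ → (1# - v) * NN.⟦ ψ ⟧ No.tuple ≈ ∫ (WQ.weigh (evaluation ψ))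
    scaled-No ψ = trans (*-congˡ (No.tuple-value ψ)) (WQ.reweighted-scaled 0<1-v (evaluation ψ))

    p≈vq+[1-v]s : ∀ ψ → M.⟦ ψ ⟧ a ≈ v * NY.⟦ ψ ⟧ Yes.tuple + (1# - v) * NN.⟦ ψ ⟧ No.tuple
    p≈vq+[1-v]s ψ = trans (sym (∫-evaluation ψ)) (trans
      (∫-+ {evaluation ψ} (WP.weigh (evaluation ψ)) (WQ.weigh (evaluation ψ)) λ i →
        solve 2 (λ p x → x := p :* x :+ (1ₚ :- p) :* x) refl (P i) (M₀.⟦ ψ ⟧ i))
      (sym (+-cong (scaled-Yes ψ) (scaled-No ψ))))

    convex : IsConvexCombination v (tp {T = T} 𝓜 𝓜⊨T a) Yes.type No.type
    convex ψ {b} {c} (y≤b , b≤y) (n≤c , c≤n) =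
      ≤-reflexive (trans e (sym (*-identityʳ _))) , ≤-reflexive (trans (*-identityʳ _) (sym e))
      where
      e : M.⟦ ψ ⟧ a ≈ v * b + (1# - v) * c
      e = trans (p≈vq+[1-v]s ψ) (+-cong
        (*-congˡ (trans (antisym y≤b b≤y) (*-identityʳ b)))
        (*-congˡ (trans (antisym n≤c c≤n) (*-identityʳ c))))

    -- As `P` is idempotent, weighting `φ` by `P` changes nothing, so `v` times the value in
    -- question is `v`, and `v` cancels.
    φ≈1 : NY.⟦ φ ⟧ Yes.tuple ≈ 1#
    φ≈1 = trans (solve 1 (λ x → x := x :+ :- 1ₚ :+ 1ₚ) refl x)
      (trans (+-congʳ (*-zero-cancel 0<v (trans (solve 2 (λ v x → v :* (x :+ :- 1ₚ) := v :* x :- v) refl v x)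
        (trans (+-congʳ (trans (scaled-Yes φ)
          (trans (∫-cong {WP.weigh (evaluation φ)} {evaluation φ} PP≈P) (∫-evaluation φ)))) (-‿inverseʳ v)))))
      (+-identityˡ 1#))
      where x = NY.⟦ φ ⟧ Yes.tuple

    -- The condition that `φ` is at least 1 belongs to `Yes.type`. Extremeness would place it in the
    -- type of `a`, where `φ` has the smaller value `v`.
    not-extreme : ¬ Extreme {T = T} (tp 𝓜 𝓜⊨T a)
    not-extreme extreme = v≉1 (antisym v≤1 (≤-trans (≤-reflexive (sym (*-identityˡ 1#)))
      (proj₁ (proj₁ (extreme Yes.type No.type v 0<v v<1 convex)) {1# · 𝟙 ≼ φ}
        (≤-reflexive (trans (*-identityˡ 1#) (sym φ≈1))))))

  extreme⇒binary : ∀ {n} (φ : Formula L n) → IsBinary φ → (a : Vec M.M n) →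
                   Extreme {T = T} (tp 𝓜 𝓜⊨T a) → (M.⟦ φ ⟧ a ≈ 0#) ⊎ (M.⟦ φ ⟧ a ≈ 1#)
  extreme⇒binary φ binary a extreme with em {P = M.⟦ φ ⟧ a ≈ 0#} | em {P = M.⟦ φ ⟧ a ≈ 1#}
  ... | yes v≈0 | _       = inj₁ v≈0
  ... | no _    | yes v≈1 = inj₂ v≈1
  ... | no v≉0  | no v≉1  = contradiction extreme (Splitting.not-extreme φ binary a v≉0 v≉1)

module VariableTerms {R : CompleteOrderedField} {L : Language R} where

  variables : ∀ {n} → Vec (Term L n) n
  variables = Vec.tabulate var

  ⟦variables⟧ : (𝓜 : Structure L) → ∀ {n} (ρ : Vec (Structure.M 𝓜) n) → Structure.⟦_⟧ₜₛ 𝓜 variables ρ ≡ ρ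
  ⟦variables⟧ 𝓜 ρ = ≡.trans (go id) (Vec.tabulate∘lookup ρ)
    where
    open Structure 𝓜
    go : ∀ {k} (f : Fin k → Fin _) → ⟦ Vec.tabulate (λ i → var (f i)) ⟧ₜₛ ρ ≡ Vec.tabulate (λ i → lookup ρ (f i))
    go {zero}  f = ≡.refl
    go {suc k} f = ≡.cong (lookup ρ (f zero) ∷_) (go (λ i → f (suc i)))

module ExtremalModels (em : ∀ {ℓ} → ExcludedMiddle ℓ) (ext : ∀ {a b} → Extensionality a b)
  {R : CompleteOrderedField} {L : Language R} {T : Theory L} (T-complete : Complete T)
  {𝓜₀ : Structure L} (fo : IsFirstOrder L 𝓜₀) (𝓜₀⊨T : 𝓜₀ ⊨ T) {𝓜 : Structure L} (𝓜⊨T : 𝓜 ⊨ T) where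

  open ExtremeTypes em ext T-complete {𝓜₀} 𝓜₀⊨T {𝓜} 𝓜⊨T
  open CompleteOrderedField R using (_≈_; 0#; 1#)
  open VariableTerms {R} {L}
  open IsFirstOrder

  extremal⇒firstOrder : Extremal T 𝓜 𝓜⊨T → IsFirstOrder L 𝓜
  extremal⇒firstOrder extremal .d-discrete x y = extreme⇒binary (dist (var zero) (var (suc zero)))
    (λ ρ → fo .d-discrete _ _) (x ∷ y ∷ []) (extremal _)
  extremal⇒firstOrder extremal .rel-binary P xs = ≡.subst
    (λ ys → (Structure.⟦_⟧ʳ 𝓜 P ys ≈ 0#) ⊎ (Structure.⟦_⟧ʳ 𝓜 P ys ≈ 1#)) (⟦variables⟧ 𝓜 xs)
    (extreme⇒binary (rel P variables) (λ ρ → fo .rel-binary P _) xs (extremal xs))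

-- Finite ranges and controls in first order structures

module FiniteRange (em : ∀ {ℓ} → ExcludedMiddle ℓ) {R : CompleteOrderedField} {L : Language R} where
  open OrderedField em R

  infix 4 _∈≈_
  _∈≈_ : Carrier → List Carrier → Set
  x ∈≈ vs = Any (x ≈_) vs

  -- Computed from the formula alone, so one list serves all first order structures and all tuples.
  -- This uniformity makes the lists of controls and the translation finite.
  values : ∀ {n} → Formula L n → List Carrier
  values 𝟙          = 1# ∷ []
  values (rel P ts) = 0# ∷ 1# ∷ []
  values (dist s t) = 0# ∷ 1# ∷ []
  values (r · φ)    = List.map (r *_) (values φ)
  values (φ ⊕ ψ)    = cartesianProductWith _+_ (values φ) (values ψ)
  values (inf φ)    = values φ
  values (sup φ)    = values φ

  -- The list may contain numbers that `f` never takes; excluded middle recognises them and they are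
  -- skipped.
  minimum-attained : {A : Set} (f : A → Carrier) (vs : List Carrier) → A →
                     ∃[ a ] ∀ b → f b ∈≈ vs → f a ≤ f b
  minimum-attained f []       a = a , λ _ ()
  minimum-attained f (v ∷ vs) a with minimum-attained f vs a | em {P = ∃[ c ] f c ≈ v}
  ... | m , m≤ | no ∄c = m , λ { b (here fb≈v) → contradiction (b , fb≈v) ∄c ; b (there p) → m≤ b p }
  ... | m , m≤ | yes (c , fc≈v) with total (f c) (f m)
  ...   | inj₁ fc≤fm = c , λ { b (here fb≈v) → ≤-reflexive (trans fc≈v (sym fb≈v))
                             ; b (there p) → ≤-trans fc≤fm (m≤ b p) }
  ...   | inj₂ fm≤fc = m , λ { b (here fb≈v) → ≤-trans fm≤fc (≤-reflexive (trans fc≈v (sym fb≈v)))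
                             ; b (there p) → m≤ b p }

  module _ (𝓜 : Structure L) (fo : IsFirstOrder L 𝓜) where
    open Structure 𝓜
    open Semantics 𝓜
    open StructureProperties em 𝓜
    open IsFirstOrder fo

    private
      attained : ∀ {n} (φ : Formula L (suc n)) ρ {vs} → (∀ m → ⟦ φ ⟧ (m ∷ ρ) ∈≈ vs) →
                 ∃[ m ] ⟦ inf φ ⟧ ρ ≈ ⟦ φ ⟧ (m ∷ ρ)
      attained φ ρ {vs} h with minimum-attained (λ m → ⟦ φ ⟧ (m ∷ ρ)) vs point
      ... | m , m≤ = m , antisym (inf≤ φ ρ m) (≤inf φ ρ λ b → m≤ b (h b))

      binary : ∀ {x} → (x ≈ 0#) ⊎ (x ≈ 1#) → x ∈≈ 0# ∷ 1# ∷ []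
      binary (inj₁ e) = here e
      binary (inj₂ e) = there (here e)

      scale : ∀ r {x vs} → x ∈≈ vs → r * x ∈≈ List.map (r *_) vs
      scale r p = Any.map⁺ (Any.map *-congˡ p)

    ∈values : ∀ {n} (φ : Formula L n) ρ → ⟦ φ ⟧ ρ ∈≈ values φ
    ∈values 𝟙          ρ = here refl
    ∈values (rel P ts) ρ = binary (rel-binary P _)
    ∈values (dist s t) ρ = binary (d-discrete _ _)
    ∈values (r · φ)    ρ = scale r (∈values φ ρ)
    ∈values (φ ⊕ ψ)    ρ = Any.cartesianProductWith⁺ _+_ +-cong (∈values φ ρ) (∈values ψ ρ)
    ∈values (inf φ)    ρ with attained φ ρ (λ m → ∈values φ (m ∷ ρ))
    ... | m , e = Any.map (trans e) (∈values φ (m ∷ ρ))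
    ∈values (sup φ)    ρ with attained ((- 1#) · φ) ρ (λ m → scale (- 1#) (∈values φ (m ∷ ρ)))
    ... | m , e = Any.map (trans (trans (⟦sup⟧≈ φ ρ) (trans (*-congˡ e)
          (solve 1 (λ x → (:- 1ₚ) :* ((:- 1ₚ) :* x) := x) refl _)))) (∈values φ (m ∷ ρ))

    inf-attained : ∀ {n} (φ : Formula L (suc n)) ρ → ∃[ m ] ⟦ inf φ ⟧ ρ ≈ ⟦ φ ⟧ (m ∷ ρ)
    inf-attained φ ρ = attained φ ρ λ m → ∈values φ (m ∷ ρ)

-- The bounds given by a control hold in every structure, first order or not, so
-- that its vanishing passes to both parts of a convex combination.
module Control (em : ∀ {ℓ} → ExcludedMiddle ℓ) {R : CompleteOrderedField} {L : Language R} where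
  open OrderedField em R
  open FiniteRange em {R} {L}

  ∣_∣ : Carrier → Carrier
  ∣ r ∣ with total 0# r
  ... | inj₁ _ = r
  ... | inj₂ _ = - r

  -- If inf φ ≤ w + inf χ holds everywhere, with equality at a, then so does
  -- 0 ≤ inf χ + w - inf φ; adding another inf χ bounds inf φ on both sides.
  inf-control : ∀ {n} → Formula L (suc n) → Formula L (suc n) → Carrier → Formula L n
  inf-control φ χ w = (inf χ ⊕ inf χ) ⊕ (w · 𝟙 ⊕ (- 1#) · inf φ)

  scale-controls : ∀ {n} → Carrier → List (Formula L n) → List (Formula L n)
  scale-controls r = List.map (∣ r ∣ ·_)

  inf-controls : ∀ {n} → Formula L (suc n) → List (Formula L (suc n)) → List (Formula L n)
  inf-controls φ χs = cartesianProductWith (inf-control φ) χs (values φ)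

  controls : ∀ {n} → Formula L n → List (Formula L n)
  controls 𝟙          = 0# · 𝟙 ∷ []
  controls (rel P ts) = rel P ts ∷ 𝟙 ⊕ (- 1#) · rel P ts ∷ []
  controls (dist s t) = dist s t ∷ 𝟙 ⊕ (- 1#) · dist s t ∷ []
  controls (r · φ)    = scale-controls r (controls φ)
  controls (φ ⊕ ψ)    = cartesianProductWith _⊕_ (controls φ) (controls ψ)
  controls (inf φ)    = inf-controls φ (controls φ)
  controls (sup φ)    =
    scale-controls (- 1#) (inf-controls ((- 1#) · φ) (scale-controls (- 1#) (controls φ)))

  module _ (𝓜 : Structure L) (fo : IsFirstOrder L 𝓜) where
    open Structure 𝓜
    open Semantics 𝓜
    open StructureProperties em 𝓜
    open IsFirstOrder fo

    record Controls {n} (a : Vec M n) (φ χ : Formula L n) : Set₁ where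
      field
        vanishes : ⟦ χ ⟧ a ≈ 0#
        bound-above : ∀ 𝓝 b → Semantics.⟦_⟧ 𝓝 φ b ≤ ⟦ φ ⟧ a + Semantics.⟦_⟧ 𝓝 χ b
        bound-below : ∀ 𝓝 b → ⟦ φ ⟧ a ≤ Semantics.⟦_⟧ 𝓝 φ b + Semantics.⟦_⟧ 𝓝 χ b

      -- The sum of the two bounds shows that twice the control is nonnegative; if the control were
      -- nonpositive, its double would be at most itself.
      nonneg : ∀ 𝓝 b → 0# ≤ Semantics.⟦_⟧ 𝓝 χ b
      nonneg 𝓝 b with total 0# (Semantics.⟦_⟧ 𝓝 χ b)
      ... | inj₁ 0≤c = 0≤c
      ... | inj₂ c≤0 = ≤-trans
        (≤-by-difference (+-mono-≤ (bound-above 𝓝 b) (bound-below 𝓝 b))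
          (solve 3 (λ x y c → (c :+ c) :- 0ₚ := ((y :+ c) :+ (x :+ c)) :- (x :+ y)) refl
            (Semantics.⟦_⟧ 𝓝 φ b) (⟦ φ ⟧ a) (Semantics.⟦_⟧ 𝓝 χ b)))
        (≤-resp refl (+-identityʳ _) (+-mono-≤ ≤-refl c≤0))

      determines : ∀ 𝓝 b → Semantics.⟦_⟧ 𝓝 χ b ≈ 0# → ⟦ φ ⟧ a ≈ Semantics.⟦_⟧ 𝓝 φ b
      determines 𝓝 b e = antisym
        (≤-resp refl (trans (+-congˡ e) (+-identityʳ _)) (bound-below 𝓝 b))
        (≤-resp refl (trans (+-congˡ e) (+-identityʳ _)) (bound-above 𝓝 b))

    open Controls

    private
      Binary : ∀ {n} → Formula L n → Set₁
      Binary φ = ∀ 𝓝 b → (0# ≤ Semantics.⟦_⟧ 𝓝 φ b) × (Semantics.⟦_⟧ 𝓝 φ b ≤ 1#)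

    controls-binary : ∀ {n a} {φ : Formula L n} → Binary φ → (⟦ φ ⟧ a ≈ 0#) ⊎ (⟦ φ ⟧ a ≈ 1#) →
                      Any (Controls a φ) (φ ∷ 𝟙 ⊕ (- 1#) · φ ∷ [])
    controls-binary {φ = φ} 0≤φ≤1 (inj₁ e) = here record
      { vanishes = e
      ; bound-above = λ 𝓝 b → ≤-reflexive (sym (trans (+-congʳ e) (+-identityˡ _)))
      ; bound-below = λ 𝓝 b → ≤-trans (≤-reflexive e) (+-nonneg (proj₁ (0≤φ≤1 𝓝 b)) (proj₁ (0≤φ≤1 𝓝 b)))
      }
    controls-binary {φ = φ} 0≤φ≤1 (inj₂ e) = there (here record
      { vanishes = trans (+-congˡ (*-congˡ e)) (solve 0 (1ₚ :+ (:- 1ₚ) :* 1ₚ := 0ₚ) refl)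
      ; bound-above = λ 𝓝 b → ≤-trans (proj₂ (0≤φ≤1 𝓝 b)) (≤-trans (≤-reflexive (sym e))
          (0≤⇒≤+ (≤-by-difference (proj₂ (0≤φ≤1 𝓝 b))
            (solve 1 (λ x → (1ₚ :+ (:- 1ₚ) :* x) :- 0ₚ := 1ₚ :- x) refl (Semantics.⟦_⟧ 𝓝 φ b)))))
      ; bound-below = λ 𝓝 b → ≤-reflexive (trans e
          (solve 1 (λ x → 1ₚ := x :+ (1ₚ :+ (:- 1ₚ) :* x)) refl (Semantics.⟦_⟧ 𝓝 φ b)))
      })

    controls-scale : ∀ {n a} r {φ χ : Formula L n} → Controls a φ χ → Controls a (r · φ) (∣ r ∣ · χ)
    controls-scale {a = a} r {φ} {χ} c with total 0# r
    ... | inj₁ 0≤r = record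
      { vanishes = trans (*-congˡ (c .vanishes)) (zeroʳ _)
      ; bound-above = λ 𝓝 b → ≤-resp refl (distribˡ _ _ _) (*-monoˡ-≤ 0≤r (c .bound-above 𝓝 b))
      ; bound-below = λ 𝓝 b → ≤-resp refl (distribˡ _ _ _) (*-monoˡ-≤ 0≤r (c .bound-below 𝓝 b))
      }
    ... | inj₂ r≤0 = record
      { vanishes = trans (*-congˡ (c .vanishes)) (zeroʳ _)
      ; bound-above = λ 𝓝 b → flip (*-antitoneˡ-≤ r≤0 (c .bound-below 𝓝 b))
      ; bound-below = λ 𝓝 b → flip (*-antitoneˡ-≤ r≤0 (c .bound-above 𝓝 b))
      }
      where
      flip : ∀ {x y z} → r * (y + z) ≤ r * x → r * y ≤ r * x + (- r) * z
      flip {x} {y} {z} p = ≤-by-difference p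
        (solve 4 (λ r x y z → (r :* x :+ (:- r) :* z) :- r :* y := r :* x :- r :* (y :+ z)) refl r x y z)

    controls-⊕ : ∀ {n a} {φ ψ χ ξ : Formula L n} → Controls a φ χ → Controls a ψ ξ → Controls a (φ ⊕ ψ) (χ ⊕ ξ)
    controls-⊕ c e = record
      { vanishes = trans (+-cong (c .vanishes) (e .vanishes)) (+-identityˡ 0#)
      ; bound-above = λ 𝓝 b → ≤-resp refl (interchange _ _ _ _) (+-mono-≤ (c .bound-above 𝓝 b) (e .bound-above 𝓝 b))
      ; bound-below = λ 𝓝 b → ≤-resp refl (interchange _ _ _ _) (+-mono-≤ (c .bound-below 𝓝 b) (e .bound-below 𝓝 b))
      }
      where
      interchange : ∀ w x y z → (w + x) + (y + z) ≈ (w + y) + (x + z)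
      interchange = solve 4 (λ w x y z → (w :+ x) :+ (y :+ z) := (w :+ y) :+ (x :+ z)) refl

    -- The control `χ` is taken at a point `m` where the infimum of `φ` is attained. As `χ` vanishes
    -- there and is nonnegative everywhere, `inf χ` vanishes at `a`.
    controls-inf : ∀ {n} {a : Vec M n} {m} {φ χ : Formula L (suc n)} {w} → ⟦ inf φ ⟧ a ≈ ⟦ φ ⟧ (m ∷ a) →
                   Controls (m ∷ a) φ χ → ⟦ φ ⟧ (m ∷ a) ≈ w → Controls a (inf φ) (inf-control φ χ w)
    controls-inf {a = a} {m} {φ} {χ} {w} attained c φ≈w = record
      { vanishes = trans
          (+-cong (+-cong infχ≈0 infχ≈0) (+-congˡ (*-congˡ v≈w)))
          (solve 1 (λ w → (0ₚ :+ 0ₚ) :+ (w :* 1ₚ :+ (:- 1ₚ) :* w) := 0ₚ) refl w)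
      ; bound-above = λ 𝓝 b → ≤-by-difference (+-mono-≤ (slack 𝓝 b) (slack 𝓝 b))
          (trans (+-congʳ (+-congʳ v≈w)) (trans
            (solve 3 (λ w k x → (w :+ ((k :+ k) :+ (w :* 1ₚ :+ (:- 1ₚ) :* x))) :- x
                                := ((w :+ k) :+ (w :+ k)) :- (x :+ x)) refl
              w (Semantics.⟦_⟧ 𝓝 (inf χ) b) (Semantics.⟦_⟧ 𝓝 (inf φ) b))
            (sym (+-congʳ (+-cong (+-congʳ v≈w) (+-congʳ v≈w))))))
      ; bound-below = λ 𝓝 b → ≤-by-difference (+-nonneg (infχ≥0 𝓝 b) (infχ≥0 𝓝 b))
          (trans (+-congˡ (-‿cong v≈w))
            (solve 3 (λ w k x → (x :+ ((k :+ k) :+ (w :* 1ₚ :+ (:- 1ₚ) :* x))) :- w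
                                := (k :+ k) :- 0ₚ) refl
              w (Semantics.⟦_⟧ 𝓝 (inf χ) b) (Semantics.⟦_⟧ 𝓝 (inf φ) b)))
      }
      where
      v≈w : ⟦ inf φ ⟧ a ≈ w
      v≈w = trans attained φ≈w
      infχ≥0 : ∀ 𝓝 b → 0# ≤ Semantics.⟦_⟧ 𝓝 (inf χ) b
      infχ≥0 𝓝 b = StructureProperties.≤inf em 𝓝 χ b λ y → nonneg c 𝓝 (y ∷ b)
      infχ≈0 : ⟦ inf χ ⟧ a ≈ 0#
      infχ≈0 = antisym (≤-trans (inf≤ χ a m) (≤-reflexive (c .vanishes))) (infχ≥0 𝓜 a)
      slack : ∀ 𝓝 b → Semantics.⟦_⟧ 𝓝 (inf φ) b ≤ ⟦ inf φ ⟧ a + Semantics.⟦_⟧ 𝓝 (inf χ) b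
      slack 𝓝 b = ≤-resp refl (+-comm _ _) (≤-unsub (StructureProperties.≤inf em 𝓝 χ b λ y →
        ≤-sub (≤-resp refl (+-comm _ _) (≤-trans (StructureProperties.inf≤ em 𝓝 φ b y)
          (≤-resp refl (+-congʳ (sym attained)) (c .bound-above 𝓝 (y ∷ b)))))))

    controls-respects : ∀ {n a} {φ ψ χ : Formula L n} →
      (∀ 𝓝 b → Semantics.⟦_⟧ 𝓝 φ b ≈ Semantics.⟦_⟧ 𝓝 ψ b) → Controls a φ χ → Controls a ψ χ
    controls-respects {a = a} e c = record
      { vanishes = c .vanishes
      ; bound-above = λ 𝓝 b → ≤-resp (e 𝓝 b) (+-congʳ (e 𝓜 a)) (c .bound-above 𝓝 b)
      ; bound-below = λ 𝓝 b → ≤-resp (e 𝓜 a) (+-congʳ (e 𝓝 b)) (c .bound-below 𝓝 b)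
      }

    private
      any-inf : ∀ {n a} (φ : Formula L (suc n)) {χs} → (∀ m → Any (Controls (m ∷ a) φ) χs) →
                Any (Controls a (inf φ)) (inf-controls φ χs)
      any-inf {a = a} φ h with inf-attained 𝓜 fo φ a
      ... | m , attained = Any.cartesianProductWith⁺ (inf-control φ) (controls-inf attained) (h m)
                             (∈values 𝓜 fo φ (m ∷ a))

      any-scale : ∀ {n a} r {φ : Formula L n} {χs} → Any (Controls a φ) χs →
                  Any (Controls a (r · φ)) (scale-controls r χs)
      any-scale r h = Any.map⁺ (Any.map (controls-scale r) h)

    controls-exist : ∀ {n} (φ : Formula L n) a → Any (Controls a φ) (controls φ)
    controls-exist 𝟙          a = here record
      { vanishes = zeroˡ _
      ; bound-above = λ 𝓝 b → 0≤⇒≤+ (≤-reflexive (sym (zeroˡ _)))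
      ; bound-below = λ 𝓝 b → 0≤⇒≤+ (≤-reflexive (sym (zeroˡ _)))
      }
    controls-exist (rel P ts) a = controls-binary
      (λ 𝓝 b → Structure.0≤rel 𝓝 P _ , Structure.rel≤1 𝓝 P _) (rel-binary P _)
    controls-exist (dist s t) a = controls-binary
      (λ 𝓝 b → Structure.Metric.nonNegative 𝓝 , Structure.d≤1 𝓝 _ _) (d-discrete _ _)
    controls-exist (r · φ)    a = any-scale r (controls-exist φ a)
    controls-exist (φ ⊕ ψ)    a = Any.cartesianProductWith⁺ _⊕_ controls-⊕ (controls-exist φ a) (controls-exist ψ a)
    controls-exist (inf φ)    a = any-inf φ λ m → controls-exist φ (m ∷ a)
    controls-exist (sup φ)    a = Any.map
      (controls-respects λ 𝓝 b → sym (StructureProperties.⟦sup⟧≈ em 𝓝 φ b))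
      (any-scale (- 1#) (any-inf ((- 1#) · φ) λ m → any-scale (- 1#) (controls-exist φ (m ∷ a))))

-- First order models are extremal

module FirstOrderExtreme (em : ∀ {ℓ} → ExcludedMiddle ℓ) {R : CompleteOrderedField} {L : Language R}
                         (T : Theory L) where
  open OrderedField em R
  open Control em {R} {L}
  open Semantics

  -- Maximality: all conditions true at the realising tuple form a satisfiable set that contains
  -- those of `q`, hence they belong to `q`.
  realised : ∀ {n} (q : Type T n) → let (𝓝 , _ , b , _) = satisfiable q in
             ∀ {c} → 𝓝 , b ⊨ᶜ c → conditions q c
  realised q {c} = maximal q {λ c → proj₁ (satisfiable q) , proj₁ (proj₂ (proj₂ (satisfiable q))) ⊨ᶜ c}
    (proj₁ (satisfiable q) , proj₁ (proj₂ (satisfiable q)) , proj₁ (proj₂ (proj₂ (satisfiable q))) , λ c → c)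
    (proj₂ (proj₂ (proj₂ (satisfiable q)))) {c}

  type-value : ∀ {n} → Type T n → Formula L n → Carrier
  type-value q φ = let (𝓝 , _ , b , _) = satisfiable q in ⟦_⟧ 𝓝 φ b

  type-has-value : ∀ {n} (q : Type T n) φ → q ⟨ φ ⟩== type-value q φ
  type-has-value q φ = realised q {φ ≼ type-value q φ · 𝟙} (≤-reflexive (sym (*-identityʳ _))) ,
                       realised q {type-value q φ · 𝟙 ≼ φ} (≤-reflexive (*-identityʳ _))

  firstOrder⇒extremal : ∀ 𝓜 (𝓜⊨T : 𝓜 ⊨ T) → IsFirstOrder L 𝓜 → Extremal T 𝓜 𝓜⊨T
  firstOrder⇒extremal 𝓜 𝓜⊨T fo {n} a q s t 0<t (t≤1 , t≉1) convex =
    same q (λ χ χ≥0 χ≈0 → proj₁ (both-vanish χ χ≥0 χ≈0)) ,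
    same s (λ χ χ≥0 χ≈0 → proj₂ (both-vanish χ χ≥0 χ≈0))
    where
    v : Formula L n → Carrier
    v φ = ⟦_⟧ 𝓜 φ a

    combination : ∀ φ → v φ ≈ t * type-value q φ + (1# - t) * type-value s φ
    combination φ with convex φ (type-has-value q φ) (type-has-value s φ)
    ... | ≤r , r≤ = trans (antisym ≤r r≤) (*-identityʳ _)

    0<1-t : 0# < 1# - t
    0<1-t = x≤y⇒0≤y-x t≤1 , λ e → t≉1 (trans (sym (+-identityˡ t)) (trans (+-congʳ e) (y-x+x≈y t 1#)))

    both-vanish : ∀ χ → (∀ 𝓝 b → 0# ≤ ⟦_⟧ 𝓝 χ b) → v χ ≈ 0# →
                  (type-value q χ ≈ 0#) × (type-value s χ ≈ 0#)
    both-vanish χ χ≥0 χ≈0 with +-cancel-nonneg (*-nonneg (proj₁ 0<t) (χ≥0 _ _)) (*-nonneg (proj₁ 0<1-t) (χ≥0 _ _))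
                                 (≤-reflexive (trans (sym (combination χ)) χ≈0))
    ... | p , p′ = *-zero-cancel 0<t p , *-zero-cancel 0<1-t p′

    same : ∀ q → (∀ χ → (∀ 𝓝 b → 0# ≤ ⟦_⟧ 𝓝 χ b) → v χ ≈ 0# → type-value q χ ≈ 0#) →
           q ≈ᵗ tp {T = T} 𝓜 𝓜⊨T a
    same q vanish =
      (λ { {φ ≼ ψ} c∈q → ≤-resp (sym (value φ)) (sym (value ψ)) (proj₂ (proj₂ (proj₂ (satisfiable q))) {φ ≼ ψ} c∈q) }) ,
      (λ { {φ ≼ ψ} φ≤ψ → realised q {φ ≼ ψ} (≤-resp (value φ) (value ψ) φ≤ψ) })
      where
      value : ∀ φ → v φ ≈ type-value q φ
      value φ with Any.satisfied (controls-exist 𝓜 fo φ a)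
      ... | χ , c = Controls.determines c _ _ (vanish χ (Controls.nonneg c) (Controls.vanishes c))

-- First order satisfaction: isomorphism invariance and back and forth

module AsFirstOrder {R : CompleteOrderedField} {L : Language R} (𝓜 : Structure L) (fo : IsFirstOrder L 𝓜) where
  private
    module A = FOStructure (asFO 𝓜 fo)
  open Structure 𝓜

  term≡ : ∀ {n} (t : Term L n) ρ → A.⟦ t ⟧ₜ ρ ≡ ⟦ t ⟧ₜ ρ
  terms≡ : ∀ {n k} (ts : Vec (Term L n) k) ρ → A.⟦ ts ⟧ₜₛ ρ ≡ ⟦ ts ⟧ₜₛ ρ
  term≡ (var i)    ρ = ≡.refl
  term≡ (con c)    ρ = ≡.refl
  term≡ (fun F ts) ρ = ≡.cong ⟦ F ⟧ᶠ (terms≡ ts ρ)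
  terms≡ []       ρ = ≡.refl
  terms≡ (t ∷ ts) ρ = ≡.cong₂ _∷_ (term≡ t ρ) (terms≡ ts ρ)

module Isomorphism {R : CompleteOrderedField} {L : Language R} {𝓐 𝓑 : FOStructure L} (iso : 𝓐 ≅ 𝓑) where
  open Language L
  open _≅_ iso
  private
    module A = FOStructure 𝓐
    module B = FOStructure 𝓑
    module ≈A = IsEquivalence A.isEquivalence
    module ≈B = IsEquivalence B.isEquivalence

  infix 4 _∼_
  _∼_ : A.A → B.A → Set
  a ∼ b = to a B.≈ₐ b

  image : ∀ {n} {xs : Vec A.A n} {ys : Vec B.A n} → Pointwise _∼_ xs ys → Pointwise B._≈ₐ_ (Vec.map to xs) ys
  image []       = []
  image (p ∷ ps) = p ∷ image ps

  preimage : ∀ b → ∃[ a ] a ∼ b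
  preimage b = proj₁ (surjective b) , proj₂ (surjective b) ≈A.refl

  term-∼ : ∀ {n} (t : Term L n) {ρ σ} → Pointwise _∼_ ρ σ → A.⟦ t ⟧ₜ ρ ∼ B.⟦ t ⟧ₜ σ
  terms-∼ : ∀ {n k} (ts : Vec (Term L n) k) {ρ σ} → Pointwise _∼_ ρ σ → Pointwise _∼_ (A.⟦ ts ⟧ₜₛ ρ) (B.⟦ ts ⟧ₜₛ σ)
  term-∼ (var i)    p = Pointwise.lookup p i
  term-∼ (con c)    p = const-homo c
  term-∼ (fun F ts) p = ≈B.trans (fun-homo F _) (B.fun-cong F (image (terms-∼ ts p)))
  terms-∼ []       p = []
  terms-∼ (t ∷ ts) p = term-∼ t p ∷ terms-∼ ts p

  -- Proved together with its converse, because the premise of an implication travels backwards.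
  preserved : ∀ {n} (σ : FOFormula L n) {ρ ρ′} → Pointwise _∼_ ρ ρ′ → A.Sat σ ρ → B.Sat σ ρ′
  reflected : ∀ {n} (σ : FOFormula L n) {ρ ρ′} → Pointwise _∼_ ρ ρ′ → B.Sat σ ρ′ → A.Sat σ ρ
  preserved (s ≐′ t)   p e = ≈B.trans (≈B.sym (term-∼ s p)) (≈B.trans (congruent e) (term-∼ t p))
  preserved (rel P ts) p e = B.rel-resp P (image (terms-∼ ts p)) (Equivalence.to (rel-homo P _) e)
  preserved ⊥′         p ()
  preserved (φ ∧′ ψ)   p (x , y) = preserved φ p x , preserved ψ p y
  preserved (φ ∨′ ψ)   p (inj₁ x) = inj₁ (preserved φ p x)
  preserved (φ ∨′ ψ)   p (inj₂ y) = inj₂ (preserved ψ p y)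
  preserved (φ ⇒′ ψ)   p h x = preserved ψ p (h (reflected φ p x))
  preserved (∀′ φ)     p h b = preserved φ (proj₂ (preimage b) ∷ p) (h (proj₁ (preimage b)))
  preserved (∃′ φ)     p (a , x) = to a , preserved φ (≈B.refl ∷ p) x
  reflected (s ≐′ t)   p e = injective (≈B.trans (term-∼ s p) (≈B.trans e (≈B.sym (term-∼ t p))))
  reflected (rel P ts) p e = Equivalence.from (rel-homo P _)
    (B.rel-resp P (Pointwise.sym ≈B.sym (image (terms-∼ ts p))) e)
  reflected ⊥′         p ()
  reflected (φ ∧′ ψ)   p (x , y) = reflected φ p x , reflected ψ p y
  reflected (φ ∨′ ψ)   p (inj₁ x) = inj₁ (reflected φ p x)
  reflected (φ ∨′ ψ)   p (inj₂ y) = inj₂ (reflected ψ p y)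
  reflected (φ ⇒′ ψ)   p h x = reflected ψ p (h (preserved φ p x))
  reflected (∀′ φ)     p h a = reflected φ (≈B.refl ∷ p) (h (to a))
  reflected (∃′ φ)     p (b , x) = proj₁ (preimage b) , reflected φ (proj₂ (preimage b) ∷ p) x

-- Back and forth: agreement on finitely many affine formulas is carried one
-- quantifier further by agreement on the infima of their controls.
module ElementaryEquivalence (em : ∀ {ℓ} → ExcludedMiddle ℓ) {R : CompleteOrderedField} {L : Language R} where
  open OrderedField em R
  open FiniteRange em {R} {L}
  open Control em {R} {L}
  open Semantics

  -- A sum of nonnegative controls vanishes only if each of them does, so a single formula tests
  -- agreement on the whole list. The empty list gets the zero formula, so that a joint control
  -- always exists.
  joint-controls : ∀ {n} → List (Formula L n) → List (Formula L n)
  joint-controls []      = 0# · 𝟙 ∷ []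
  joint-controls (φ ∷ Γ) = cartesianProductWith _⊕_ (controls φ) (joint-controls Γ)

  record JointControl (𝓜 : Structure L) {n} (a : Vec (Structure.M 𝓜) n) (Γ : List (Formula L n))
                      (χ : Formula L n) : Set₁ where
    field
      vanishes   : ⟦_⟧ 𝓜 χ a ≈ 0#
      nonneg     : ∀ 𝓝 b → 0# ≤ ⟦_⟧ 𝓝 χ b
      determines : ∀ 𝓝 b → ⟦_⟧ 𝓝 χ b ≈ 0# → All (λ φ → ⟦_⟧ 𝓜 φ a ≈ ⟦_⟧ 𝓝 φ b) Γ

  joint-control-exists : ∀ 𝓜 → IsFirstOrder L 𝓜 → ∀ {n} (Γ : List (Formula L n)) a →
                         Any (JointControl 𝓜 a Γ) (joint-controls Γ)
  joint-control-exists 𝓜 fo []      a = here record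
    { vanishes = zeroˡ _ ; nonneg = λ 𝓝 b → ≤-reflexive (sym (zeroˡ _)) ; determines = λ 𝓝 b e → [] }
  joint-control-exists 𝓜 fo (φ ∷ Γ) a = Any.cartesianProductWith⁺ _⊕_
    (λ c j → record
      { vanishes   = trans (+-cong (Controls.vanishes c) (JointControl.vanishes j)) (+-identityˡ 0#)
      ; nonneg     = λ 𝓝 b → +-nonneg (Controls.nonneg c 𝓝 b) (JointControl.nonneg j 𝓝 b)
      ; determines = λ 𝓝 b e →
          let (e₁ , e₂) = +-cancel-nonneg (Controls.nonneg c 𝓝 b) (JointControl.nonneg j 𝓝 b) (≤-reflexive e)
          in Controls.determines c 𝓝 b e₁ ∷ JointControl.determines j 𝓝 b e₂
      })
    (controls-exist 𝓜 fo φ a) (joint-control-exists 𝓜 fo Γ a)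

  record FOPoint (n : ℕ) : Set₁ where
    field
      model : Structure L
      fo    : IsFirstOrder L model
      tuple : Vec (Structure.M model) n

    value : Formula L n → Carrier
    value φ = ⟦_⟧ model φ tuple

    Satisfies : FOFormula L n → Set
    Satisfies σ = FOStructure.Sat (asFO model fo) σ tuple

  open FOPoint

  _▸_ : ∀ {n} (p : FOPoint n) → Structure.M (model p) → FOPoint (suc n)
  p ▸ x = record { model = model p ; fo = fo p ; tuple = x ∷ tuple p }

  record Agree {n} (p q : FOPoint n) (Γ : List (Formula L n)) : Set where
    constructor agreeing
    field
      on : All (λ φ → value p φ ≈ value q φ) Γ

  agree-sym : ∀ {n} (p q : FOPoint n) {Γ} → Agree p q Γ → Agree q p Γ
  agree-sym p q (agreeing es) = agreeing (All.map sym es)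

  agree-++ : ∀ {n} {p q : FOPoint n} Γ {Γ′} → Agree p q (Γ ++ Γ′) → Agree p q Γ × Agree p q Γ′
  agree-++ Γ (agreeing es) = agreeing (All.++⁻ˡ Γ es) , agreeing (All.++⁻ʳ Γ es)

  quantify : ∀ {n} → List (Formula L (suc n)) → List (Formula L n)
  quantify Γ = List.map inf (joint-controls Γ)

  -- A joint control `χ` at `x` gives `inf χ` the value 0 at `p`, hence also at `q`. There the
  -- infimum is attained at some `y`, and the vanishing of `χ` at `y` is agreement on `Γ`.
  extend : ∀ {n} (Γ : List (Formula L (suc n))) p q → Agree p q (quantify Γ) →
           ∀ x → ∃[ y ] Agree (p ▸ x) (q ▸ y) Γ
  extend Γ p q (agreeing agree) x =
    pick (All.lookupAny (All.map⁻ agree) (joint-control-exists (model p) (fo p) Γ (x ∷ tuple p)))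
    where
    pick : ∀ {χ} → (value p (inf χ) ≈ value q (inf χ)) × JointControl (model p) (x ∷ tuple p) Γ χ →
           ∃[ y ] Agree (p ▸ x) (q ▸ y) Γ
    pick {χ} (e , j) = let (y , attained) = inf-attained (model q) (fo q) χ (tuple q) in y , agreeing (JointControl.determines j (model q) (y ∷ tuple q)
      (trans (sym attained) (trans (sym e) (antisym
        (≤-trans (StructureProperties.inf≤ em (model p) χ (tuple p) x) (≤-reflexive (JointControl.vanishes j)))
        (StructureProperties.≤inf em (model p) χ (tuple p) λ z → JointControl.nonneg j (model p) (z ∷ tuple p))))))

  deciders : ∀ {n} → FOFormula L n → List (Formula L n)
  deciders (s ≐′ t)   = dist s t ∷ []
  deciders (rel P ts) = rel P ts ∷ []
  deciders ⊥′         = []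
  deciders (φ ∧′ ψ)   = deciders φ ++ deciders ψ
  deciders (φ ∨′ ψ)   = deciders φ ++ deciders ψ
  deciders (φ ⇒′ ψ)   = deciders φ ++ deciders ψ
  deciders (∀′ φ)     = quantify (deciders φ)
  deciders (∃′ φ)     = quantify (deciders φ)

  ≐-value : ∀ {n} (p : FOPoint n) s t → Satisfies p (s ≐′ t) ⇔ (value p (dist s t) ≈ 0#)
  ≐-value p s t = mk⇔ (λ h → trans (sym d≈) (Metric.≈⇒0 h)) (λ h → Metric.0⇒≈ (trans d≈ h))
    where
    open Structure (model p) using (d; module Metric)
    open AsFirstOrder (model p) (fo p)
    d≈ : d (FOStructure.⟦_⟧ₜ (asFO (model p) (fo p)) s (tuple p))
           (FOStructure.⟦_⟧ₜ (asFO (model p) (fo p)) t (tuple p)) ≈ value p (dist s t)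
    d≈ = reflexive (≡.cong₂ d (term≡ s (tuple p)) (term≡ t (tuple p)))

  rel-value : ∀ {n} (p : FOPoint n) P ts → Satisfies p (rel P ts) ⇔ (value p (rel P ts) ≈ 1#)
  rel-value p P ts = mk⇔ (trans (sym ts≈)) (trans ts≈)
    where
    open Structure (model p) using (⟦_⟧ʳ)
    open AsFirstOrder (model p) (fo p)
    ts≈ : ⟦ P ⟧ʳ (FOStructure.⟦_⟧ₜₛ (asFO (model p) (fo p)) ts (tuple p)) ≈ value p (rel P ts)
    ts≈ = reflexive (≡.cong ⟦ P ⟧ʳ (terms≡ ts (tuple p)))

  agree⇒Sat : ∀ {n} (σ : FOFormula L n) p q → Agree p q (deciders σ) → Satisfies p σ → Satisfies q σ
  agree⇒Sat (s ≐′ t)   p q (agreeing (e ∷ [])) h =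
    Equivalence.from (≐-value q s t) (trans (sym e) (Equivalence.to (≐-value p s t) h))
  agree⇒Sat (rel P ts) p q (agreeing (e ∷ [])) h =
    Equivalence.from (rel-value q P ts) (trans (sym e) (Equivalence.to (rel-value p P ts) h))
  agree⇒Sat ⊥′         p q e ()
  agree⇒Sat (φ ∧′ ψ)   p q e (h , k)  = agree⇒Sat φ p q (proj₁ (agree-++ (deciders φ) e)) h ,
                                        agree⇒Sat ψ p q (proj₂ (agree-++ (deciders φ) e)) k
  agree⇒Sat (φ ∨′ ψ)   p q e (inj₁ h) = inj₁ (agree⇒Sat φ p q (proj₁ (agree-++ (deciders φ) e)) h)
  agree⇒Sat (φ ∨′ ψ)   p q e (inj₂ k) = inj₂ (agree⇒Sat ψ p q (proj₂ (agree-++ (deciders φ) e)) k)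
  agree⇒Sat (φ ⇒′ ψ)   p q e h k      = agree⇒Sat ψ p q (proj₂ (agree-++ (deciders φ) e))
    (h (agree⇒Sat φ q p (agree-sym p q (proj₁ (agree-++ (deciders φ) e))) k))
  agree⇒Sat (∀′ φ)     p q e h y =
    let (x , e′) = extend (deciders φ) q p (agree-sym p q e) y in agree⇒Sat φ (p ▸ x) (q ▸ y) (agree-sym (q ▸ y) (p ▸ x) e′) (h x)
  agree⇒Sat (∃′ φ)     p q e (x , h) =
    let (y , e′) = extend (deciders φ) p q e x in y , agree⇒Sat φ (p ▸ x) (q ▸ y) e′ h

-- First order definability of affine values

-- Affine formulas take finitely many values in first order structures, and
-- each set of values is first order definable.
module Translation (em : ∀ {ℓ} → ExcludedMiddle ℓ) {R : CompleteOrderedField} {L : Language R} where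
  open OrderedField em R
  open FiniteRange em {R} {L}

  -- Statements about real numbers alone do not depend on a structure, so they are decided outside
  -- and enter the formula as a constant.
  truth : ∀ {n} → Set → FOFormula L n
  truth X with em {P = X}
  ... | yes _ = ⊥′ ⇒′ ⊥′
  ... | no _  = ⊥′

  ⋁ : ∀ {n} → (Carrier → FOFormula L n) → List Carrier → FOFormula L n
  ⋁ φ []       = ⊥′
  ⋁ φ (v ∷ vs) = φ v ∨′ ⋁ φ vs

  cases : ∀ {n} → FOFormula L n → Set → Set → FOFormula L n
  cases φ X Y = (φ ∧′ truth X) ∨′ ((φ ⇒′ ⊥′) ∧′ truth Y)

  -- Infima in first order structures are minima, and being a minimum is first order: `w` is
  -- attained and is a lower bound. The finite list supplies the candidates.
  inf-translate : ∀ {n} → List Carrier → (Pred Carrier 0ℓ → FOFormula L (suc n)) → Pred Carrier 0ℓ → FOFormula L n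
  inf-translate vs τ Q = ⋁ (λ w → truth (Q w) ∧′ (∃′ (τ (_≈ w)) ∧′ ∀′ (τ (w ≤_)))) vs

  translate : ∀ {n} → Formula L n → Pred Carrier 0ℓ → FOFormula L n
  translate 𝟙          Q = truth (Q 1#)
  translate (rel P ts) Q = cases (rel P ts) (Q 1#) (Q 0#)
  translate (dist s t) Q = cases (s ≐′ t) (Q 0#) (Q 1#)
  translate (r · φ)    Q = translate φ (λ x → Q (r * x))
  translate (φ ⊕ ψ)    Q = ⋁ (λ w → translate φ (_≈ w) ∧′ translate ψ (λ x → Q (w + x))) (values φ)
  translate (inf φ)    Q = inf-translate (values φ) (translate φ) Q
  translate (sup φ)    Q = inf-translate (values ((- 1#) · φ)) (λ Q′ → translate φ (λ x → Q′ (- 1# * x)))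
                             (λ x → Q (- 1# * x))

  Respects : Pred Carrier 0ℓ → Set
  Respects Q = ∀ {x y} → x ≈ y → Q x → Q y

  module _ (𝓜 : Structure L) (fo : IsFirstOrder L 𝓜) where
    open Structure 𝓜 using (M)
    open Semantics 𝓜
    open StructureProperties em 𝓜
    open IsFirstOrder fo
    open ElementaryEquivalence em {R} {L} using (≐-value; rel-value)
    open FOStructure (asFO 𝓜 fo) using (Sat)

    truth⇔ : ∀ {n} {ρ : Vec M n} X → Sat (truth X) ρ ⇔ X
    truth⇔ X with em {P = X}
    ... | yes x = mk⇔ (λ _ → x) (λ _ ())
    ... | no ¬x = mk⇔ ⊥-elim ¬x

    ⋁⇔ : ∀ {n} {ρ : Vec M n} (φ : Carrier → FOFormula L n) vs → Sat (⋁ φ vs) ρ ⇔ Any (λ v → Sat (φ v) ρ) vs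
    ⋁⇔ φ []       = mk⇔ (λ ()) (λ ())
    ⋁⇔ φ (v ∷ vs) = mk⇔
      (λ { (inj₁ p) → here p ; (inj₂ q) → there (Equivalence.to (⋁⇔ φ vs) q) })
      (λ { (here p) → inj₁ p ; (there q) → inj₂ (Equivalence.from (⋁⇔ φ vs) q) })

    cases⇔ : ∀ {n} {ρ : Vec M n} {φ : FOFormula L n} {Q x u v} → Respects Q →
             (Sat φ ρ → x ≈ u) → (¬ Sat φ ρ → x ≈ v) → Sat (cases φ (Q u) (Q v)) ρ ⇔ Q x
    cases⇔ {ρ = ρ} {φ} {Q} {x} {u} {v} resp yes⇒ no⇒ = mk⇔ fwd bwd
      where
      fwd : Sat (cases φ (Q u) (Q v)) ρ → Q x
      fwd (inj₁ (p , q))  = resp (sym (yes⇒ p)) (Equivalence.to (truth⇔ (Q u)) q)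
      fwd (inj₂ (¬p , q)) = resp (sym (no⇒ ¬p)) (Equivalence.to (truth⇔ (Q v)) q)
      bwd : Q x → Sat (cases φ (Q u) (Q v)) ρ
      bwd q with em {P = Sat φ ρ}
      ... | yes p = inj₁ (p , Equivalence.from (truth⇔ (Q u)) (resp (yes⇒ p) q))
      ... | no ¬p = inj₂ (¬p , Equivalence.from (truth⇔ (Q v)) (resp (no⇒ ¬p) q))

    Translates : ∀ {n} → (Pred Carrier 0ℓ → FOFormula L n) → Formula L n → Set₁
    Translates τ φ = ∀ Q → Respects Q → ∀ ρ → Sat (τ Q) ρ ⇔ Q (⟦ φ ⟧ ρ)

    inf-translate⇔ : ∀ {n τ} (φ : Formula L (suc n)) → Translates τ φ →
                     Translates (inf-translate (values φ) τ) (inf φ)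
    inf-translate⇔ {τ = τ} φ h Q resp ρ = mk⇔
      (λ p → fwd (Any.satisfied (Equivalence.to (⋁⇔ component (values φ)) p)))
      (λ q → Equivalence.from (⋁⇔ component (values φ)) (bwd q))
      where
      component : Carrier → FOFormula L _
      component w = truth (Q w) ∧′ (∃′ (τ (_≈ w)) ∧′ ∀′ (τ (w ≤_)))
      below⇔ : ∀ w m → Sat (τ (w ≤_)) (m ∷ ρ) ⇔ (w ≤ ⟦ φ ⟧ (m ∷ ρ))
      below⇔ w m = h (w ≤_) (λ e p → ≤-resp refl e p) (m ∷ ρ)
      equal⇔ : ∀ w m → Sat (τ (_≈ w)) (m ∷ ρ) ⇔ (⟦ φ ⟧ (m ∷ ρ) ≈ w)
      equal⇔ w m = h (_≈ w) (λ e p → trans (sym e) p) (m ∷ ρ)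
      fwd : ∃[ w ] Sat (component w) ρ → Q (⟦ inf φ ⟧ ρ)
      fwd (w , q , (m , e) , l) = resp
        (antisym (≤inf φ ρ λ k → Equivalence.to (below⇔ w k) (l k))
                 (≤-trans (inf≤ φ ρ m) (≤-reflexive (Equivalence.to (equal⇔ w m) e))))
        (Equivalence.to (truth⇔ (Q w)) q)
      bwd : Q (⟦ inf φ ⟧ ρ) → Any (λ w → Sat (component w) ρ) (values φ)
      bwd q = let (m , e) = inf-attained 𝓜 fo φ ρ in Any.map
        (λ {w} e′ → Equivalence.from (truth⇔ (Q w)) (resp (trans e e′) q) ,
                    (m , Equivalence.from (equal⇔ w m) e′) ,
                    λ k → Equivalence.from (below⇔ w k)
                            (≤-trans (≤-reflexive (sym (trans e e′))) (inf≤ φ ρ k)))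
        (∈values 𝓜 fo φ (m ∷ ρ))

    scale-translate⇔ : ∀ {n τ} r (φ : Formula L n) → Translates τ φ →
                       Translates (λ Q → τ (λ x → Q (r * x))) (r · φ)
    scale-translate⇔ r φ h Q resp ρ = h (λ x → Q (r * x)) (λ e → resp (*-congˡ e)) ρ

    translate⇔ : ∀ {n} (φ : Formula L n) → Translates (translate φ) φ
    translate⇔ 𝟙          Q resp ρ = truth⇔ (Q 1#)
    translate⇔ (rel P ts) Q resp ρ = cases⇔ {φ = rel P ts} resp (Equivalence.to rel⇔) (zero-if (rel-binary P _))
      where
      rel⇔ = rel-value (record { model = 𝓜 ; fo = fo ; tuple = ρ }) P ts
      zero-if : (⟦ rel P ts ⟧ ρ ≈ 0#) ⊎ (⟦ rel P ts ⟧ ρ ≈ 1#) → ¬ Sat (rel P ts) ρ → ⟦ rel P ts ⟧ ρ ≈ 0#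
      zero-if (inj₁ e) _  = e
      zero-if (inj₂ e) ¬p = contradiction (Equivalence.from rel⇔ e) ¬p
    translate⇔ (dist s t) Q resp ρ = cases⇔ {φ = s ≐′ t} resp (Equivalence.to ≐⇔) (one-if (d-discrete _ _))
      where
      ≐⇔ = ≐-value (record { model = 𝓜 ; fo = fo ; tuple = ρ }) s t
      one-if : (⟦ dist s t ⟧ ρ ≈ 0#) ⊎ (⟦ dist s t ⟧ ρ ≈ 1#) → ¬ Sat (s ≐′ t) ρ → ⟦ dist s t ⟧ ρ ≈ 1#
      one-if (inj₁ e) ¬p = contradiction (Equivalence.from ≐⇔ e) ¬p
      one-if (inj₂ e) _  = e
    translate⇔ (r · φ)    = scale-translate⇔ {τ = translate φ} r φ (translate⇔ φ)
    translate⇔ (φ ⊕ ψ)    Q resp ρ = mk⇔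
      (λ p → fwd (Any.satisfied (Equivalence.to (⋁⇔ component (values φ)) p)))
      (λ q → Equivalence.from (⋁⇔ component (values φ)) (bwd q))
      where
      component : Carrier → FOFormula L _
      component w = translate φ (_≈ w) ∧′ translate ψ (λ x → Q (w + x))
      left⇔ : ∀ w → Sat (translate φ (_≈ w)) ρ ⇔ (⟦ φ ⟧ ρ ≈ w)
      left⇔ w = translate⇔ φ (_≈ w) (λ e p → trans (sym e) p) ρ
      right⇔ : ∀ w → Sat (translate ψ (λ x → Q (w + x))) ρ ⇔ Q (w + ⟦ ψ ⟧ ρ)
      right⇔ w = translate⇔ ψ (λ x → Q (w + x)) (λ e → resp (+-congˡ e)) ρ
      fwd : ∃[ w ] Sat (component w) ρ → Q (⟦ φ ⊕ ψ ⟧ ρ)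
      fwd (w , p , q) = resp (+-congʳ (sym (Equivalence.to (left⇔ w) p))) (Equivalence.to (right⇔ w) q)
      bwd : Q (⟦ φ ⊕ ψ ⟧ ρ) → Any (λ w → Sat (component w) ρ) (values φ)
      bwd q = Any.map (λ {w} e → Equivalence.from (left⇔ w) e , Equivalence.from (right⇔ w) (resp (+-congʳ e) q))
                (∈values 𝓜 fo φ ρ)
    translate⇔ (inf φ)    = inf-translate⇔ {τ = translate φ} φ (translate⇔ φ)
    translate⇔ (sup φ)    Q resp ρ = mk⇔
      (λ p → resp (sym (⟦sup⟧≈ φ ρ)) (Equivalence.to neg⇔ p))
      (λ q → Equivalence.from neg⇔ (resp (⟦sup⟧≈ φ ρ) q))
      where
      neg⇔ : Sat (translate (sup φ) Q) ρ ⇔ Q (⟦ (- 1#) · inf ((- 1#) · φ) ⟧ ρ)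
      neg-translate : Pred Carrier 0ℓ → FOFormula L (suc _)
      neg-translate Q′ = translate φ (λ x → Q′ (- 1# * x))
      neg⇔ = scale-translate⇔ {τ = inf-translate (values ((- 1#) · φ)) neg-translate} (- 1#) (inf ((- 1#) · φ))
        (inf-translate⇔ {τ = neg-translate} ((- 1#) · φ)
          (scale-translate⇔ {τ = translate φ} (- 1#) φ (translate⇔ φ))) Q resp ρ

-- Ordinary first order structures as discrete metric structures

∀* : {R : CompleteOrderedField} {L : Language R} → ∀ n → FOFormula L n → FOSentence L
∀* zero    φ = φ
∀* (suc n) φ = ∀* n (∀′ φ)

module Constancy {R : CompleteOrderedField} {L : Language R} where
  open Language L

  -- Two disjoint blocks of variables, to speak about two independent argument tuples.
  left right : ∀ k → Vec (Term L (k ℕ.+ k)) k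
  left  k = Vec.tabulate λ i → var (i ↑ˡ k)
  right k = Vec.tabulate λ i → var (k ↑ʳ i)

  -- The trace left in first order logic by a Lipschitz constant below 1. Holding in `𝓜₀`, it passes
  -- to every model of its theory and secures the Lipschitz condition there.
  function-constant : Fun → FOSentence L
  function-constant F = ∀* (k ℕ.+ k) (fun F (left k) ≐′ fun F (right k))
    where k = arityᶠ F

  relation-constant : Rel′ → FOSentence L
  relation-constant P = ∀* (k ℕ.+ k) (rel P (left k) ⇒′ rel P (right k))
    where k = arityʳ P

  module _ (𝓐 : FOStructure L) where
    open FOStructure 𝓐

    ∀*-intro : ∀ n (φ : FOFormula L n) → (∀ ρ → Sat φ ρ) → Sat (∀* n φ) []
    ∀*-intro zero    φ h = h []
    ∀*-intro (suc n) φ h = ∀*-intro n (∀′ φ) λ ρ a → h (a ∷ ρ)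

    ∀*-elim : ∀ {n} (φ : FOFormula L n) → Sat (∀* n φ) [] → ∀ ρ → Sat φ ρ
    ∀*-elim φ h []      = h
    ∀*-elim φ h (a ∷ ρ) = ∀*-elim (∀′ φ) h ρ a

    ⟦tabulate-var⟧ : ∀ {n k} (f : Fin k → Fin n) ρ →
                     ⟦ Vec.tabulate (λ i → var (f i)) ⟧ₜₛ ρ ≡ Vec.tabulate (λ i → lookup ρ (f i))
    ⟦tabulate-var⟧ {k = zero}  f ρ = ≡.refl
    ⟦tabulate-var⟧ {k = suc k} f ρ = ≡.cong (lookup ρ (f zero) ∷_) (⟦tabulate-var⟧ (λ i → f (suc i)) ρ)

    ⟦left⟧ : ∀ {k} (xs ys : Vec A k) → ⟦ left k ⟧ₜₛ (xs Vec.++ ys) ≡ xs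
    ⟦left⟧ {k} xs ys = ≡.trans (⟦tabulate-var⟧ (_↑ˡ k) (xs Vec.++ ys))
      (≡.trans (Vec.tabulate-cong (Vec.lookup-++ˡ xs ys)) (Vec.tabulate∘lookup xs))

    ⟦right⟧ : ∀ {k} (xs ys : Vec A k) → ⟦ right k ⟧ₜₛ (xs Vec.++ ys) ≡ ys
    ⟦right⟧ {k} xs ys = ≡.trans (⟦tabulate-var⟧ (k ↑ʳ_) (xs Vec.++ ys))
      (≡.trans (Vec.tabulate-cong (Vec.lookup-++ʳ xs ys)) (Vec.tabulate∘lookup ys))

    function-constant-intro : ∀ F → (∀ xs ys → funᴬ F xs ≈ₐ funᴬ F ys) → Sat (function-constant F) []
    function-constant-intro F h = ∀*-intro _ (fun F (left _) ≐′ fun F (right _)) λ ρ → h _ _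

    function-constant-elim : ∀ F → Sat (function-constant F) [] → ∀ xs ys → funᴬ F xs ≈ₐ funᴬ F ys
    function-constant-elim F h xs ys = ≡.subst₂ (λ us vs → funᴬ F us ≈ₐ funᴬ F vs) (⟦left⟧ xs ys) (⟦right⟧ xs ys)
      (∀*-elim (fun F (left _) ≐′ fun F (right _)) h (xs Vec.++ ys))

    relation-constant-intro : ∀ P → (∀ xs ys → relᴬ P xs → relᴬ P ys) → Sat (relation-constant P) []
    relation-constant-intro P h = ∀*-intro _ (rel P (left _) ⇒′ rel P (right _)) λ ρ → h _ _

    relation-constant-elim : ∀ P → Sat (relation-constant P) [] → ∀ xs ys → relᴬ P xs → relᴬ P ys
    relation-constant-elim P h xs ys = ≡.subst₂ (λ us vs → relᴬ P us → relᴬ P vs) (⟦left⟧ xs ys) (⟦right⟧ xs ys)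
      (∀*-elim (rel P (left _) ⇒′ rel P (right _)) h (xs Vec.++ ys))

-- Any tuple is reached from any other by changing one coordinate at a time, in
-- steps of length at most 1; a Lipschitz constant below 1 thus forbids any change
-- of a {0,1}-valued quantity.
module Rigidity (em : ∀ {ℓ} → ExcludedMiddle ℓ) {R : CompleteOrderedField} {L : Language R}
                (𝓜 : Structure L) (fo : IsFirstOrder L 𝓜) where
  open OrderedField em R
  open Language L
  open Structure 𝓜
  open StructureProperties em 𝓜
  open IsFirstOrder fo

  unit-steps : ∀ {k} (E : Rel (Vec M k) 0ℓ) → Transitive E → (∀ xs ys → dⁿ xs ys ≤ 1# → E xs ys) →
               ∀ xs ys → E xs ys
  unit-steps E E-trans step []       []       = step [] [] 0≤1
  unit-steps E E-trans step (x ∷ xs) (y ∷ ys) = E-trans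
    (step (x ∷ xs) (y ∷ xs) (≤-resp (sym (trans (+-congˡ (dⁿ-refl xs)) (+-identityʳ _))) refl (d≤1 x y)))
    (unit-steps (λ us vs → E (y ∷ us) (y ∷ vs)) E-trans
      (λ us vs p → step (y ∷ us) (y ∷ vs) (≤-resp (sym (trans (+-congʳ (d-refl y)) (+-identityˡ _))) refl p)) xs ys)
    where
    dⁿ-refl : ∀ {n} (us : Vec M n) → dⁿ us us ≈ 0#
    dⁿ-refl []       = refl
    dⁿ-refl (u ∷ us) = trans (+-cong (d-refl u) (dⁿ-refl us)) (+-identityˡ 0#)

  function-rigid : ∀ F → ¬ (1# ≤ lipᶠ F) → ∀ xs ys → ⟦ F ⟧ᶠ xs ≈ₘ ⟦ F ⟧ᶠ ys
  function-rigid F 1≰λ = unit-steps _ Metric.EqC.trans λ xs ys p → Metric.0⇒≈ (small⇒0 xs ys p (d-discrete _ _))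
    where
    small⇒0 : ∀ xs ys → dⁿ xs ys ≤ 1# → (d (⟦ F ⟧ᶠ xs) (⟦ F ⟧ᶠ ys) ≈ 0#) ⊎ (d (⟦ F ⟧ᶠ xs) (⟦ F ⟧ᶠ ys) ≈ 1#) →
           d (⟦ F ⟧ᶠ xs) (⟦ F ⟧ᶠ ys) ≈ 0#
    small⇒0 xs ys p (inj₁ e) = e
    small⇒0 xs ys p (inj₂ e) = contradiction (≤-resp e (*-identityʳ _)
      (≤-trans (lipschitzᶠ F xs ys) (*-monoˡ-≤ (lipᶠ≥0 F) p))) 1≰λ

  relation-rigid : ∀ P → ¬ (1# ≤ lipʳ P) → ∀ xs ys → ⟦ P ⟧ʳ xs ≈ 1# → ⟦ P ⟧ʳ ys ≈ 1#
  relation-rigid P 1≰λ = unit-steps (λ xs ys → ⟦ P ⟧ʳ xs ≈ 1# → ⟦ P ⟧ʳ ys ≈ 1#) (λ f g e → g (f e))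
    λ xs ys p e → one xs ys p e (rel-binary P ys)
    where
    one : ∀ xs ys → dⁿ xs ys ≤ 1# → ⟦ P ⟧ʳ xs ≈ 1# → (⟦ P ⟧ʳ ys ≈ 0#) ⊎ (⟦ P ⟧ʳ ys ≈ 1#) → ⟦ P ⟧ʳ ys ≈ 1#
    one xs ys p e (inj₂ e′) = e′
    one xs ys p e (inj₁ e′) = contradiction
      (≤-resp (trans (+-cong e (-‿cong e′)) (solve 0 (1ₚ :- 0ₚ := 1ₚ) refl)) (*-identityʳ _)
        (≤-trans (lipschitzʳ P xs ys) (*-monoˡ-≤ (lipʳ≥0 P) p))) 1≰λ

module DiscreteStructure (em : ∀ {ℓ} → ExcludedMiddle ℓ) {R : CompleteOrderedField} {L : Language R}
  (𝓐 : FOStructure L) where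
  open OrderedField em R hiding (isEquivalence)
  open Language L
  open FOStructure 𝓐
  private module ≈ₐ = IsEquivalence isEquivalence

  ⟪_⟫ : Set → Carrier
  ⟪ X ⟫ with em {P = X}
  ... | yes _ = 1#
  ... | no _  = 0#

  ⟪⟫-binary : ∀ X → (⟪ X ⟫ ≈ 0#) ⊎ (⟪ X ⟫ ≈ 1#)
  ⟪⟫-binary X with em {P = X}
  ... | yes _ = inj₂ refl
  ... | no _  = inj₁ refl

  ⟪⟫≈1⇔ : ∀ X → ⟪ X ⟫ ≈ 1# ⇔ X
  ⟪⟫≈1⇔ X with em {P = X}
  ... | yes x = mk⇔ (λ _ → x) (λ _ → refl)
  ... | no ¬x = mk⇔ (λ e → contradiction e 0≉1) (λ x → contradiction x ¬x)

  ⟪⟫≈0 : ∀ {X} → ¬ X → ⟪ X ⟫ ≈ 0#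
  ⟪⟫≈0 {X} ¬x with em {P = X}
  ... | yes x = contradiction x ¬x
  ... | no _  = refl

  ⟪⟫≥0 : ∀ X → 0# ≤ ⟪ X ⟫
  ⟪⟫≥0 X with em {P = X}
  ... | yes _ = 0≤1
  ... | no _  = ≤-refl

  ⟪⟫≤1 : ∀ X → ⟪ X ⟫ ≤ 1#
  ⟪⟫≤1 X with em {P = X}
  ... | yes _ = ≤-refl
  ... | no _  = 0≤1

  ⟪⟫-mono : ∀ {X Y} → (X → Y) → ⟪ X ⟫ ≤ ⟪ Y ⟫
  ⟪⟫-mono {X} {Y} f with em {P = X}
  ... | yes x = ≤-reflexive (sym (Equivalence.from (⟪⟫≈1⇔ Y) (f x)))
  ... | no _  = ⟪⟫≥0 Y

  distance : A → A → Carrier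
  distance x y = ⟪ ¬ (x ≈ₐ y) ⟫

  distance⇒≈ : ∀ {x y} → ¬ (1# ≤ distance x y) → x ≈ₐ y
  distance⇒≈ {x} {y} small with em {P = x ≈ₐ y}
  ... | yes p = p
  ... | no ¬p = contradiction (≤-reflexive (sym (Equivalence.from (⟪⟫≈1⇔ (¬ (x ≈ₐ y))) ¬p))) small

  ≈⇒distance : ∀ {x y} → x ≈ₐ y → distance x y ≈ 0#
  ≈⇒distance p = ⟪⟫≈0 λ ¬p → ¬p p

  1≰0 : ¬ (1# ≤ 0#)
  1≰0 p = 0≉1 (antisym 0≤1 p)

  1≰½ : ¬ (1# ≤ ½)
  1≰½ p = 1≰0 (≤-by-difference (≤-resp refl ½+½≈1 (+-mono-≤ p p))
    (solve 0 (0ₚ :- 1ₚ := 1ₚ :- (1ₚ :+ 1ₚ)) refl))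

  0<½ : 0# < ½
  0<½ = 0≤½ , λ e → 0≉1 (trans (sym (+-identityˡ 0#)) (trans (+-cong e e) ½+½≈1))

  triangle : ∀ x y z → distance x z ≤ distance x y + distance y z
  triangle x y z with em {P = x ≈ₐ y} | em {P = y ≈ₐ z}
  ... | yes p | yes q = ≤-trans (≤-reflexive (≈⇒distance (≈ₐ.trans p q)))
        (+-nonneg (⟪⟫≥0 (¬ (x ≈ₐ y))) (⟪⟫≥0 (¬ (y ≈ₐ z))))
  ... | no ¬p | _     = ≤-trans (⟪⟫≤1 (¬ (x ≈ₐ z))) (≤-trans
        (≤-reflexive (sym (Equivalence.from (⟪⟫≈1⇔ (¬ (x ≈ₐ y))) ¬p))) (0≤⇒≤+ (⟪⟫≥0 (¬ (y ≈ₐ z)))))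
  ... | _     | no ¬q = ≤-trans (⟪⟫≤1 (¬ (x ≈ₐ z))) (≤-trans
        (≤-reflexive (sym (Equivalence.from (⟪⟫≈1⇔ (¬ (y ≈ₐ z))) ¬q)))
        (≤-resp refl (+-comm _ _) (0≤⇒≤+ (⟪⟫≥0 (¬ (x ≈ₐ y))))))

  distance-mono : ∀ {x y x′ y′} → x ≈ₐ x′ → y ≈ₐ y′ → distance x y ≤ distance x′ y′
  distance-mono p q = ⟪⟫-mono λ ¬r r → ¬r (≈ₐ.trans p (≈ₐ.trans r (≈ₐ.sym q)))

  discrete : CompleteMetricSpace R
  discrete = record
    { M        = A
    ; _≈ₘ_     = _≈ₐ_
    ; point    = point
    ; d        = distance
    ; isMetric = record
      { isSemiMetric = record
        { isQuasiSemiMetric = record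
          { isPreMetric = record
            { isProtoMetric = record
              { isPartialOrder  = isPartialOrder
              ; ≈-isEquivalence = isEquivalence
              ; cong            = λ p q → antisym (distance-mono p q) (distance-mono (≈ₐ.sym p) (≈ₐ.sym q))
              ; nonNegative     = ⟪⟫≥0 _
              }
            ; ≈⇒0 = ≈⇒distance
            }
          ; 0⇒≈ = λ e → distance⇒≈ λ p → 1≰0 (≤-resp refl e p)
          }
        ; sym = λ x y → antisym (⟪⟫-mono λ ¬p q → ¬p (≈ₐ.sym q)) (⟪⟫-mono λ ¬p q → ¬p (≈ₐ.sym q))
        }
      ; triangle = triangle
      }
    ; d≤1      = λ x y → ⟪⟫≤1 _
    -- Distances are 0 or 1, so within one half the sequence is constant from `N` on.
    ; cauchy-complete = λ s cauchy → let (N , close) = cauchy 0<½ in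
        s N , λ 0<ε → N , λ i N≤i → ≤-trans
          (≤-reflexive (≈⇒distance (distance⇒≈ λ p → 1≰½ (≤-trans p (close i N N≤i ℕ.≤-refl)))))
          (proj₁ 0<ε)
    }

  open CompleteMetricSpace discrete using (dⁿ)

  dⁿ-nonneg : ∀ {n} (xs ys : Vec A n) → 0# ≤ dⁿ xs ys
  dⁿ-nonneg []       []       = ≤-refl
  dⁿ-nonneg (x ∷ xs) (y ∷ ys) = +-nonneg (⟪⟫≥0 _) (dⁿ-nonneg xs ys)

  -- The gap between 0 and 1 is what makes every Lipschitz constant of at least 1 harmless for a
  -- discrete structure.
  equal-or-apart : ∀ {n} (xs ys : Vec A n) → Pointwise _≈ₐ_ xs ys ⊎ (1# ≤ dⁿ xs ys)
  equal-or-apart []       []       = inj₁ []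
  equal-or-apart (x ∷ xs) (y ∷ ys) with em {P = x ≈ₐ y} | equal-or-apart xs ys
  ... | yes p | inj₁ ps = inj₁ (p ∷ ps)
  ... | _     | inj₂ q  = inj₂ (≤-trans q (≤-resp refl (+-comm _ _) (0≤⇒≤+ (⟪⟫≥0 _))))
  ... | no ¬p | inj₁ _  = inj₂ (≤-trans (≤-reflexive (sym (Equivalence.from (⟪⟫≈1⇔ (¬ (x ≈ₐ y))) ¬p)))
                                        (0≤⇒≤+ (dⁿ-nonneg xs ys)))

  module Interpretation
    (function-rigid : ∀ F → (1# ≤ lipᶠ F) ⊎ (∀ xs ys → funᴬ F xs ≈ₐ funᴬ F ys))
    (relation-rigid : ∀ P → (1# ≤ lipʳ P) ⊎ (∀ xs ys → relᴬ P xs → relᴬ P ys)) where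

    private
      lipschitz : ∀ {n} {x l} → 0# ≤ l → x ≤ 1# → (xs ys : Vec A n) →
                  (1# ≤ l) ⊎ (x ≤ 0#) → (Pointwise _≈ₐ_ xs ys → x ≤ 0#) → x ≤ l * dⁿ xs ys
      lipschitz 0≤l x≤1 xs ys (inj₂ x≤0) _ = ≤-trans x≤0 (*-nonneg 0≤l (dⁿ-nonneg xs ys))
      lipschitz {l = l} 0≤l x≤1 xs ys (inj₁ 1≤l) h with equal-or-apart xs ys
      ... | inj₁ ps  = ≤-trans (h ps) (*-nonneg 0≤l (dⁿ-nonneg xs ys))
      ... | inj₂ 1≤d = ≤-trans x≤1 (≤-trans 1≤l (≤-resp (*-identityʳ l) refl (*-monoˡ-≤ 0≤l 1≤d)))

      difference≤0 : ∀ {x y} → x ≤ y → x - y ≤ 0#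
      difference≤0 {x} {y} p = ≤-sub (≤-trans p (≤-reflexive (sym (+-identityˡ y))))

    structure : Structure L
    structure = record
      { space      = discrete
      ; ⟦_⟧ᶜ       = constᴬ
      ; ⟦_⟧ᶠ       = funᴬ
      ; ⟦_⟧ʳ       = λ P xs → ⟪ relᴬ P xs ⟫
      ; lipschitzᶠ = λ F xs ys → lipschitz (lipᶠ≥0 F) (⟪⟫≤1 _) xs ys
          (Sum.map₂ (λ h → ≤-reflexive (≈⇒distance (h xs ys))) (function-rigid F))
          (λ ps → ≤-reflexive (≈⇒distance (fun-cong F ps)))
      ; lipschitzʳ = λ P xs ys → lipschitz (lipʳ≥0 P)
          (≤-trans (≤-sub {b = ⟪ relᴬ P ys ⟫} (0≤⇒≤+ (⟪⟫≥0 _))) (⟪⟫≤1 _)) xs ys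
          (Sum.map₂ (λ h → difference≤0 (⟪⟫-mono (h xs ys))) (relation-rigid P))
          (λ ps → difference≤0 (⟪⟫-mono (rel-resp P ps)))
      ; 0≤rel      = λ P xs → ⟪⟫≥0 _
      ; rel≤1      = λ P xs → ⟪⟫≤1 _
      }

    firstOrder : IsFirstOrder L structure
    firstOrder = record { d-discrete = λ x y → ⟪⟫-binary _ ; rel-binary = λ P xs → ⟪⟫-binary _ }

    isomorphic : asFO structure firstOrder ≅ 𝓐
    isomorphic = record
      { to         = id
      ; congruent  = id
      ; injective  = id
      ; surjective = λ y → y , id
      ; const-homo = λ c → ≈ₐ.refl
      ; fun-homo   = λ F xs → ≈ₐ.reflexive (≡.cong (funᴬ F) (≡.sym (Vec.map-id xs)))
      ; rel-homo   = λ P xs → ≡.subst (λ ys → (⟪ relᴬ P xs ⟫ ≈ 1#) ⇔ relᴬ P ys) (≡.sym (Vec.map-id xs))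
                                (⟪⟫≈1⇔ (relᴬ P xs))
      }

-- The extremal theory and its models

module ExtremalTheory (em : ∀ {ℓ} → ExcludedMiddle ℓ) {R : CompleteOrderedField} {L : Language R}
  {T : Theory L} (T-complete : Complete T)
  (𝓜₀ : Structure L) (fo₀ : IsFirstOrder L 𝓜₀) (𝓜₀⊨T : 𝓜₀ ⊨ T) where
  open OrderedField em R
  open Language L
  open CompleteTheory em T-complete
  open ElementaryEquivalence em {R} {L}
  open Translation em {R} {L}
  open Constancy {R} {L}
  open FOStructure using (Sat)

  𝓐₀ : FOStructure L
  𝓐₀ = asFO 𝓜₀ fo₀

  extremalTheory : FOTheory L
  extremalTheory σ = Sat 𝓐₀ σ []

  extremalTheory-complete : FOComplete extremalTheory
  extremalTheory-complete = (𝓐₀ , id) , decide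
    where
    decide : ∀ σ → (extremalTheory ⊩ᶠᵒ σ) ⊎ (extremalTheory ⊩ᶠᵒ (σ ⇒′ ⊥′))
    decide σ with em {P = Sat 𝓐₀ σ []}
    ... | yes p = inj₁ λ 𝓐 h → h {σ} p
    ... | no ¬p = inj₂ λ 𝓐 h → h {σ ⇒′ ⊥′} ¬p

  -- The deciders of a first order sentence are affine sentences, and any two models of `T` agree on
  -- all of those.
  model⇒⊨ : ∀ 𝓜 (fo : IsFirstOrder L 𝓜) → 𝓜 ⊨ T → ∀ {𝓐} → asFO 𝓜 fo ≅ 𝓐 → 𝓐 ⊨ᶠᵒ extremalTheory
  model⇒⊨ 𝓜 fo 𝓜⊨T {𝓐} iso {σ} p = Isomorphism.preserved iso σ []
    (agree⇒Sat σ (record { model = 𝓜₀ ; fo = fo₀ ; tuple = [] }) (record { model = 𝓜 ; fo = fo ; tuple = [] })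
      (agreeing (All.tabulate λ {φ} _ → sentences-agree 𝓜₀⊨T 𝓜⊨T φ)) p)

  module _ (𝓐 : FOStructure L) (𝓐⊨ : 𝓐 ⊨ᶠᵒ extremalTheory) where

    function-rigid : ∀ F → (1# ≤ lipᶠ F) ⊎ (∀ xs ys → FOStructure._≈ₐ_ 𝓐 (FOStructure.funᴬ 𝓐 F xs) (FOStructure.funᴬ 𝓐 F ys))
    function-rigid F with em {P = 1# ≤ lipᶠ F}
    ... | yes p = inj₁ p
    ... | no ¬p = inj₂ (function-constant-elim 𝓐 F (𝓐⊨ {function-constant F}
          (function-constant-intro 𝓐₀ F (Rigidity.function-rigid em 𝓜₀ fo₀ F ¬p))))

    relation-rigid : ∀ P → (1# ≤ lipʳ P) ⊎ (∀ xs ys → FOStructure.relᴬ 𝓐 P xs → FOStructure.relᴬ 𝓐 P ys)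
    relation-rigid P with em {P = 1# ≤ lipʳ P}
    ... | yes p = inj₁ p
    ... | no ¬p = inj₂ (relation-constant-elim 𝓐 P (𝓐⊨ {relation-constant P}
          (relation-constant-intro 𝓐₀ P (Rigidity.relation-rigid em 𝓜₀ fo₀ P ¬p))))

    open DiscreteStructure.Interpretation em 𝓐 function-rigid relation-rigid

    -- That `φ` has the value `r` is expressed by `translate φ (_≈ r)`. This sentence holds in `𝓜₀`,
    -- so it belongs to the extremal theory, holds in `𝓐`, and returns along the isomorphism.
    sentence-value : ∀ (φ : Sentence L) → Semantics.⟦_⟧ structure φ [] ≈ Semantics.⟦_⟧ 𝓜₀ φ []
    sentence-value φ = Equivalence.to (translate⇔ structure firstOrder φ (_≈ r) (λ e p → trans (sym e) p) [])
      (Isomorphism.reflected isomorphic (translate φ (_≈ r)) [] (𝓐⊨ {translate φ (_≈ r)}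
        (Equivalence.from (translate⇔ 𝓜₀ fo₀ φ (_≈ r) (λ e p → trans (sym e) p) []) refl)))
      where
      r : Carrier
      r = Semantics.⟦_⟧ 𝓜₀ φ []

    ⊨⇒model : Σ (Structure L) λ 𝓜 → Σ (IsFirstOrder L 𝓜) λ fo → (𝓜 ⊨ T) × (asFO 𝓜 fo ≅ 𝓐)
    ⊨⇒model = structure , firstOrder ,
      (λ { {φ ≼ ψ} c∈T → ≤-resp (sym (sentence-value φ)) (sym (sentence-value ψ)) (𝓜₀⊨T {φ ≼ ψ} c∈T) }) ,
      isomorphic

mainTheorem1 : (∀ {ℓ} → ExcludedMiddle ℓ) →
    (∀ {a b} → Extensionality a b) →
    (R : CompleteOrderedField) (L : Language R) (T : Theory L) →
    Complete T →
    (Σ (Structure L) λ 𝓜 → IsFirstOrder L 𝓜 × (𝓜 ⊨ T)) →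
    ((𝓜 : Structure L) (𝓜⊨T : 𝓜 ⊨ T) → IsFirstOrder L 𝓜 ⇔ Extremal T 𝓜 𝓜⊨T)
    × (Σ (FOTheory L) λ Tₑ → FOComplete Tₑ ×
    ((𝓐 : FOStructure L) → (𝓐 ⊨ᶠᵒ Tₑ) ⇔ (Σ (Structure L) λ 𝓜 → Σ (IsFirstOrder L 𝓜) λ fo → (𝓜 ⊨ T) × (asFO 𝓜 fo ≅ 𝓐))))
mainTheorem1 em ext R L T T-complete (𝓜₀ , fo₀ , 𝓜₀⊨T) =
  (λ 𝓜 𝓜⊨T → mk⇔ (FirstOrderExtreme.firstOrder⇒extremal em T 𝓜 𝓜⊨T)
                   (ExtremalModels.extremal⇒firstOrder em ext T-complete {𝓜₀} fo₀ 𝓜₀⊨T {𝓜} 𝓜⊨T)) ,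
  extremalTheory , extremalTheory-complete ,
  λ 𝓐 → mk⇔ (λ h → ⊨⇒model 𝓐 (λ {σ} → h {σ})) (λ (𝓜 , fo , 𝓜⊨T , iso) {σ} → model⇒⊨ 𝓜 fo 𝓜⊨T iso {σ})
  where open ExtremalTheory em T-complete 𝓜₀ fo₀ 𝓜₀⊨T
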